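{- Let $k\ge 1$ and $n\ge 2k+3$. Then $\mathrm{Grob}_k(n)\subset\mathbb{R}^{\binom{[n]}{2}}$ is a simplicial cone with a lineality space of dimension $n$ (that is, it is the sum of an $n$-dimensional linear subspace and a cone that is simplicial modulo that subspace). More precisely: (1) $\mathrm{Grob}_k(n)$ is generated by the following vectors and lines: (a) (lineality space) for each $i\in[n]$, the line spanned by the indicator vector of the set $\{\{i,j\}: j\in[n]\setminus\{i\}\}$; (b) ("short" generators) for each $\{i,j\}\in\binom{[n]}{2}$ with $1\le |i-j|\le k$, the negative $-V_{i,j}$ of the standard basis vector corresponding to $\{i,j\}$; (c) ("long" generators) for each $\{i,j\}\in\binom{[n]}{2}$ with $|i-j|\ge k+2$, the ray $W_{i,j}$ of $\mathrm{FP}_n$ corresponding to $\{i,j\}$. (2) An irredundant facet description of $\mathrm{Grob}_k(n)$ is given by the following $\binom{n}{2}-n$ inequalities, where $s_{a,b}(v):=v_{a,b}+v_{a+1,b+1}-v_{a,b+1}-v_{a+1,b}$: (a) ("long" inequalities) for each $\{i,j\}\in\binom{[n]}{2}$ with $|i-j|\ge k+1$, the inequality $s_{i,j}(v)\ge 0$; (b) ("short" inequalities) for each $\{i,j\}\in\binom{[n]}{2}$ with $2\le|i-j|\le k$, the inequality $\sum s_{i',j'}(v)\ge 0$, where the sum runs over all $\{i',j'\}\in\binom{[n]}{2}$ with $|i'-j'|\le k+1$ and with $\{i,j\}$ contained in the short side of $\{i',j'\}$. In particular, $\mathrm{FP}_n\subset \mathrm{Grob}_k(n)$.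
   Context: Here $[n]=\{1,\dots,n\}$ is identified with $\mathbb{Z}/n$, indices are taken modulo $n$, and $|i-j|$ denotes cyclic distance, i.e. the minimum of the two residues of $i-j$ and $j-i$ in $\{0,\dots,n-1\}$. Vectors $v\in\mathbb{R}^{\binom{[n]}{2}}$ have coordinates $v_{i,j}=v_{j,i}$ indexed by two-element subsets of $[n]$; $V_{i,j}$ is the standard basis vector. Edges $\{i,j\},\{i',j'\}$ with $i<j$, $i'<j'$ cross if $i<i'<j<j'$ or $i'<i<j'<j$. A $(k+1)$-crossing is a set of $k+1$ mutually crossing edges. Each $U\subset[n]$ with $|U|=2k+2$ has exactly one perfect matching that is a $(k+1)$-crossing. The Pfaffian of degree $k+1$ of $U$ is $\sum_E(-1)^{\mathrm{cr}(E)}\prod_{\{i,j\}\in E}x_{i,j}$, over all perfect matchings $E$ of $U$, where $\mathrm{cr}(E)$ is the number of crossing pairs in $E$. $\mathrm{Grob}_k(n)$ is the set of $v\in\mathbb{R}^{\binom{[n]}{2}}$ such that, for every $U\subset[n]$ of size $2k+2$, the maximum of $\sum_{\{i,j\}\in E}v_{i,j}$ over perfect matchings $E$ of $U$ is attained at (possibly among others) the $(k+1)$-crossing of $U$. $\mathrm{FP}_n$ is the set of $v$ with $v_{a,b}+v_{a',b'}\ge\max\{v_{a,a'}+v_{b,b'},\,v_{a,b'}+v_{a',b}\}$ for all $1\le a<a'<b<b'\le n$. It is irredundantly described by the linearly independent inequalities $s_{a,b}(v)\ge0$ for $\{a,b\}$ with $|a-b|>1$. Its ray corresponding to $\{i,j\}$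 ($|i-j|>1$) is, modulo the lineality space, the one at which all these inequalities except that of $\{i,j\}$ are equalities; it is represented by the vector $W_{i,j}$ whose $\{a,b\}$-coordinate is $1$ if exactly one of $a,b$ lies in the cyclic interval $\{i+1,i+2,\dots,j\}$ and is $0$ otherwise. For $|i'-j'|\le k+1$, name the endpoints so that $j'=i'+|i'-j'|$ (mod $n$); the short side of $\{i',j'\}$ is the cyclic interval $\{i',i'+1,\dots,j'\}$. -}

module Defs where

open import Level using (Level; _⊔_; 0ℓ) renaming (suc to lsuc)
open import Algebra.Bundles using (CommutativeRing)
open import Algebra.Structures using (IsCommutativeRing)
open import Data.Bool.Base using (Bool; if_then_else_; _xor_)
open import Data.Fin.Base using (Fin; toℕ; _<_)
open import Data.Fin.Properties using (<-cmp; _≟_; _<?_)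
open import Data.Fin.Subset using (Subset; ∣_∣) renaming (_∈_ to _∈ₛ_)
open import Data.List.Base using (List; []; _∷_; _++_; map; mapMaybe; filter; foldr; concatMap; cartesianProduct; allFin; length)
open import Data.List.Membership.Propositional using (_∈_)
open import Data.List.Relation.Unary.All using (All)
open import Data.List.Relation.Unary.AllPairs using (AllPairs)
open import Data.List.Relation.Unary.Unique.Propositional using (Unique)
open import Data.Maybe.Base using (Maybe; just; nothing)
open import Data.Nat.Base as ℕ using (ℕ; suc; _⊓_; _∸_)
open import Data.Nat.DivMod using (_%_; _mod_)
import Data.Nat.Properties as ℕₚ
open import Data.Product.Base using (Σ; ∃; ∃-syntax; Σ-syntax; _×_; _,_)
open import Data.Sum.Base using (_⊎_; inj₁; inj₂; [_,_]′)
open import Function.Bundles using (_⇔_)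
open import Relation.Binary.Core using (Rel)
open import Relation.Binary.Definitions using (tri<; tri≈; tri>)
open import Relation.Binary.PropositionalEquality using (_≡_; _≢_)
open import Relation.Binary.Structures using (IsTotalOrder)
open import Relation.Nullary using (¬_; Dec; does; yes; no)
open import Relation.Nullary.Decidable using (_×-dec_; _⊎-dec_)
open import Relation.Unary using (Pred; _≐_)

-- The cones below live in a coordinate space over an arbitrary ordered field;
-- the real numbers are the intended instance.

record OrderedField (c ℓ₁ ℓ₂ : Level) : Set (lsuc (c ⊔ ℓ₁ ⊔ ℓ₂)) where
  infix  8 -_
  infixl 7 _*_
  infixl 6 _+_
  infix  4 _≈_ _≤_
  field
    Carrier           : Set c
    _≈_               : Rel Carrier ℓ₁
    _≤_               : Rel Carrier ℓ₂
    _+_ _*_           : Carrier → Carrier → Carrier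
    -_                : Carrier → Carrier
    0# 1#             : Carrier
    isCommutativeRing : IsCommutativeRing _≈_ _+_ _*_ -_ 0# 1#
    isTotalOrder      : IsTotalOrder _≈_ _≤_
    1≉0               : ¬ (1# ≈ 0#)
    inverse           : ∀ x → ¬ (x ≈ 0#) → ∃[ y ] (x * y ≈ 1#)
    +-monoˡ-≤         : ∀ z {x y} → x ≤ y → x + z ≤ y + z
    *-nonNeg          : ∀ {x y} → 0# ≤ x → 0# ≤ y → 0# ≤ x * y

  commutativeRing : CommutativeRing c ℓ₁
  commutativeRing = record { isCommutativeRing = isCommutativeRing }

------------------------------------------------------------------------
-- Cyclic combinatorics of [n]; the vertex i ∈ {1,…,n} is the element of
-- Fin n with toℕ-value i − 1.

-- the residue of x − y in {0,…,n−1}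
_⊖_ : ∀ {n} → Fin n → Fin n → ℕ
_⊖_ {n@(suc _)} x y = ((n ℕ.+ toℕ x) ∸ toℕ y) % n

-- i + 1 modulo n
next : ∀ {n} → Fin n → Fin n
next {n@(suc _)} i = suc (toℕ i) mod n

-- x lies in the cyclic interval {p, p+1, …, q}
InInterval : ∀ {n} → Fin n → Fin n → Fin n → Set
InInterval p q x = (x ⊖ p) ℕ.≤ (q ⊖ p)

inInterval? : ∀ {n} (p q x : Fin n) → Dec (InInterval p q x)
inInterval? p q x = (x ⊖ p) ℕₚ.≤? (q ⊖ p)

record Edge (n : ℕ) : Set where
  constructor edge
  field
    lo hi  : Fin n
    .lo<hi : lo < hi
open Edge public

allEdges : ∀ n → List (Edge n)
allEdges n = mapMaybe fromPair (cartesianProduct (allFin n) (allFin n))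
  where
  fromPair : Fin n × Fin n → Maybe (Edge n)
  fromPair (i , j) with i <? j
  ... | yes i<j = just (edge i j i<j)
  ... | no  _   = nothing

_≡ᵉ?_ : ∀ {n} (e f : Edge n) → Dec (lo e ≡ lo f × hi e ≡ hi f)
e ≡ᵉ? f = (lo e ≟ lo f) ×-dec (hi e ≟ hi f)

-- the cyclic distance |i − j| of the endpoints
dist : ∀ {n} → Edge n → ℕ
dist e = (lo e ⊖ hi e) ⊓ (hi e ⊖ lo e)

-- The short side of an edge is the interval {p,…,q} for the naming p, q of its
-- endpoints with q = p + dist (unique when 2 · dist < n).
InShortSide : ∀ {n} → Edge n → Fin n → Set
InShortSide e x = ((hi e ⊖ lo e) ≡ dist e × InInterval (lo e) (hi e) x)
                ⊎ ((lo e ⊖ hi e) ≡ dist e × InInterval (hi e) (lo e) x)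

inShortSide? : ∀ {n} (e : Edge n) (x : Fin n) → Dec (InShortSide e x)
inShortSide? e x =
        (((hi e ⊖ lo e) ℕₚ.≟ dist e) ×-dec inInterval? (lo e) (hi e) x)
  ⊎-dec (((lo e ⊖ hi e) ℕₚ.≟ dist e) ×-dec inInterval? (hi e) (lo e) x)

Cross : ∀ {n} → Edge n → Edge n → Set
Cross e f = (lo e < lo f × lo f < hi e × hi e < hi f)
          ⊎ (lo f < lo e × lo e < hi f × hi f < hi e)

endpoints : ∀ {n} → List (Edge n) → List (Fin n)
endpoints = concatMap (λ e → lo e ∷ hi e ∷ [])

-- Sets of edges are given by lists; the order of the entries plays no role, and
-- uniqueness of the endpoints makes the edges distinct and disjoint.
IsPerfectMatching : ∀ {n} → Subset n → List (Edge n) → Set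
IsPerfectMatching U E = Unique (endpoints E) × (∀ x → x ∈ endpoints E ⇔ x ∈ₛ U)

IsCrossing : ∀ {n} → ℕ → List (Edge n) → Set
IsCrossing m E = length E ≡ m × AllPairs Cross E

module _ (n k : ℕ) where

  shortGeneratorEdges longGeneratorEdges : List (Edge n)
  shortGeneratorEdges = filter (λ e → (1 ℕₚ.≤? dist e) ×-dec (dist e ℕₚ.≤? k)) (allEdges n)
  longGeneratorEdges  = filter (λ e → k ℕ.+ 2 ℕₚ.≤? dist e) (allEdges n)

  longInequalityEdges shortInequalityEdges : List (Edge n)
  longInequalityEdges  = filter (λ e → k ℕ.+ 1 ℕₚ.≤? dist e) (allEdges n)
  shortInequalityEdges = filter (λ e → (2 ℕₚ.≤? dist e) ×-dec (dist e ℕₚ.≤? k)) (allEdges n)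

  -- the edges f with |f| ≤ k+1 whose short side contains the edge e
  enclosing : Edge n → List (Edge n)
  enclosing e = filter
    (λ f → (dist f ℕₚ.≤? k ℕ.+ 1) ×-dec (inShortSide? f (lo e) ×-dec inShortSide? f (hi e)))
    (allEdges n)

  -- index set of the facet inequalities: long ones on the left, short ones on the right
  inequalityIndices : List (Edge n ⊎ Edge n)
  inequalityIndices = map inj₁ longInequalityEdges ++ map inj₂ shortInequalityEdges

------------------------------------------------------------------------

module EdgeSpace {c ℓ₁ ℓ₂} (F : OrderedField c ℓ₁ ℓ₂) (n : ℕ) where

  open OrderedField F

  infix  8 ⊝_
  infixl 6 _⊕_ _⊞_
  infix  4 _≋_

  V : Set c
  V = Edge n → Carrier

  _≋_ : Rel V ℓ₁
  v ≋ w = ∀ e → v e ≈ w e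

  𝟎 : V
  𝟎 _ = 0#

  _⊕_ : V → V → V
  (v ⊕ w) e = v e + w e

  ⊝_ : V → V
  (⊝ v) e = - v e

  ∑ : ∀ {a} {A : Set a} → List A → (A → Carrier) → Carrier
  ∑ xs f = foldr (λ x acc → f x + acc) 0# xs

  [_]₀₁ : Bool → Carrier
  [ b ]₀₁ = if b then 1# else 0#

  -- v ⟨ i , j ⟩ is v_{i,j} = v_{j,i}; the value 0 at i = j is a dummy
  _⟨_,_⟩ : V → Fin n → Fin n → Carrier
  v ⟨ i , j ⟩ with <-cmp i j
  ... | tri< i<j _ _ = v (edge i j i<j)
  ... | tri≈ _ _ _   = 0#
  ... | tri> _ _ j<i = v (edge j i j<i)

  --------------------------------------------------------------------
  -- Cones.  Finite families of vectors are given by a duplicate-free list xs of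
  -- indices and a function g on the index type; coefficients outside xs are
  -- irrelevant.

  comb : {I : Set} → List I → (I → Carrier) → (I → V) → V
  comb xs a g e = ∑ xs (λ x → a x * g x e)

  Span : {I : Set} → List I → (I → V) → Pred V (c ⊔ ℓ₁)
  Span xs g v = ∃[ a ] (v ≋ comb xs a g)

  Cone : {I : Set} → List I → (I → V) → Pred V (c ⊔ ℓ₁ ⊔ ℓ₂)
  Cone xs g v = ∃[ a ] ((∀ x → 0# ≤ a x) × v ≋ comb xs a g)

  -- Minkowski sum
  _⊞_ : ∀ {p q} → Pred V p → Pred V q → Pred V (c ⊔ ℓ₁ ⊔ p ⊔ q)
  (P ⊞ Q) v = ∃[ p ] ∃[ q ] (P p × Q q × v ≋ p ⊕ q)

  -- linear independence modulo the subspace L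
  IndependentModulo : ∀ {p} → Pred V p → {I : Set} → List I → (I → V) → Set (c ⊔ p ⊔ ℓ₁)
  IndependentModulo L {I} xs g =
    Unique xs × (∀ (a : I → Carrier) → L (comb xs a g) → ∀ x → x ∈ xs → a x ≈ 0#)

  HasDimension : ∀ {p} → Pred V p → ℕ → Set (c ⊔ ℓ₁ ⊔ p)
  HasDimension P d =
    Σ[ b ∈ (Fin d → V) ] (IndependentModulo (_≋ 𝟎) (allFin d) b × P ≐ Span (allFin d) b)

  Lineality : ∀ {p} → Pred V p → Pred V p
  Lineality C v = C v × C (⊝ v)

  IsSimplicialModuloLineality : ∀ {p} → Pred V p → Set (lsuc 0ℓ ⊔ c ⊔ ℓ₁ ⊔ ℓ₂ ⊔ p)
  IsSimplicialModuloLineality C =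
    Σ[ I ∈ Set ] Σ[ xs ∈ List I ] Σ[ g ∈ (I → V) ]
      (IndependentModulo (Lineality C) xs g × C ≐ (Lineality C ⊞ Cone xs g))

  Describes : {I : Set} → List I → (I → V → Carrier) → ∀ {p} → Pred V p → Set (c ⊔ ℓ₂ ⊔ p)
  Describes xs φ C = C ≐ (λ v → All (λ x → 0# ≤ φ x v) xs)

  -- none of the inequalities 0 ≤ φ x can be dropped
  Irredundant : {I : Set} → List I → (I → V → Carrier) → Set (c ⊔ ℓ₂)
  Irredundant xs φ = ∀ x → x ∈ xs →
    ∃[ v ] ((∀ y → y ∈ xs → y ≢ x → 0# ≤ φ y v) × ¬ (0# ≤ φ x v))

  --------------------------------------------------------------------

  weight : V → List (Edge n) → Carrier
  weight v E = ∑ E v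

  -- Every U of size 2k+2 has exactly one crossing perfect matching X, and its
  -- weight is required to be maximal.
  Grob : ℕ → Pred V ℓ₂
  Grob k v = ∀ (U : Subset n) → ∣ U ∣ ≡ 2 ℕ.* k ℕ.+ 2 →
    ∀ X → IsPerfectMatching U X → IsCrossing (k ℕ.+ 1) X →
    ∀ E → IsPerfectMatching U E → weight v E ≤ weight v X

  FP : Pred V ℓ₂
  FP v = ∀ a a′ b b′ → a < a′ → a′ < b → b < b′ →
      (v ⟨ a , a′ ⟩ + v ⟨ b , b′ ⟩ ≤ v ⟨ a , b ⟩ + v ⟨ a′ , b′ ⟩)
    × (v ⟨ a , b′ ⟩ + v ⟨ a′ , b ⟩ ≤ v ⟨ a , b ⟩ + v ⟨ a′ , b′ ⟩)

  -- s e is symmetric in the two endpoints; it is only used for dist e ≥ 2, where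
  -- no dummy diagonal entry occurs.
  s : Edge n → V → Carrier
  s e v = v ⟨ a , b ⟩ + v ⟨ next a , next b ⟩ + - v ⟨ a , next b ⟩ + - v ⟨ next a , b ⟩
    where
    a = lo e
    b = hi e

  -- w represents the ray of FP corresponding to e
  IsRayOfFP : Edge n → V → Set (ℓ₁ ⊔ ℓ₂)
  IsRayOfFP e w = FP w × ¬ (s e w ≤ 0#) × (∀ f → 2 ℕ.≤ dist f → f ≢ e → s f w ≈ 0#)

  star : Fin n → V
  star i e = [ does ((lo e ≟ i) ⊎-dec (hi e ≟ i)) ]₀₁

  basis : Edge n → V
  basis e f = [ does (e ≡ᵉ? f) ]₀₁

  W : Edge n → V
  W e f = [ inside (lo f) xor inside (hi f) ]₀₁
    where
    inside : Fin n → Bool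
    inside x = does (inInterval? (next (lo e)) (hi e) x)

  inequality : ℕ → Edge n ⊎ Edge n → V → Carrier
  inequality k (inj₁ e) v = s e v
  inequality k (inj₂ e) v = ∑ (enclosing n k e) (λ f → s f v)

-- The vectors −V_f (|f| ≤ k) and W_e (|e| ≥ k+2) form, up to the factor 2 on the W_e, a basis
-- dual to the inequalities: s_e(W_f) = 2 δ_{ef}, and if {p , q} has length ≤ k+1, its inequality
-- telescopes to an expression Ψ whose only entry at an edge of length ≤ k is − v_{p+1,q}.
-- A vector on which all s_e vanish is a combination of stars, so every v equals a combination
-- of stars plus ∑ Ψ_{p,q}(v) (−V_{p+1,q}) + ½ ∑ s_e(v) W_e.
--
-- Each Ψ and each long s_e is a difference of weights of the crossing matching and of one
-- obtained by rotating partners, hence nonnegative on Grob.  Conversely the generators lie in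
-- Grob: an edge of a (k+1)-crossing has k edges across it, so its length is at least k+1;
-- and in a crossing matching no two edges lie on different sides of a cut by an interval, so
-- one of the sides has all its vertices cut off.

module Submission where

open import Defs
open import Level using (_⊔_)
open import Algebra.Bundles using (CommutativeRing)
import Algebra.Solver.Ring
open import Algebra.Solver.Ring.AlmostCommutativeRing using
    (fromCommutativeRing; _-Raw-AlmostCommutative⟶_)
open import Data.Bool.Base using (Bool; true; false; T; _xor_; not)
import Data.Bool.Properties
open import Data.Empty using (⊥; ⊥-elim)
open import Data.Fin.Base as Fin using (Fin; toℕ)
import Data.Fin.Properties as Finₚ
open import Data.Fin.Subset using (Subset; ∣_∣) renaming (_∈_ to _∈ₛ_)
open import Data.Fin.Subset.Properties using (∉⊥; ∣⊥∣≡0)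
open import Data.Integer.Base as ℤ using (ℤ; -[1+_])
import Data.Integer.Properties as ℤₚ
open import Data.List.Base using
    (List; []; _∷_; _++_; map; mapMaybe; filter; cartesianProduct; allFin; upTo; applyUpTo;
    zipWith; length)
open import Data.List.Membership.Propositional using (_∈_; lose; find)
open import Data.List.Membership.Propositional.Properties
open import Data.List.Membership.Propositional.Properties.WithK using (unique∧set⇒bag)
open import Data.List.Properties using
    (mapMaybe-cong; length-++; length-map; length-upTo; length-tabulate; length-zipWith)
open import Data.List.Relation.Binary.BagAndSetEquality using (∼bag⇒↭)
open import Data.List.Relation.Binary.Permutation.Propositional as Perm using
    (_↭_; ↭-sym; ↭-trans; ↭-refl; ↭-reflexive)
open import Data.List.Relation.Binary.Permutation.Propositional.Properties as Permₚ using
    (↭-length; ∈-resp-↭; All-resp-↭; shift)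
open import Data.List.Relation.Unary.All as All using (All; []; _∷_)
import Data.List.Relation.Unary.All.Properties as Allₚ
open import Data.List.Relation.Unary.AllPairs using (AllPairs; []; _∷_)
open import Data.List.Relation.Unary.Any as Any using (here; there)
open import Data.List.Relation.Unary.Unique.Propositional using (Unique)
import Data.List.Relation.Unary.Unique.Propositional.Properties as Uniqueₚ
open import Data.Maybe.Base as Maybe using (Maybe; just; nothing)
open import Data.Maybe.Relation.Unary.All as MaybeAll using (just; nothing)
open import Data.Nat.Base as ℕ using (ℕ; zero; suc; z≤n; s≤s; NonZero)
open import Data.Nat.Combinatorics using (_C_; nC1≡n; nCk+nC[k+1]≡[n+1]C[k+1])
import Data.Nat.Properties as ℕₚ
open import Data.Product.Base using (∃₂; Σ-syntax; ∃-syntax; _×_; _,_; proj₁; proj₂)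
import Data.Sign.Base as Sign
open import Data.Sum.Base as Sum using (_⊎_; inj₁; inj₂; [_,_]′)
open import Data.Unit.Base using (tt)
open import Data.Vec.Properties using ([]≔-updates; []≔-minimal; lookup⇒[]=; []=⇒lookup; lookup∘update′)
open import Function.Base using (id; _∘_)
open import Function.Bundles using (_⇔_; mk⇔; Equivalence)
open import Relation.Binary.Definitions using (tri<; tri≈; tri>; WeaklyDecidable)
open import Relation.Binary.PropositionalEquality as ≡ using (_≡_; _≢_; cong; cong₂; subst; subst₂)
open import Relation.Binary.Structures using (IsTotalOrder)
open import Relation.Nullary using (¬_; Dec; yes; no; does)
open import Relation.Nullary.Decidable using (_×-dec_; dec-true; dec-false; dec⇒maybe; recompute)
open import Relation.Unary using (_≐_; _⊆_)

-- Why the only short entry of a short inequality is one step shorter: write m = k+1 and name an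
-- edge of length at most m as {a+l, a+m}. The edges of length at most m whose short side contains
-- it form the triangle {a+t, a+m+u} with 0 ≤ u ≤ t ≤ l. Since s is a mixed second difference, row t
-- collapses to four entries, of displacements m-t, m-t-1, m and m+1. The first two telescope over
-- t, from displacement m down to that of {a+l+1, a+m}; the others are never short. For displacement
-- m+1 this requires n ≥ 2m+1, which is the bound n ≥ 2k+3; the same bound makes short sides unique.
-- The two families of coefficients do not interfere: a long s_e has no entry at an edge of length
-- at most k, and a short inequality involves only s_f with |f| ≤ m, which vanish on every long W_e.
-- The cancellation in the other direction also comes from triangles: the vector of short
-- coefficients has as its mixed second difference at a short f exactly -s_f(v). The order of `lo`
-- and `hi` ignores the cyclic order, so vertices are handled through lifts to ℕ and edges as
-- unordered pairs of them.

module Combinatorics where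

  open import Data.Fin.Subset using (inside; outside) renaming (⊥ to ∅)
  open import Data.Nat.Base
  open import Data.Nat.DivMod
  open import Data.Nat.Properties
  open import Data.Vec.Base using ([]; _∷_; _[_]≔_; here; there)
  open Finₚ using (toℕ-injective; toℕ-fromℕ<; toℕ<n)
  open ≡ using (refl; sym; trans; module ≡-Reasoning)

  -- Edges as unordered pairs of vertices.

  edge-≡ : ∀ {n} {e f : Edge n} → lo e ≡ lo f → hi e ≡ hi f → e ≡ f
  edge-≡ refl refl = refl

  lo<hi′ : ∀ {n} (e : Edge n) → toℕ (lo e) < toℕ (hi e)
  lo<hi′ (edge i j i<j) = recompute (toℕ i <? toℕ j) i<j

  lo≢hi : ∀ {n} (e : Edge n) → lo e ≢ hi e
  lo≢hi e eq = <-irrefl (cong toℕ eq) (lo<hi′ e)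

  -- Forgets which endpoint is the smaller one: endpoints named in cyclic order may be stored either
  -- way round, and rotating the circle can exchange `lo` and `hi`.
  data Joins {n} (e : Edge n) (x y : Fin n) : Set where
    fwd : lo e ≡ x → hi e ≡ y → Joins e x y
    bwd : lo e ≡ y → hi e ≡ x → Joins e x y

  joins-sym : ∀ {n} {e : Edge n} {x y} → Joins e x y → Joins e y x
  joins-sym (fwd p q) = bwd p q
  joins-sym (bwd p q) = fwd p q

  joins-unique : ∀ {n} {e f : Edge n} {x y} → Joins e x y → Joins f x y → e ≡ f
  joins-unique (fwd refl refl) (fwd p q) = edge-≡ (sym p) (sym q)
  joins-unique (bwd refl refl) (bwd p q) = edge-≡ (sym p) (sym q)
  joins-unique {e = e} {f} (fwd refl refl) (bwd p q) =
    ⊥-elim (<-asym (lo<hi′ e) (subst₂ (λ a b → toℕ a < toℕ b) p q (lo<hi′ f)))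
  joins-unique {e = e} {f} (bwd refl refl) (fwd p q) =
    ⊥-elim (<-asym (lo<hi′ e) (subst₂ (λ a b → toℕ a < toℕ b) p q (lo<hi′ f)))

  joins-endpoints : ∀ {n} {e : Edge n} {x y z w} → Joins e x y → Joins e z w →
                    (x ≡ z × y ≡ w) ⊎ (x ≡ w × y ≡ z)
  joins-endpoints (fwd refl refl) (fwd p q) = inj₁ (p , q)
  joins-endpoints (fwd refl refl) (bwd p q) = inj₂ (p , q)
  joins-endpoints (bwd refl refl) (fwd p q) = inj₂ (q , p)
  joins-endpoints (bwd refl refl) (bwd p q) = inj₁ (q , p)

  joins-≢ : ∀ {n} {e : Edge n} {x y} → Joins e x y → x ≢ y
  joins-≢ {e = e} (fwd refl refl) = lo≢hi e
  joins-≢ {e = e} (bwd refl refl) = lo≢hi e ∘ sym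

  ⊖-mod : ∀ {n} .{{_ : NonZero n}} (x y : Fin n) → x ⊖ y ≡ ((n + toℕ x) ∸ toℕ y) % n
  ⊖-mod {suc n} x y = refl

  next-mod : ∀ {n} .{{_ : NonZero n}} (i : Fin n) → next i ≡ suc (toℕ i) mod n
  next-mod {suc n} i = refl

  -- Arithmetic of the cyclic vertices through lifts to ℕ.

  module Cyclic (n : ℕ) (3≤n : 3 ≤ n) where

    instance
      n≢0 : NonZero n
      n≢0 = >-nonZero (≤-trans (s≤s z≤n) 3≤n)

    opaque
      -- Every natural number is a lift of a vertex, so a cyclic interval becomes a stretch of ℕ and
      -- cyclic order becomes a chain of inequalities within one turn. Being opaque, it is
      -- accessible only through the two lemmas of this block.
      pt : ℕ → Fin n
      pt x = x mod n

      toℕ-pt : ∀ x → toℕ (pt x) ≡ x % n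
      toℕ-pt x = toℕ-fromℕ< (m%n<n x n)

      next≡pt : ∀ i → next i ≡ pt (suc (toℕ i))
      next≡pt i = next-mod i

    toℕ-pt< : ∀ {x} → x < n → toℕ (pt x) ≡ x
    toℕ-pt< x<n = trans (toℕ-pt _) (m<n⇒m%n≡m x<n)

    pt-≡ : ∀ {x y} → x % n ≡ y % n → pt x ≡ pt y
    pt-≡ {x} {y} eq = toℕ-injective (trans (toℕ-pt x) (trans eq (sym (toℕ-pt y))))

    pt-% : ∀ {x y} → pt x ≡ pt y → x % n ≡ y % n
    pt-% {x} {y} eq = trans (sym (toℕ-pt x)) (trans (cong toℕ eq) (toℕ-pt y))

    pt-toℕ : ∀ i → pt (toℕ i) ≡ i
    pt-toℕ i = toℕ-injective (toℕ-pt< (toℕ<n i))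

    pt-+n : ∀ x → pt (x + n) ≡ pt x
    pt-+n x = pt-≡ ([m+n]%n≡m%n x n)

    pt-n+ : ∀ x → pt (n + x) ≡ pt x
    pt-n+ x = trans (cong pt (+-comm n x)) (pt-+n x)

    pt-shift : ∀ {x y} z → pt x ≡ pt y → pt (x + z) ≡ pt (y + z)
    pt-shift {x} {y} z eq = pt-≡ (begin
      (x + z) % n           ≡⟨ %-distribˡ-+ x z n ⟩
      (x % n + z % n) % n   ≡⟨ cong (λ u → (u + z % n) % n) (pt-% {x} {y} eq) ⟩
      (y % n + z % n) % n   ≡⟨ %-distribˡ-+ y z n ⟨
      (y + z) % n           ∎)
      where open ≡-Reasoning

    -- Adding `z * pred n` takes the place of subtracting `z`: together with `z` it makes the
    -- multiple `z * n`.
    pt-cancel : ∀ {x y} z → pt (x + z) ≡ pt (y + z) → pt x ≡ pt y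
    pt-cancel {x} {y} z eq = trans (sym (full x))
        (trans (pt-shift {x + z} {y + z} (z * pred n) eq) (full y))
      where
      full : ∀ x → pt (x + z + z * pred n) ≡ pt x
      full x = pt-≡ (trans (cong (_% n)
          (trans (+-assoc x z _) (cong (x +_)
          (trans (sym (*-suc z (pred n))) (cong (z *_) (suc-pred n)))))) ([m+kn]%n≡m%n x z n))

    pt-injective : ∀ {x y} → x ≤ y → y < x + n → pt x ≡ pt y → x ≡ y
    pt-injective {x} {y} x≤y y<x+n eq = sym (trans (sym (m∸n+n≡m x≤y)) (cong (_+ x) y∸x≡0))
      where
      y∸x≡0 : y ∸ x ≡ 0
      y∸x≡0 = trans (sym (m<n⇒m%n≡m (m<n+o⇒m∸n<o y x y<x+n)))
                (trans (pt-% {y ∸ x} {0} (sym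
                    (pt-cancel {0} {y ∸ x} x (trans eq (cong pt (sym (m∸n+n≡m x≤y)))))))
                  (m<n⇒m%n≡m (≤-trans (s≤s z≤n) 3≤n)))

    pt-≢ : ∀ {x y} → x < y → y < x + n → pt x ≢ pt y
    pt-≢ x<y y<x+n eq = <⇒≢ x<y (pt-injective (<⇒≤ x<y) y<x+n eq)

    next-pt : ∀ x → next (pt x) ≡ pt (suc x)
    next-pt x = trans (next≡pt (pt x)) (trans (cong pt (+-comm 1 (toℕ (pt x))))
                 (trans (pt-shift {toℕ (pt x)} {x} 1 (pt-toℕ (pt x))) (cong pt (+-comm x 1))))

    ⊖<n : ∀ (x y : Fin n) → x ⊖ y < n
    ⊖<n x y = subst (_< n) (sym (⊖-mod x y)) (m%n<n ((n + toℕ x) ∸ toℕ y) n)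

    pt-⊖ : ∀ (x y : Fin n) → pt ((x ⊖ y) + toℕ y) ≡ x
    pt-⊖ x y = begin
      pt ((x ⊖ y) + toℕ y)               ≡⟨ pt-shift {x ⊖ y} {(n + toℕ x) ∸ toℕ y} (toℕ y)
          (pt-≡ (trans (cong (_% n) (⊖-mod x y)) (m%n%n≡m%n ((n + toℕ x) ∸ toℕ y) n))) ⟩
      pt ((n + toℕ x) ∸ toℕ y + toℕ y)   ≡⟨ cong pt
          (m∸n+n≡m (≤-trans (<⇒≤ (toℕ<n y)) (m≤m+n n (toℕ x)))) ⟩
      pt (n + toℕ x)                     ≡⟨ pt-n+ (toℕ x) ⟩
      pt (toℕ x)                         ≡⟨ pt-toℕ x ⟩
      x                                  ∎
      where open ≡-Reasoning

    ⊖-pt : ∀ x {d} → d < n → pt (x + d) ⊖ pt x ≡ d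
    ⊖-pt x {d} d<n = trans (sym (m<n⇒m%n≡m (⊖<n (pt (x + d)) (pt x))))
        (trans (pt-% {δ} {d} δ≡d) (m<n⇒m%n≡m d<n))
      where
      δ = pt (x + d) ⊖ pt x
      δ≡d : pt δ ≡ pt d
      δ≡d = pt-cancel {δ} {d} (toℕ (pt x)) (begin
        pt (δ + toℕ (pt x))   ≡⟨ pt-⊖ (pt (x + d)) (pt x) ⟩
        pt (x + d)            ≡⟨ pt-shift {x} {toℕ (pt x)} d (sym (pt-toℕ (pt x))) ⟩
        pt (toℕ (pt x) + d)   ≡⟨ cong pt (+-comm (toℕ (pt x)) d) ⟩
        pt (d + toℕ (pt x))   ∎)
        where open ≡-Reasoning

    pt-⊖′ : ∀ x y → pt (y + (pt x ⊖ pt y)) ≡ pt x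
    pt-⊖′ x y = trans (pt-shift {y} {toℕ (pt y)} (pt x ⊖ pt y) (sym (pt-toℕ (pt y))))
                 (trans (cong pt (+-comm (toℕ (pt y)) _)) (pt-⊖ (pt x) (pt y)))

    ⊖-pt-op : ∀ x {d} → 0 < d → d < n → pt x ⊖ pt (x + d) ≡ n ∸ d
    ⊖-pt-op x {d} 0<d d<n =
      trans (cong (_⊖ pt (x + d))
          (sym (trans (cong pt (trans (+-assoc x d (n ∸ d)) (cong (x +_) (m+[n∸m]≡n (<⇒≤ d<n)))))
          (pt-+n x))))
        (⊖-pt (x + d) (∸-monoʳ-< 0<d (<⇒≤ d<n)))

    dist-joins : ∀ {e : Edge n} {x y} → Joins e x y → dist e ≡ (x ⊖ y) ⊓ (y ⊖ x)
    dist-joins (fwd refl refl) = refl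
    dist-joins {e} (bwd refl refl) = ⊓-comm (lo e ⊖ hi e) (hi e ⊖ lo e)

    dist-pt : ∀ {e : Edge n} {x d} → 0 < d → d < n → Joins e (pt x) (pt (x + d)) → dist e ≡ (n ∸ d) ⊓ d
    dist-pt {x = x} 0<d d<n j = trans (dist-joins j) (cong₂ _⊓_ (⊖-pt-op x 0<d d<n) (⊖-pt x d<n))

    d≤n∸d : ∀ {d} → d + d ≤ n → d ≤ n ∸ d
    d≤n∸d {d} = m+n≤o⇒m≤o∸n d

    dist-pt-short : ∀ {e : Edge n} {x d} → 0 < d → d + d ≤ n → Joins e (pt x) (pt (x + d)) → dist e ≡ d
    dist-pt-short {d = d} 0<d 2d≤n j =
      trans (dist-pt 0<d (<-≤-trans (m<m+n d 0<d) 2d≤n) j) (m≥n⇒m⊓n≡n (d≤n∸d 2d≤n))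

    dist-pt-≥ : ∀ {e : Edge n} {x d c} → 0 < d → c ≤ d → d + c ≤ n → 0 < c →
        Joins e (pt x) (pt (x + d)) → c ≤ dist e
    dist-pt-≥ {d = d} {c} 0<d c≤d d+c≤n 0<c j =
      subst (c ≤_) (sym (dist-pt 0<d (<-≤-trans (m<m+n d 0<c) d+c≤n) j))
        (⊓-glb (m+n≤o⇒m≤o∸n c (subst (_≤ n) (+-comm d c) d+c≤n)) c≤d)

    -- Starts at the endpoint from which the other is reached in `dist e` upward steps, so that the
    -- short side is a stretch of ℕ. The lift lies above `n` so that stepping back by at most `n`,
    -- as is done to find the apex of a fan, is not truncated.
    record Named (e : Edge n) : Set where
      field
        base  : ℕ
        n≤    : n ≤ base
        joins : Joins e (pt base) (pt (base + dist e))
        0<d   : 0 < dist e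
        2d≤n  : dist e + dist e ≤ n

    name : ∀ e → Named e
    name e = go (≤-total (hi e ⊖ lo e) (lo e ⊖ hi e))
      where
      gap : ℕ
      gap = toℕ (hi e) ∸ toℕ (lo e)
      lo+gap : toℕ (lo e) + gap ≡ toℕ (hi e)
      lo+gap = m+[n∸m]≡n (<⇒≤ (lo<hi′ e))
      gap<n : gap < n
      gap<n = ≤-<-trans (m∸n≤m (toℕ (hi e)) (toℕ (lo e))) (toℕ<n (hi e))
      0<gap : 0 < gap
      0<gap = m<n⇒0<n∸m (lo<hi′ e)
      hi≡ : pt (toℕ (lo e) + gap) ≡ hi e
      hi≡ = trans (cong pt lo+gap) (pt-toℕ _)
      hi⊖lo : hi e ⊖ lo e ≡ gap
      hi⊖lo = trans (cong₂ _⊖_ (sym hi≡) (sym (pt-toℕ (lo e)))) (⊖-pt (toℕ (lo e)) gap<n)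
      lo⊖hi : lo e ⊖ hi e ≡ n ∸ gap
      lo⊖hi = trans (cong₂ _⊖_ (sym (pt-toℕ (lo e))) (sym hi≡)) (⊖-pt-op (toℕ (lo e)) 0<gap gap<n)
      to : ∀ (x y : Fin n) → pt (n + toℕ x + (y ⊖ x)) ≡ y
      to x y = trans (cong pt (+-assoc n (toℕ x) _))
          (trans (pt-n+ _) (trans (cong pt (+-comm (toℕ x) _)) (pt-⊖ y x)))
      from : ∀ (x : Fin n) → pt (n + toℕ x) ≡ x
      from x = trans (pt-n+ _) (pt-toℕ x)
      total : (hi e ⊖ lo e) + (lo e ⊖ hi e) ≡ n
      total = trans (cong₂ _+_ hi⊖lo lo⊖hi) (m+[n∸m]≡n (<⇒≤ gap<n))
      go : _ → Named e
      go (inj₁ short) = record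
        { base = n + toℕ (lo e) ; n≤ = m≤m+n n _
        ; joins = fwd (sym (from (lo e)))
            (sym (trans (cong (λ d → pt (n + toℕ (lo e) + d)) d≡) (to (lo e) (hi e))))
        ; 0<d = subst (0 <_) (sym (trans d≡ hi⊖lo)) 0<gap
        ; 2d≤n = subst (_≤ n) (cong₂ _+_ (sym d≡) (sym d≡))
            (≤-trans (+-monoʳ-≤ (hi e ⊖ lo e) short) (≤-reflexive total))
        }
        where
        d≡ : dist e ≡ hi e ⊖ lo e
        d≡ = m≥n⇒m⊓n≡n short
      go (inj₂ short) = record
        { base = n + toℕ (hi e) ; n≤ = m≤m+n n _
        ; joins = bwd (sym (trans (cong (λ d → pt (n + toℕ (hi e) + d)) d≡) (to (hi e) (lo e))))
            (sym (from (hi e)))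
        ; 0<d = subst (0 <_) (sym (trans d≡ lo⊖hi)) (m<n⇒0<n∸m gap<n)
        ; 2d≤n = subst (_≤ n) (cong₂ _+_ (sym d≡) (sym d≡))
            (≤-trans (+-monoˡ-≤ (lo e ⊖ hi e) short) (≤-reflexive total))
        }
        where
        d≡ : dist e ≡ lo e ⊖ hi e
        d≡ = m≤n⇒m⊓n≡m short

    -- Two names with exchanged ends would give two runs of `d` steps that return to the start,
    -- although `d + d` is less than a full turn.
    name-unique : ∀ {e : Edge n} {x y d} → 0 < d → d + d < n →
                  Joins e (pt x) (pt (x + d)) → Joins e (pt y) (pt (y + d)) → pt x ≡ pt y
    name-unique {x = x} {y} {d} 0<d 2d<n j j′ = [ proj₁ , ⊥-elim ∘ impossible ]′ (joins-endpoints j j′)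
      where
      impossible : pt x ≡ pt (y + d) × pt (x + d) ≡ pt y → ⊥
      impossible (p , q) = pt-≢ {x} {x + (d + d)} (m<m+n x (≤-trans 0<d (m≤m+n d d))) (+-monoʳ-< x 2d<n)
        (trans p (trans (pt-shift {y} {x + d} d (sym q)) (cong pt (+-assoc x d d))))

    dummy : Edge n
    dummy = edge (pt 0) (pt 1) (subst₂ _<_ (sym (toℕ-pt< 0<n)) (sym (toℕ-pt< 1<n)) (s≤s z≤n))
      where
      1<n : 1 < n
      1<n = <-≤-trans (s≤s (s≤s z≤n)) 3≤n
      0<n : 0 < n
      0<n = <-trans (s≤s z≤n) 1<n

    -- The value at x = y is a dummy.
    mk : Fin n → Fin n → Edge n
    mk x y with Finₚ.<-cmp x y
    ... | tri< x<y _ _ = edge x y x<y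
    ... | tri≈ _ _ _   = dummy
    ... | tri> _ _ y<x = edge y x y<x

    mk-joins : ∀ {x y} → x ≢ y → Joins (mk x y) x y
    mk-joins {x} {y} x≢y with Finₚ.<-cmp x y
    ... | tri< x<y _ _ = fwd refl refl
    ... | tri≈ _ x≡y _ = ⊥-elim (x≢y x≡y)
    ... | tri> _ _ y<x = bwd refl refl

    E : ℕ → ℕ → Edge n
    E a b = mk (pt a) (pt b)

    E-joins : ∀ {a b} → a < b → b < a + n → Joins (E a b) (pt a) (pt b)
    E-joins a<b b<a+n = mk-joins (pt-≢ a<b b<a+n)

  -- Enumerating and counting edges.

  ∈-mapMaybe⁺ : ∀ {A B : Set} (f : A → Maybe B) {xs x y} → x ∈ xs → f x ≡ just y → y ∈ mapMaybe f xs
  ∈-mapMaybe⁺ f {x ∷ xs} (here refl) eq with f x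
  ∈-mapMaybe⁺ f (here refl) refl | just _ = here refl
  ∈-mapMaybe⁺ f {x ∷ xs} (there x∈) eq with f x
  ... | just _  = there (∈-mapMaybe⁺ f x∈ eq)
  ... | nothing = ∈-mapMaybe⁺ f x∈ eq

  unique-mapMaybe⁺ : ∀ {A B : Set} (f : A → Maybe B) →
      (∀ {x y z} → f x ≡ just z → f y ≡ just z → x ≡ y) →
                     ∀ {xs} → Unique xs → Unique (mapMaybe f xs)
  unique-mapMaybe⁺ f inj [] = []
  unique-mapMaybe⁺ f inj {x ∷ xs} (px ∷ pxs) with f x in eq
  ... | nothing = unique-mapMaybe⁺ f inj pxs
  ... | just y  = Allₚ.mapMaybe⁺ {f = f} (Allₚ.map⁺ (All.map fresh px)) ∷ unique-mapMaybe⁺ f inj pxs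
    where

    fresh : ∀ {z} → x ≢ z → MaybeAll.All (y ≢_) (f z)
    fresh {z} x≢z with f z in eq′
    ... | nothing = nothing
    ... | just w  = just λ y≡w → x≢z (inj eq (trans eq′ (cong just (sym y≡w))))

  fromPair : ∀ {n} → Fin n × Fin n → Maybe (Edge n)
  fromPair (i , j) with i Finₚ.<? j
  ... | yes i<j = just (edge i j i<j)
  ... | no  _   = nothing

  -- Gives access to the local function in the definition of allEdges.
  allEdges-shape : ∀ n → Σ[ f ∈ (Fin n × Fin n → Maybe (Edge n)) ]
                   allEdges n ≡ mapMaybe f (cartesianProduct (allFin n) (allFin n))
  allEdges-shape n = _ , refl

  allEdges-≡ : ∀ n → allEdges n ≡ mapMaybe fromPair (cartesianProduct (allFin n) (allFin n))
  allEdges-≡ n = trans (proj₂ (allEdges-shape n))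
      (mapMaybe-cong pointwise (cartesianProduct (allFin n) (allFin n)))
    where
    pointwise : ∀ p → proj₁ (allEdges-shape n) p ≡ fromPair p
    pointwise (i , j) with i Finₚ.<? j
    ... | yes _ = refl
    ... | no _  = refl

  fromPair-just : ∀ {n p} {e : Edge n} → fromPair p ≡ just e → p ≡ (lo e , hi e)
  fromPair-just {p = i , j} eq with i Finₚ.<? j
  fromPair-just {p = i , j} refl | yes i<j = refl

  fromPair-endpoints : ∀ {n} (e : Edge n) → fromPair (lo e , hi e) ≡ just e
  fromPair-endpoints e with lo e Finₚ.<? hi e
  ... | yes _   = refl
  ... | no  ≮   = ⊥-elim (≮ (lo<hi′ e))

  ∈-allEdges : ∀ {n} (e : Edge n) → e ∈ allEdges n
  ∈-allEdges e = subst (e ∈_) (sym (allEdges-≡ _))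
    (∈-mapMaybe⁺ fromPair (∈-cartesianProduct⁺ (∈-allFin (lo e)) (∈-allFin (hi e)))
        (fromPair-endpoints e))

  allEdges-unique : ∀ n → Unique (allEdges n)
  allEdges-unique n = subst Unique (sym (allEdges-≡ n))
    (unique-mapMaybe⁺ fromPair (λ p q → trans (fromPair-just p) (sym (fromPair-just q)))
      (Uniqueₚ.cartesianProduct⁺ (Uniqueₚ.allFin⁺ n) (Uniqueₚ.allFin⁺ n)))

  unique-↭ : ∀ {A : Set} {xs ys : List A} → Unique xs → Unique ys →
             (∀ {x} → x ∈ xs → x ∈ ys) → (∀ {x} → x ∈ ys → x ∈ xs) → xs ↭ ys
  unique-↭ u v f g = ∼bag⇒↭ (unique∧set⇒bag u v (mk⇔ f g))

  unique-length-≤ : ∀ {A : Set} {xs ys : List A} → Unique xs → (∀ {x} → x ∈ xs → x ∈ ys) →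
      length xs ≤ length ys
  unique-length-≤ [] _ = z≤n
  unique-length-≤ {xs = x ∷ xs} (px ∷ pxs) sub with ∈-∃++ (sub (here refl))
  ... | as , bs , refl = begin
    suc (length xs)             ≤⟨ s≤s (unique-length-≤ pxs sub′) ⟩
    suc (length (as ++ bs))     ≡⟨ cong suc (length-++ as) ⟩
    suc (length as + length bs) ≡⟨ +-suc (length as) (length bs) ⟨
    length as + length (x ∷ bs) ≡⟨ length-++ as ⟨
    length (as ++ x ∷ bs)       ∎
    where
    open ≤-Reasoning
    sub′ : ∀ {y} → y ∈ xs → y ∈ as ++ bs
    sub′ y∈ with ∈-++⁻ as (sub (there y∈))
    ... | inj₁ y∈as         = ∈-++⁺ˡ y∈as
    ... | inj₂ (here refl)  = ⊥-elim (All.lookup px y∈ refl)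
    ... | inj₂ (there y∈bs) = ∈-++⁺ʳ as y∈bs

  -- Grouping by the larger entry turns the recursion into Pascal's rule for `m C 2`.
  pairsBelow : ℕ → List (ℕ × ℕ)
  pairsBelow zero    = []
  pairsBelow (suc m) = map (_, m) (upTo m) ++ pairsBelow m

  length-pairsBelow : ∀ m → length (pairsBelow m) ≡ m C 2
  length-pairsBelow zero    = refl
  length-pairsBelow (suc m) = begin
    length (map (_, m) (upTo m) ++ pairsBelow m)         ≡⟨ length-++ (map (_, m) (upTo m)) ⟩
    length (map (_, m) (upTo m)) + length (pairsBelow m) ≡⟨ cong₂ _+_
        (trans (length-map _ (upTo m)) (length-upTo m)) (length-pairsBelow m) ⟩
    m + m C 2                                            ≡⟨ cong (_+ m C 2) (nC1≡n m) ⟨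
    m C 1 + m C 2                                        ≡⟨ nCk+nC[k+1]≡[n+1]C[k+1] m 1 ⟩
    suc m C 2                                            ∎
    where open ≡-Reasoning

  ∈-pairsBelow⁺ : ∀ {m x y} → x < y → y < m → (x , y) ∈ pairsBelow m
  ∈-pairsBelow⁺ {suc m} {x} {y} x<y y<1+m with m≤n⇒m<n∨m≡n (s≤s⁻¹ y<1+m)
  ... | inj₁ y<m  = ∈-++⁺ʳ _ (∈-pairsBelow⁺ x<y y<m)
  ... | inj₂ refl = ∈-++⁺ˡ (∈-map⁺ _ (∈-upTo⁺ x<y))

  ∈-pairsBelow⁻ : ∀ {m x y} → (x , y) ∈ pairsBelow m → x < y × y < m
  ∈-pairsBelow⁻ {suc m} p∈ with ∈-++⁻ (map (_, m) (upTo m)) p∈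
  ... | inj₂ q with x<y , y<m ← ∈-pairsBelow⁻ {m} q = x<y , m<n⇒m<1+n y<m
  ... | inj₁ q with _ , x∈ , refl ← ∈-map⁻ _ q = ∈-upTo⁻ x∈ , n<1+n m

  pairsBelow-unique : ∀ m → Unique (pairsBelow m)
  pairsBelow-unique zero    = []
  pairsBelow-unique (suc m) = Uniqueₚ.++⁺ (Uniqueₚ.map⁺ (cong proj₁) (Uniqueₚ.upTo⁺ m))
      (pairsBelow-unique m) disjoint
    where
    disjoint : ∀ {p} → ¬ (p ∈ map (_, m) (upTo m) × p ∈ pairsBelow m)
    disjoint (p∈ , q∈) with _ , _ , refl ← ∈-map⁻ _ p∈ = <-irrefl refl (proj₂ (∈-pairsBelow⁻ {m} q∈))

  length-allEdges : ∀ n → length (allEdges n) ≡ n C 2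
  length-allEdges n = begin
    length (allEdges n)           ≡⟨ length-map ends (allEdges n) ⟨
    length (map ends (allEdges n)) ≡⟨ ↭-length
        (unique-↭ (Uniqueₚ.map⁺ inj (allEdges-unique n)) (pairsBelow-unique n) to from) ⟩
    length (pairsBelow n)         ≡⟨ length-pairsBelow n ⟩
    n C 2                         ∎
    where
    open ≡-Reasoning
    ends : Edge n → ℕ × ℕ
    ends e = toℕ (lo e) , toℕ (hi e)
    inj : ∀ {e f} → ends e ≡ ends f → e ≡ f
    inj eq = edge-≡ (Finₚ.toℕ-injective (cong proj₁ eq)) (Finₚ.toℕ-injective (cong proj₂ eq))
    to : ∀ {p} → p ∈ map ends (allEdges n) → p ∈ pairsBelow n
    to p∈ with e , _ , refl ← ∈-map⁻ ends p∈ = ∈-pairsBelow⁺ (lo<hi′ e) (Finₚ.toℕ<n (hi e))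
    from : ∀ {p} → p ∈ pairsBelow n → p ∈ map ends (allEdges n)
    from {x , y} p∈ with x<y , y<n ← ∈-pairsBelow⁻ {n} p∈ =
      subst (_∈ map ends (allEdges n)) (cong₂ _,_ (Finₚ.toℕ-fromℕ< x<n) (Finₚ.toℕ-fromℕ< y<n))
        (∈-map⁺ ends (∈-allEdges (edge (Fin.fromℕ< x<n) (Fin.fromℕ< y<n)
          (subst₂ _<_ (sym (Finₚ.toℕ-fromℕ< x<n)) (sym (Finₚ.toℕ-fromℕ< y<n)) x<y))))
      where x<n = <-trans x<y y<n

  -- Vertex sets, integer ranges and transversals of matchings.

  ∣insert∣ : ∀ {n} (U : Subset n) {x} → ¬ (x ∈ₛ U) → ∣ U [ x ]≔ inside ∣ ≡ suc ∣ U ∣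
  ∣insert∣ (inside  ∷ U) {Fin.zero}  x∉ = ⊥-elim (x∉ here)
  ∣insert∣ (outside ∷ U) {Fin.zero}  x∉ = refl
  ∣insert∣ (inside  ∷ U) {Fin.suc x} x∉ = cong suc (∣insert∣ U (x∉ ∘ there))
  ∣insert∣ (outside ∷ U) {Fin.suc x} x∉ = ∣insert∣ U (x∉ ∘ there)

  subsetOf : ∀ {n} (xs : List (Fin n)) → Unique xs →
             Σ[ U ∈ Subset n ] (∣ U ∣ ≡ length xs × (∀ x → x ∈ xs ⇔ x ∈ₛ U))
  subsetOf {n} [] [] = ∅ , ∣⊥∣≡0 n , λ x → mk⇔ (λ ()) (⊥-elim ∘ ∉⊥)
  subsetOf (x ∷ xs) (px ∷ pxs) with subsetOf xs pxs
  ... | U , size , iff = U [ x ]≔ inside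
      , trans (∣insert∣ U (λ x∈ → All.lookup px (Equivalence.from (iff x) x∈) refl)) (cong suc size)
      , λ y → mk⇔ (to y) (from y)
    where
    to : ∀ y → y ∈ x ∷ xs → y ∈ₛ U [ x ]≔ inside
    to y (here refl) = []≔-updates U x
    to y (there y∈)  with y Finₚ.≟ x
    ... | yes refl = []≔-updates U x
    ... | no  y≢x  = []≔-minimal U y x y≢x (Equivalence.to (iff y) y∈)
    from : ∀ y → y ∈ₛ U [ x ]≔ inside → y ∈ x ∷ xs
    from y y∈ with y Finₚ.≟ x
    ... | yes refl = here refl
    ... | no  y≢x  = there (Equivalence.from (iff y)
                       (lookup⇒[]= y U (trans (sym (lookup∘update′ y≢x U inside)) ([]=⇒lookup y∈))))

  unique-resp-↭ : ∀ {A : Set} {xs ys : List A} → xs ↭ ys → Unique xs → Unique ys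
  unique-resp-↭ Perm.refl u = u
  unique-resp-↭ (Perm.prep x p) (px ∷ u) = All-resp-↭ p px ∷ unique-resp-↭ p u
  unique-resp-↭ (Perm.swap x y p) ((x≢y ∷ px) ∷ py ∷ u) =
      ((x≢y ∘ sym) ∷ All-resp-↭ p py) ∷ All-resp-↭ p px ∷ unique-resp-↭ p u
  unique-resp-↭ (Perm.trans p q) u = unique-resp-↭ q (unique-resp-↭ p u)

  iota : ℕ → ℕ → List ℕ
  iota a zero    = []
  iota a (suc l) = a ∷ iota (suc a) l

  length-iota : ∀ a l → length (iota a l) ≡ l
  length-iota a zero    = refl
  length-iota a (suc l) = cong suc (length-iota (suc a) l)

  ∈-iota⁻ : ∀ {a l x} → x ∈ iota a l → a ≤ x × x < a + l
  ∈-iota⁻ {a} {suc l} (here refl) = ≤-refl , m<m+n a (s≤s z≤n)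
  ∈-iota⁻ {a} {suc l} {x} (there x∈) with a<x , x<a+l ← ∈-iota⁻ {suc a} {l} x∈ =
    <⇒≤ a<x , subst (x <_) (sym (+-suc a l)) x<a+l

  ∈-iota⁺ : ∀ {a l x} → a ≤ x → x < a + l → x ∈ iota a l
  ∈-iota⁺ {a} {zero}  a≤x x<a+l = ⊥-elim (<⇒≱ x<a+l (subst (_≤ _) (sym (+-identityʳ a)) a≤x))
  ∈-iota⁺ {a} {suc l} {x} a≤x x<a+l with m≤n⇒m<n∨m≡n a≤x
  ... | inj₁ a<x  = there (∈-iota⁺ a<x (subst (x <_) (+-suc a l) x<a+l))
  ... | inj₂ refl = here refl

  iota-unique : ∀ a l → Unique (iota a l)
  iota-unique a zero    = []
  iota-unique a (suc l) = All.tabulate (λ x∈ → <⇒≢ (proj₁ (∈-iota⁻ {suc a} {l} x∈))) ∷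
      iota-unique (suc a) l

  iota-++ : ∀ a l l′ → iota a (l + l′) ≡ iota a l ++ iota (a + l) l′
  iota-++ a zero    l′ = cong (λ a → iota a l′) (sym (+-identityʳ a))
  iota-++ a (suc l) l′ = cong (a ∷_)
      (trans (iota-++ (suc a) l l′) (cong (λ b → iota (suc a) l ++ iota b l′) (sym (+-suc a l))))

  cross-sym : ∀ {n} {e f : Edge n} → Cross e f → Cross f e
  cross-sym = Sum.swap

  cross-lookup : ∀ {n} {X : List (Edge n)} {e f} → AllPairs Cross X → e ∈ X → f ∈ X → e ≡ f ⊎ Cross e f
  cross-lookup (_ ∷ _)  (here refl) (here refl) = inj₁ refl
  cross-lookup (p ∷ _)  (here refl) (there f∈)  = inj₂ (All.lookup p f∈)
  cross-lookup {e = e} {f} (p ∷ _) (there e∈) (here refl) =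
      inj₂ (cross-sym {e = f} {e} (All.lookup p e∈))
  cross-lookup (_ ∷ ps) (there e∈)  (there f∈)  = cross-lookup ps e∈ f∈

  -- One endpoint in `ys` is chosen from each edge. The edges are disjoint, so the choices are
  -- distinct, and a vertex set that meets every edge of a matching is at least as large as the
  -- matching.
  transversal : ∀ {n} {ys : List (Fin n)} (X : List (Edge n)) → Unique (endpoints X) →
                (∀ {f} → f ∈ X → lo f ∈ ys ⊎ hi f ∈ ys) →
                Σ[ zs ∈ List (Fin n) ] (length zs ≡ length X × Unique zs ×
                  (∀ {z} → z ∈ zs → z ∈ endpoints X) × (∀ {z} → z ∈ zs → z ∈ ys))
  transversal [] _ _ = [] , refl , [] , (λ ()) , (λ ())
  transversal (f ∷ X) ((_ ∷ pl) ∷ ph ∷ u) choice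
    with zs , size , uz , ends , sub ← transversal X u (choice ∘ there) | choice (here refl)
  ... | inj₁ l∈ = lo f ∷ zs , cong suc size , All.tabulate (λ z∈ → All.lookup pl (ends z∈)) ∷ uz
                , (λ { (here refl) → here refl ; (there z∈) → there (there (ends z∈)) })
                , (λ { (here refl) → l∈ ; (there z∈) → sub z∈ })
  ... | inj₂ h∈ = hi f ∷ zs , cong suc size , All.tabulate (λ z∈ → All.lookup ph (ends z∈)) ∷ uz
                , (λ { (here refl) → there (here refl) ; (there z∈) → there (there (ends z∈)) })
                , (λ { (here refl) → h∈ ; (there z∈) → sub z∈ })

  length-≤-transversal : ∀ {n} {ys : List (Fin n)} (X : List (Edge n)) → Unique (endpoints X) →
                         (∀ {f} → f ∈ X → lo f ∈ ys ⊎ hi f ∈ ys) → length X ≤ length ys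
  length-≤-transversal {ys = ys} X u choice with zs , size , uz , _ , sub ← transversal X u choice =
    subst (_≤ length ys) size (unique-length-≤ uz sub)

  -- Matchings between two disjoint cyclic intervals.

  module Matchings (n : ℕ) (3≤n : 3 ≤ n) where
    open Cyclic n 3≤n

    window-injective : ∀ a {x y} → a ≤ x → x < a + n → a ≤ y → y < a + n → pt x ≡ pt y → x ≡ y
    window-injective a {x} {y} a≤x x<a+n a≤y y<a+n eq with ≤-total x y
    ... | inj₁ x≤y = pt-injective x≤y (<-≤-trans y<a+n (+-monoˡ-≤ n a≤x)) eq
    ... | inj₂ y≤x = sym (pt-injective y≤x (<-≤-trans x<a+n (+-monoˡ-≤ n a≤y)) (sym eq))

    pt-%n : ∀ x i → pt (x + i) ≡ pt (toℕ (pt x) + i)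
    pt-%n x i = pt-shift i (sym (pt-toℕ (pt x)))

    mk-< : ∀ {x y : Fin n} → x Fin.< y → lo (mk x y) ≡ x × hi (mk x y) ≡ y
    mk-< {x} {y} x<y with Finₚ.<-cmp x y
    ... | tri< _ _ _   = refl , refl
    ... | tri≈ _ x≡y _ = ⊥-elim (<-irrefl (cong toℕ x≡y) x<y)
    ... | tri> _ _ y<x = ⊥-elim (<-asym x<y y<x)

    mk-> : ∀ {x y : Fin n} → y Fin.< x → lo (mk x y) ≡ y × hi (mk x y) ≡ x
    mk-> {x} {y} y<x with Finₚ.<-cmp x y
    ... | tri< x<y _ _ = ⊥-elim (<-asym x<y y<x)
    ... | tri≈ _ x≡y _ = ⊥-elim (<-irrefl (cong toℕ (sym x≡y)) y<x)
    ... | tri> _ _ _   = refl , refl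

    cross-of : ∀ (e f : Edge n) {a b c d} → lo e ≡ a × hi e ≡ b → lo f ≡ c × hi f ≡ d →
               (a Fin.< c × c Fin.< b × b Fin.< d) ⊎ (c Fin.< a × a Fin.< d × d Fin.< b) → Cross e f
    cross-of _ _ (refl , refl) (refl , refl) c = c

    -- The four alternatives are the rotations of the cyclic order x, z, y, w; they differ in which
    -- vertex comes first in the linear order.
    cross-mk : ∀ {x z y w : Fin n} →
               (x Fin.< z × z Fin.< y × y Fin.< w) ⊎ (w Fin.< x × x Fin.< z × z Fin.< y) ⊎
               (y Fin.< w × w Fin.< x × x Fin.< z) ⊎ (z Fin.< y × y Fin.< w × w Fin.< x) →
               Cross (mk x y) (mk z w)
    cross-mk {x} {z} {y} {w} (inj₁ (xz , zy , yw)) =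
        cross-of (mk x y) (mk z w) (mk-< (<-trans xz zy)) (mk-< (<-trans zy yw)) (inj₁ (xz , zy , yw))
    cross-mk {x} {z} {y} {w} (inj₂ (inj₁ (wx , xz , zy))) =
        cross-of (mk x y) (mk z w) (mk-< (<-trans xz zy)) (mk-> (<-trans wx xz)) (inj₂ (wx , xz , zy))
    cross-mk {x} {z} {y} {w} (inj₂ (inj₂ (inj₁ (yw , wx , xz)))) =
        cross-of (mk x y) (mk z w) (mk-> (<-trans yw wx)) (mk-> (<-trans wx xz)) (inj₁ (yw , wx , xz))
    cross-mk {x} {z} {y} {w} (inj₂ (inj₂ (inj₂ (zy , yw , wx)))) =
        cross-of (mk x y) (mk z w) (mk-> (<-trans yw wx)) (mk-< (<-trans zy yw)) (inj₂ (zy , yw , wx))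

    toℕ-pt-wrap : ∀ {x} → n ≤ x → x < n + n → toℕ (pt x) ≡ x ∸ n
    toℕ-pt-wrap {x} n≤x x<2n = trans (cong toℕ (trans (cong pt (sym (m∸n+n≡m n≤x))) (pt-+n (x ∸ n))))
        (toℕ-pt< (m<n+o⇒m∸n<o x n x<2n))

    -- A translation by a multiple of `n` brings `x` below `n`, and then `w` below `n + n`. The
    -- linear order of the four vertices now depends only on how many of z < y < w have passed `n`,
    -- and those form a final segment: four cases, the four rotations of `cross-mk`.
    cross-E : ∀ {x z y w} → x < z → z < y → y < w → w < x + n → Cross (E x y) (E z w)
    cross-E {x} {z} {y} {w} x<z z<y y<w w<x+n =
      subst₂ (λ e f → Cross e f) (cong₂ mk (at x ≤-refl) (at y x≤y)) (cong₂ mk (at z x≤z) (at w x≤w))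
        (reduced (≤-<-trans (≤-reflexive (trans (cong (toℕ (pt x) +_) (n∸n≡0 x)) (+-identityʳ _)))
            toℕ<n′) (lt ≤-refl x<z) (lt x≤z z<y) (lt x≤y y<w) w<)
      where
      toℕ<n′ : toℕ (pt x) < n
      toℕ<n′ = Finₚ.toℕ<n (pt x)
      x≤z = <⇒≤ x<z
      x≤y = ≤-trans x≤z (<⇒≤ z<y)
      x≤w = ≤-trans x≤y (<⇒≤ y<w)
      X : ℕ → ℕ
      X u = toℕ (pt x) + (u ∸ x)
      at : ∀ u → x ≤ u → pt (X u) ≡ pt u
      at u x≤u = trans (sym (pt-%n x (u ∸ x))) (cong pt (m+[n∸m]≡n x≤u))
      lt : ∀ {u u′} → x ≤ u → u < u′ → X u < X u′
      lt x≤u u<u′ = +-monoʳ-< (toℕ (pt x)) (∸-monoˡ-< u<u′ x≤u)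
      w< : X w < X x + n
      w< = subst (X w <_) (cong (_+ n) (sym (trans (cong (toℕ (pt x) +_) (n∸n≡0 x)) (+-identityʳ _))))
             (+-monoʳ-< (toℕ (pt x)) (m<n+o⇒m∸n<o w x w<x+n))
      reduced : ∀ {x z y w} → x < n → x < z → z < y → y < w → w < x + n → Cross (E x y) (E z w)
      reduced {x} {z} {y} {w} x<n x<z z<y y<w w<x+n = cross-mk (cases (z <? n) (y <? n) (w <? n))
        where
        below : ∀ {u} → u < n → u ≡ toℕ (pt u)
        below u<n = sym (toℕ-pt< u<n)
        w<2n : w < n + n
        w<2n = <-trans w<x+n (+-monoˡ-< n x<n)
        wrapped : ∀ {u} → n ≤ u → u ≤ w → u ∸ n ≡ toℕ (pt u)
        wrapped n≤u u≤w = sym (toℕ-pt-wrap n≤u (≤-<-trans u≤w w<2n))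
        w∸n<x : n ≤ w → w ∸ n < x
        w∸n<x n≤w = subst (w ∸ n <_) (m+n∸n≡m x n) (∸-monoˡ-< w<x+n n≤w)
        y≤w = <⇒≤ y<w
        z≤w = ≤-trans (<⇒≤ z<y) y≤w
        cases : Dec (z < n) → Dec (y < n) → Dec (w < n) → _
        cases _ _ (yes w<n) =
          let y<n = <-trans y<w w<n ; z<n = <-trans z<y y<n in
          inj₁ (subst₂ _<_ (below x<n) (below z<n) x<z , subst₂ _<_ (below z<n) (below y<n) z<y , subst₂
              _<_ (below y<n) (below w<n) y<w)
        cases _ (yes y<n) (no w≮n) =
          let n≤w = ≮⇒≥ w≮n ; z<n = <-trans z<y y<n in
          inj₂ (inj₁ (subst₂ _<_ (wrapped n≤w ≤-refl) (below x<n) (w∸n<x n≤w)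
                    , subst₂ _<_ (below x<n) (below z<n) x<z , subst₂ _<_ (below z<n) (below y<n) z<y))
        cases (yes z<n) (no y≮n) (no w≮n) =
          let n≤w = ≮⇒≥ w≮n ; n≤y = ≮⇒≥ y≮n in
          inj₂ (inj₂ (inj₁ (subst₂ _<_ (wrapped n≤y y≤w) (wrapped n≤w ≤-refl) (∸-monoˡ-< y<w n≤y)
                          , subst₂ _<_ (wrapped n≤w ≤-refl) (below x<n) (w∸n<x n≤w) , subst₂ _<_
                              (below x<n) (below z<n) x<z)))
        cases (no z≮n) (no y≮n) (no w≮n) =
          let n≤w = ≮⇒≥ w≮n ; n≤y = ≮⇒≥ y≮n ; n≤z = ≮⇒≥ z≮n in
          inj₂ (inj₂ (inj₂ (subst₂ _<_ (wrapped n≤z z≤w) (wrapped n≤y y≤w) (∸-monoˡ-< z<y n≤z)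
                          , subst₂ _<_ (wrapped n≤y y≤w) (wrapped n≤w ≤-refl) (∸-monoˡ-< y<w n≤y)
                          , subst₂ _<_ (wrapped n≤w ≤-refl) (below x<n) (w∸n<x n≤w))))


    link : List ℕ → List ℕ → List (Edge n)
    link = zipWith E

    endpoints-link : ∀ P Q → length P ≡ length Q → (∀ {p q} → p ∈ P → q ∈ Q → pt p ≢ pt q) →
                     endpoints (link P Q) ↭ map pt (P ++ Q)
    endpoints-link [] [] _ _ = ↭-refl
    endpoints-link (p ∷ P) (q ∷ Q) len apart =
        ↭-trans (first (mk-joins (apart (here refl) (here refl))))
        (Perm.prep (pt p) (↭-sym (Permₚ.map⁺ pt (shift q P Q))))
      where
      rest : endpoints (link P Q) ↭ map pt (P ++ Q)
      rest = endpoints-link P Q (suc-injective len) (λ p∈ q∈ → apart (there p∈) (there q∈))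
      first : Joins (E p q) (pt p) (pt q) → endpoints (link (p ∷ P) (q ∷ Q)) ↭ pt p ∷ pt q ∷ map
          pt (P ++ Q)
      first (fwd l h) = ↭-trans (↭-reflexive (cong₂ (λ x y → x ∷ y ∷ endpoints (link P Q)) l h))
          (Perm.prep _ (Perm.prep _ rest))
      first (bwd l h) = ↭-trans (↭-reflexive (cong₂ (λ x y → x ∷ y ∷ endpoints (link P Q)) l h))
          (Perm.swap _ _ rest)

    map-pt-unique : ∀ a {xs} → (∀ {x} → x ∈ xs → a ≤ x × x < a + n) → Unique xs → Unique (map pt xs)
    map-pt-unique a win [] = []
    map-pt-unique a {x ∷ xs} win (px ∷ pxs) =
      Allₚ.map⁺ (All.tabulate λ {y} y∈ eq → All.lookup px y∈
        (window-injective a (proj₁ (win (here refl))) (proj₂ (win (here refl))) (proj₁ (win (there y∈)))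
            (proj₂ (win (there y∈))) eq))
      ∷ map-pt-unique a (win ∘ there) pxs

    module Antipodal (a b l : ℕ) (a+l≤b : a + l ≤ b) (b+l≤a+n : b + l ≤ a + n) where

      P Q : List ℕ
      P = iota a l
      Q = iota b l

      P<Q : ∀ {p q} → p ∈ P → q ∈ Q → p < q × q < p + n
      P<Q p∈ q∈ with a≤p , p<a+l ← ∈-iota⁻ {a} {l} p∈ | b≤q , q<b+l ← ∈-iota⁻ {b} {l} q∈ =
        <-≤-trans p<a+l (≤-trans a+l≤b b≤q) , <-≤-trans q<b+l (≤-trans b+l≤a+n (+-monoˡ-≤ n a≤p))

      points-unique : Unique (map pt (P ++ Q))
      points-unique = map-pt-unique a win (Uniqueₚ.++⁺ (iota-unique a l) (iota-unique b l)
                        (λ (p∈ , q∈) → <-irrefl refl (proj₁ (P<Q p∈ q∈))))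
        where
        win : ∀ {x} → x ∈ P ++ Q → a ≤ x × x < a + n
        win x∈ with ∈-++⁻ P x∈
        ... | inj₁ p∈ with a≤p , p<a+l ← ∈-iota⁻ {a} {l} p∈ =
                a≤p , <-≤-trans p<a+l (≤-trans a+l≤b (≤-trans (m≤m+n b l) b+l≤a+n))
        ... | inj₂ q∈ with b≤q , q<b+l ← ∈-iota⁻ {b} {l} q∈ =
                ≤-trans (m≤m+n a l) (≤-trans a+l≤b b≤q) , <-≤-trans q<b+l b+l≤a+n

      vertices = subsetOf (map pt (P ++ Q)) points-unique

      U : Subset n
      U = proj₁ vertices

      ∣U∣ : ∣ U ∣ ≡ l + l
      ∣U∣ = trans (proj₁ (proj₂ vertices)) (trans (length-map pt (P ++ Q))
             (trans (length-++ P) (cong₂ _+_ (length-iota a l) (length-iota b l))))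

      -- Permuting the partners leaves the covered vertices unchanged, so the crossing and all its
      -- competitors of this form share the same `U`.
      perfect : ∀ {Q′} → Q′ ↭ Q → IsPerfectMatching U (link P Q′)
      perfect {Q′} σ = unique-resp-↭ (↭-sym ends) points-unique
                     , λ x → mk⇔ (Equivalence.to (proj₂ (proj₂ vertices) x) ∘ ∈-resp-↭ ends)
                                 (∈-resp-↭ (↭-sym ends) ∘ Equivalence.from (proj₂ (proj₂ vertices) x))
        where
        len : length P ≡ length Q′
        len = trans (length-iota a l) (trans (sym (length-iota b l)) (↭-length (↭-sym σ)))
        ends : endpoints (link P Q′) ↭ map pt (P ++ Q)
        ends = ↭-trans (endpoints-link P Q′ len (λ p∈ q∈ → let p<q , q<p+n = P<Q p∈ (∈-resp-↭ σ q∈) in pt-≢ p<q q<p+n))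
                       (Permₚ.map⁺ pt (Permₚ.++⁺ˡ P σ))

      -- With both intervals in increasing order, two edges with indices i < j have their ends in
      -- the order a+i, a+j, b+i, b+j within one turn.
      crossing : IsCrossing l (link P Q)
      crossing = size , pairwise a b l a+l≤b b+l≤a+n
        where
        size : length (link P Q) ≡ l
        size = trans (length-zipWith E P Q)
            (trans (cong₂ _⊓_ (length-iota a l) (length-iota b l)) (⊓-idem l))
        later : ∀ {a b} a′ b′ l → a < a′ → b < b′ → a′ + l ≤ b → b′ + l ≤ a + n →
            All (Cross (E a b)) (link (iota a′ l) (iota b′ l))
        later a′ b′ zero    _ _ _ _ = []
        later {a} {b} a′ b′ (suc l) a<a′ b<b′ u v =
          cross-E a<a′ (<-≤-trans (m<m+n a′ (s≤s z≤n)) u) b<b′ (<-≤-trans (m<m+n b′ (s≤s z≤n)) v)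
          ∷ later (suc a′) (suc b′) l (m<n⇒m<1+n a<a′) (m<n⇒m<1+n b<b′) (subst (_≤ b) (+-suc a′ l) u)
              (subst (_≤ a + n) (+-suc b′ l) v)
        pairwise : ∀ a b l → a + l ≤ b → b + l ≤ a + n → AllPairs Cross (link (iota a l) (iota b l))
        pairwise a b zero    _ _ = []
        pairwise a b (suc l) u v =
          later (suc a) (suc b) l ≤-refl ≤-refl u′ v′ ∷ pairwise (suc a) (suc b) l (m≤n⇒m≤1+n u′)
              (m≤n⇒m≤1+n v′)
          where
          u′ : suc a + l ≤ b
          u′ = subst (_≤ b) (+-suc a l) u
          v′ : suc b + l ≤ a + n
          v′ = subst (_≤ a + n) (+-suc b l) v

  -- Distances, intervals and sides of the polygon.

  module Distances (n : ℕ) (3≤n : 3 ≤ n) where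
    open Cyclic n 3≤n

    gap : Edge n → ℕ
    gap e = toℕ (hi e) ∸ toℕ (lo e)

    lo+gap : ∀ e → toℕ (lo e) + gap e ≡ toℕ (hi e)
    lo+gap e = m+[n∸m]≡n (<⇒≤ (lo<hi′ e))

    gap<n : ∀ e → gap e < n
    gap<n e = ≤-<-trans (m∸n≤m (toℕ (hi e)) (toℕ (lo e))) (Finₚ.toℕ<n (hi e))

    dist-gap : ∀ e → dist e ≡ (n ∸ gap e) ⊓ gap e
    dist-gap e = dist-pt {e} {toℕ (lo e)} {gap e} (m<n⇒0<n∸m (lo<hi′ e)) (gap<n e)
      (fwd (sym (pt-toℕ (lo e))) (sym (trans (cong pt (lo+gap e)) (pt-toℕ (hi e)))))

    -- The circle splits into two half-open arcs, from `lo e` to just before `hi e` and from `hi e`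
    -- to just before `lo e`. Each contains one end of `e` and an end of every edge across `e`,
    -- hence a transversal of all of `X`; the smaller arc has `dist e` vertices.
    crossing-length-≤-dist : ∀ {X} → Unique (endpoints X) → AllPairs Cross X → ∀ {e} → e ∈ X →
        length X ≤ dist e
    crossing-length-≤-dist {X} u cross {e} e∈ =
      subst (length X ≤_) (sym (dist-gap e)) (⊓-glb
        (subst (length X ≤_) (size (toℕ (hi e)) (n ∸ gap e)) (length-≤-transversal X u outer))
        (subst (length X ≤_) (size (toℕ (lo e)) (gap e)) (length-≤-transversal X u inner)))
      where
      size : ∀ a l → length (map pt (iota a l)) ≡ l
      size a l = trans (length-map pt (iota a l)) (length-iota a l)
      inside∈ : ∀ {x} → lo e Fin.≤ x → x Fin.< hi e → x ∈ map pt (iota (toℕ (lo e)) (gap e))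
      inside∈ {x} lo≤x x<hi = subst (_∈ _) (pt-toℕ x)
          (∈-map⁺ pt (∈-iota⁺ lo≤x (subst (toℕ x <_) (sym (lo+gap e)) x<hi)))
      hi+gap : toℕ (hi e) + (n ∸ gap e) ≡ toℕ (lo e) + n
      hi+gap = trans (cong (_+ (n ∸ gap e)) (sym (lo+gap e)))
                (trans (+-assoc (toℕ (lo e)) (gap e) _)
                    (cong (toℕ (lo e) +_) (m+[n∸m]≡n (<⇒≤ (gap<n e)))))
      above∈ : ∀ {x} → hi e Fin.≤ x → x ∈ map pt (iota (toℕ (hi e)) (n ∸ gap e))
      above∈ {x} hi≤x = subst (_∈ _) (pt-toℕ x) (∈-map⁺ pt (∈-iota⁺ hi≤x
        (subst (toℕ x <_) (sym hi+gap) (<-≤-trans (Finₚ.toℕ<n x) (m≤n+m n _)))))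
      below∈ : ∀ {x} → x Fin.< lo e → x ∈ map pt (iota (toℕ (hi e)) (n ∸ gap e))
      below∈ {x} x<lo = subst (_∈ _) (trans (pt-+n (toℕ x)) (pt-toℕ x)) (∈-map⁺ pt (∈-iota⁺
        (≤-trans (<⇒≤ (Finₚ.toℕ<n (hi e))) (m≤n+m n _))
        (subst (toℕ x + n <_) (sym hi+gap) (+-monoˡ-< n x<lo))))
      inner : ∀ {f} → f ∈ X → lo f ∈ map pt (iota (toℕ (lo e)) (gap e)) ⊎ hi f ∈ map pt
          (iota (toℕ (lo e)) (gap e))
      inner f∈ with cross-lookup cross e∈ f∈
      ... | inj₁ refl                        = inj₁ (inside∈ ≤-refl (lo<hi′ e))
      ... | inj₂ (inj₁ (le<lf , lf<he , _))  = inj₁ (inside∈ (<⇒≤ le<lf) lf<he)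
      ... | inj₂ (inj₂ (_ , le<hf , hf<he))  = inj₂ (inside∈ (<⇒≤ le<hf) hf<he)
      outer : ∀ {f} → f ∈ X → lo f ∈ map pt (iota (toℕ (hi e)) (n ∸ gap e)) ⊎ hi f ∈ map pt
          (iota (toℕ (hi e)) (n ∸ gap e))
      outer f∈ with cross-lookup cross e∈ f∈
      ... | inj₁ refl                       = inj₂ (above∈ ≤-refl)
      ... | inj₂ (inj₁ (_ , _ , he<hf))     = inj₂ (above∈ (<⇒≤ he<hf))
      ... | inj₂ (inj₂ (lf<le , _ , _))     = inj₁ (below∈ lf<le)

    -- This interval does not wrap past the last vertex because `lo e` precedes `hi e`. A vertex
    -- before its start `p` has displacement n - (p - x), already beyond that of `hi e`.
    inInterval⇔ : ∀ (e : Edge n) x → InInterval (next (lo e)) (hi e) x ⇔ (lo e Fin.< x × x Fin.≤ hi e)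
    inInterval⇔ e x = mk⇔ to from
      where
      p = suc (toℕ (lo e))
      next≡ : next (lo e) ≡ pt p
      next≡ = next≡pt (lo e)
      above : ∀ {y : Fin n} → p ≤ toℕ y → y ⊖ next (lo e) ≡ toℕ y ∸ p
      above {y} p≤y = trans (cong₂ _⊖_ (sym (trans (cong pt (m+[n∸m]≡n p≤y)) (pt-toℕ y))) next≡)
                              (⊖-pt p (≤-<-trans (m∸n≤m (toℕ y) p) (Finₚ.toℕ<n y)))
      below : toℕ x < p → x ⊖ next (lo e) ≡ n ∸ (p ∸ toℕ x)
      below x<p = trans (cong₂ _⊖_ (sym (pt-toℕ x)) (trans next≡ (cong pt (sym (m+[n∸m]≡n (<⇒≤ x<p))))))
                          (⊖-pt-op (toℕ x) (m<n⇒0<n∸m x<p)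
                              (≤-<-trans (m∸n≤m p (toℕ x)) (≤-<-trans (lo<hi′ e) (Finₚ.toℕ<n (hi e)))))
      to : InInterval (next (lo e)) (hi e) x → lo e Fin.< x × x Fin.≤ hi e
      to in′ with p ≤? toℕ x
      ... | yes p≤x = p≤x , (begin
            toℕ x                   ≡⟨ m+[n∸m]≡n p≤x ⟨
            p + (toℕ x ∸ p)         ≤⟨ +-monoʳ-≤ p (subst₂ _≤_ (above p≤x) (above (lo<hi′ e)) in′) ⟩
            p + (toℕ (hi e) ∸ p)    ≡⟨ m+[n∸m]≡n (lo<hi′ e) ⟩
            toℕ (hi e)              ∎)
        where open ≤-Reasoning
      ... | no  p≰x = ⊥-elim (<⇒≱ (begin-strict
            toℕ (hi e) ∸ p          <⟨ ∸-monoˡ-< (Finₚ.toℕ<n (hi e)) (lo<hi′ e) ⟩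
            n ∸ p                   ≤⟨ ∸-monoʳ-≤ n (m∸n≤m p (toℕ x)) ⟩
            n ∸ (p ∸ toℕ x)         ∎) (subst₂ _≤_ (below (≰⇒> p≰x)) (above (lo<hi′ e)) in′))
        where open ≤-Reasoning
      from : lo e Fin.< x × x Fin.≤ hi e → InInterval (next (lo e)) (hi e) x
      from (lo<x , x≤hi) = subst₂ _≤_ (sym (above lo<x)) (sym (above (lo<hi′ e))) (∸-monoˡ-≤ p x≤hi)

    -- With 2d < n the complementary displacement n - d differs from `dist f`, so only one disjunct
    -- of `InShortSide` can hold, whichever way round the endpoints are stored.
    inShortSide⇔ : ∀ {f : Edge n} {i d} → 0 < d → d + d < n → Joins f (pt i) (pt (i + d)) →
                   ∀ x → InShortSide f x ⇔ x ⊖ pt i ≤ d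
    inShortSide⇔ {f} {i} {d} 0<d 2d<n j x = mk⇔ (to j) (from j)
      where
      d<n = <-trans (m<m+n d 0<d) 2d<n
      dist≡ : dist f ≡ d
      dist≡ = dist-pt-short 0<d (<⇒≤ 2d<n) j
      long≢ : n ∸ d ≢ dist f
      long≢ eq = <⇒≢ 2d<n (trans (cong (d +_) (sym (trans eq dist≡))) (m+[n∸m]≡n (<⇒≤ d<n)))
      forward = ⊖-pt i d<n
      backward = ⊖-pt-op i 0<d d<n
      to : Joins f (pt i) (pt (i + d)) → InShortSide f x → x ⊖ pt i ≤ d
      to (fwd refl h) (inj₁ (_ , in′)) = subst (x ⊖ lo f ≤_) (trans (cong (_⊖ lo f) h) forward) in′
      to (fwd l h)    (inj₂ (eq , _))  = ⊥-elim
          (long≢ (trans (sym (trans (cong₂ _⊖_ l h) backward)) eq))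
      to (bwd l h)    (inj₁ (eq , _))  = ⊥-elim
          (long≢ (trans (sym (trans (cong₂ _⊖_ h l) backward)) eq))
      to (bwd l refl) (inj₂ (_ , in′)) = subst (x ⊖ hi f ≤_) (trans (cong (_⊖ hi f) l) forward) in′
      from : Joins f (pt i) (pt (i + d)) → x ⊖ pt i ≤ d → InShortSide f x
      from (fwd l h) le = inj₁ (trans (trans (cong₂ _⊖_ h l) forward) (sym dist≡)
        , subst₂ _≤_ (cong (x ⊖_) (sym l)) (sym (trans (cong₂ _⊖_ h l) forward)) le)
      from (bwd l h) le = inj₂ (trans (trans (cong₂ _⊖_ l h) forward) (sym dist≡)
        , subst₂ _≤_ (cong (x ⊖_) (sym h)) (sym (trans (cong₂ _⊖_ l h) forward)) le)

    -- The sides of the polygon are the edges of length 1, the only ones to which no inequality is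
    -- attached; they account for the `∸ n` in the number of facets.
    side : Fin n → Edge n
    side i = mk i (next i)

    side-joins : ∀ p → Joins (side (pt p)) (pt p) (pt (p + 1))
    side-joins p = subst (Joins (side (pt p)) (pt p)) (trans (next-pt p) (cong pt (+-comm 1 p)))
      (mk-joins (λ eq → pt-≢ {p} {suc p} ≤-refl
          (subst (_< p + n) (+-comm p 1) (+-monoʳ-< p (<-trans (n<1+n 1) 3≤n)))
                          (trans eq (next-pt p))))

    side-dist : ∀ i → dist (side i) ≡ 1
    side-dist i = subst (λ j → dist (side j) ≡ 1) (pt-toℕ i)
        (dist-pt-short (s≤s z≤n) (<⇒≤ 3≤n) (side-joins (toℕ i)))

    side-injective : ∀ {i j} → side i ≡ side j → i ≡ j
    side-injective {i} {j} eq = subst₂ _≡_ (pt-toℕ i) (pt-toℕ j)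
      (name-unique {x = toℕ i} {toℕ j} {1} (s≤s z≤n) 3≤n
        (side-joins (toℕ i))
        (subst (λ f → Joins f (pt (toℕ j)) (pt (toℕ j + 1)))
            (trans (cong side (pt-toℕ j)) (trans (sym eq) (cong side (sym (pt-toℕ i)))))
            (side-joins (toℕ j))))

    dist≡1⇒side : ∀ e → dist e ≡ 1 → ∃[ i ] e ≡ side i
    dist≡1⇒side e d≡1 = pt base , joins-unique
        (subst (λ d → Joins e (pt base) (pt (base + d))) d≡1 joins) (side-joins base)
      where open Named (name e)

    edges-↭ : ∀ k → 1 ≤ k →
              (longInequalityEdges n k ++ shortInequalityEdges n k) ++ map side (allFin n) ↭ allEdges n
    edges-↭ k 1≤k = unique-↭
        (Uniqueₚ.++⁺ (Uniqueₚ.++⁺ (Uniqueₚ.filter⁺ long? (allEdges-unique n))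
            (Uniqueₚ.filter⁺ short? (allEdges-unique n)) disjoint₁)
                     (Uniqueₚ.map⁺ side-injective (Uniqueₚ.allFin⁺ n)) disjoint₂)
        (allEdges-unique n) (λ {e} _ → ∈-allEdges e) (λ {e} _ → covered e)
      where
      long? : ∀ (e : Edge n) → Dec (k + 1 ≤ dist e)
      long? e = k + 1 ≤? dist e
      short? : ∀ (e : Edge n) → Dec (2 ≤ dist e × dist e ≤ k)
      short? e = (2 ≤? dist e) ×-dec (dist e ≤? k)
      disjoint₁ : ∀ {e} → ¬ (e ∈ filter long? (allEdges n) × e ∈ filter short? (allEdges n))
      disjoint₁ {e} (p , q) with _ , k+1≤ ← ∈-filter⁻ long? {xs = allEdges n} p | _ , _ , ≤k ← ∈-filter⁻
          short? {xs = allEdges n} q =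
        <⇒≱ (subst (_≤ dist e) (+-comm k 1) k+1≤) ≤k
      disjoint₂ : ∀ {e} → ¬ (e ∈ filter long? (allEdges n) ++ filter short? (allEdges n) × e ∈ map side
          (allFin n))
      disjoint₂ (p , q) with i , _ , refl ← ∈-map⁻ side q | ∈-++⁻ (filter long? (allEdges n)) p
      -- This is where `1 ≤ k` enters the count: for k = 0 the threshold k+1 would admit the sides.
      ... | inj₁ p′ = <⇒≱ 2≤k+1
          (subst (k + 1 ≤_) (side-dist i) (proj₂ (∈-filter⁻ long? {xs = allEdges n} p′)))
        where
        2≤k+1 : 1 < k + 1
        2≤k+1 = subst (2 ≤_) (+-comm 1 k) (s≤s 1≤k)
      ... | inj₂ p′ = <-irrefl refl
          (subst (2 ≤_) (side-dist i) (proj₁ (proj₂ (∈-filter⁻ short? {xs = allEdges n} p′))))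
      covered : ∀ e → e ∈ (filter long? (allEdges n) ++ filter short? (allEdges n)) ++ map side
          (allFin n)
      covered e with k + 1 ≤? dist e | 2 ≤? dist e
      ... | yes l | _ = ∈-++⁺ˡ (∈-++⁺ˡ (∈-filter⁺ long? (∈-allEdges e) l))
      ... | no ¬l | yes 2≤ = ∈-++⁺ˡ
          (∈-++⁺ʳ (filter long? (allEdges n))
          (∈-filter⁺ short? (∈-allEdges e)
          (2≤ , s≤s⁻¹ (subst (suc (dist e) ≤_) (+-comm k 1) (≰⇒> ¬l)))))
      ... | no _  | no ¬2≤ with dist≡1⇒side e (≤-antisym (s≤s⁻¹ (≰⇒> ¬2≤)) (Named.0<d (name e)))
      ...   | i , refl = ∈-++⁺ʳ (filter long? (allEdges n) ++ filter short? (allEdges n))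
          (∈-map⁺ side (∈-allFin i))

    length-inequalityIndices : ∀ k → 1 ≤ k → length (inequalityIndices n k) ≡ (n C 2) ∸ n
    length-inequalityIndices k 1≤k = begin
      length (inequalityIndices n k)                                ≡⟨ length-++ (map inj₁ long) ⟩
      length (map inj₁ long) + length (map inj₂ short)              ≡⟨ cong₂ _+_ (length-map inj₁ long)
          (length-map inj₂ short) ⟩
      length long + length short                                    ≡⟨ m+n∸n≡m _ n ⟨
      length long + length short + n ∸ n                            ≡⟨ cong (_∸ n) total ⟩
      (n C 2) ∸ n                                                   ∎
      where
      open ≡-Reasoning
      long = longInequalityEdges n k
      short = shortInequalityEdges n k
      total : length long + length short + n ≡ n C 2
      total = begin
        length long + length short + n                              ≡⟨ cong₂ _+_ (sym (length-++ long))
            (sym (trans (length-map side (allFin n)) (length-tabulate {n = n} id))) ⟩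
        length (long ++ short) + length (map side (allFin n))       ≡⟨ length-++ (long ++ short) ⟨
        length ((long ++ short) ++ map side (allFin n))             ≡⟨ ↭-length (edges-↭ k 1≤k) ⟩
        length (allEdges n)                                         ≡⟨ length-allEdges n ⟩
        n C 2                                                       ∎

  -- Fans: the edges whose short side contains a given edge.

  module Fans (n : ℕ) (3≤n : 3 ≤ n) (k : ℕ) (m+m<n : suc k + suc k < n) where
    open Cyclic n 3≤n
    open Matchings n 3≤n
    open Distances n 3≤n

    m : ℕ
    m = suc k

    m<n : m < n
    m<n = ≤-<-trans (m≤m+n m m) m+m<n

    -- Row `t` consists of the edges {a+t, a+m+u} with 0 ≤ u ≤ t, the condition u ≤ t being the
    -- bound m + u - t ≤ m on the length. With `suc ℓ` rows the short sides are those that contain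
    -- {a+ℓ, a+m}.
    fanRow fan : ℕ → ℕ → List (Edge n)
    fanRow a ℓ = applyUpTo (λ u → E (a + ℓ) (a + m + u)) (suc ℓ)
    fan a zero    = []
    fan a (suc ℓ) = fanRow a ℓ ++ fan a ℓ

    E-fan-joins : ∀ a {t u} → t < m → u < m → Joins (E (a + t) (a + m + u)) (pt (a + t))
        (pt (a + m + u))
    E-fan-joins a {t} {u} t<m u<m = E-joins (<-≤-trans (+-monoʳ-< a t<m) (m≤m+n (a + m) u))
        (begin-strict
        a + m + u     <⟨ +-monoʳ-< (a + m) u<m ⟩
        a + m + m     ≡⟨ +-assoc a m m ⟩
        a + (m + m)   <⟨ +-monoʳ-< a m+m<n ⟩
        a + n         ≤⟨ +-monoˡ-≤ n (m≤m+n a t) ⟩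
        a + t + n     ∎)
      where open ≤-Reasoning

    shift-injective : ∀ a {x y} → x < m + m → y < m + m → pt (a + x) ≡ pt (a + y) → x ≡ y
    shift-injective a x<2m y<2m eq = +-cancelˡ-≡ a _ _ (window-injective a
      (m≤m+n a _) (+-monoʳ-< a (<-trans x<2m m+m<n)) (m≤m+n a _) (+-monoʳ-< a (<-trans y<2m m+m<n)) eq)

    E-fan-injective : ∀ a {t u t′ u′} → t < m → u < m → t′ < m → u′ < m →
                      E (a + t) (a + m + u) ≡ E (a + t′) (a + m + u′) → t ≡ t′ × u ≡ u′
    E-fan-injective a {t} {u} {t′} {u′} t<m u<m t′<m u′<m eq
      with joins-endpoints (E-fan-joins a t<m u<m)
          (subst (λ f → Joins f (pt (a + t′)) (pt (a + m + u′))) (sym eq) (E-fan-joins a t′<m u′<m))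
    ... | inj₁ (p , q) = shift-injective a (small t<m) (small t′<m) p
                       , +-cancelˡ-≡ m _ _ (shift-injective a (+-monoʳ-< m u<m) (+-monoʳ-< m u′<m)
                           (trans (cong pt (sym (+-assoc a m u))) (trans q (cong pt (+-assoc a m u′)))))
      where
      small : ∀ {t} → t < m → t < m + m
      small t<m = <-≤-trans t<m (m≤m+n m m)
    ... | inj₂ (p , _) = ⊥-elim (<⇒≢ (<-≤-trans t<m (m≤m+n m u′))
                           (shift-injective a (<-≤-trans t<m (m≤m+n m m)) (+-monoʳ-< m u′<m)
                               (trans p (cong pt (+-assoc a m u′)))))

    ∈-fan⁺ : ∀ a {ℓ t u} → t < ℓ → u ≤ t → E (a + t) (a + m + u) ∈ fan a ℓ
    ∈-fan⁺ a {suc ℓ} {t} {u} t<1+ℓ u≤t with m≤n⇒m<n∨m≡n (s≤s⁻¹ t<1+ℓ)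
    ... | inj₁ t<ℓ  = ∈-++⁺ʳ (fanRow a ℓ) (∈-fan⁺ a t<ℓ u≤t)
    ... | inj₂ refl = ∈-++⁺ˡ (∈-applyUpTo⁺ (λ u → E (a + ℓ) (a + m + u)) (s≤s u≤t))

    ∈-fan⁻ : ∀ a ℓ {f} → f ∈ fan a ℓ → ∃₂ λ t u → t < ℓ × u ≤ t × f ≡ E (a + t) (a + m + u)
    ∈-fan⁻ a (suc ℓ) f∈ with ∈-++⁻ (fanRow a ℓ) f∈
    ... | inj₁ p with u , u<1+ℓ , refl ← ∈-applyUpTo⁻ (λ u → E (a + ℓ) (a + m + u)) p =
        ℓ , u , ≤-refl , s≤s⁻¹ u<1+ℓ , refl
    ... | inj₂ p with t , u , t<ℓ , u≤t , eq ← ∈-fan⁻ a ℓ p = t , u , m<n⇒m<1+n t<ℓ , u≤t , eq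

    fan-unique : ∀ a ℓ → ℓ ≤ m → Unique (fan a ℓ)
    fan-unique a zero    _   = []
    fan-unique a (suc ℓ) ℓ<m = Uniqueₚ.++⁺
        (Uniqueₚ.applyUpTo⁺₁ (λ u → E (a + ℓ) (a + m + u)) (suc ℓ)
          (λ i<j j≤ℓ eq → <⇒≢ i<j (proj₂
              (E-fan-injective a ℓ<m (<-trans i<j (<-≤-trans j≤ℓ ℓ<m)) ℓ<m (<-≤-trans j≤ℓ ℓ<m) eq))))
        (fan-unique a ℓ (<⇒≤ ℓ<m)) disjoint
      where
      disjoint : ∀ {f} → ¬ (f ∈ fanRow a ℓ × f ∈ fan a ℓ)
      disjoint (p , q) with u , u≤ℓ , refl ← ∈-applyUpTo⁻ (λ u → E (a + ℓ) (a + m + u)) p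
                          | t , u′ , t<ℓ , u′≤t , eq ← ∈-fan⁻ a ℓ q =
        <⇒≢ t<ℓ (sym (proj₁ (E-fan-injective a ℓ<m (<-≤-trans u≤ℓ ℓ<m) (<-trans t<ℓ ℓ<m)
            (≤-<-trans u′≤t (<-trans t<ℓ ℓ<m)) eq)))

    -- A short side of length d containing the edge starts r₁ steps before a+ℓ and ends d - r₂ steps
    -- after a+m, where r₁ and r₂ are the displacements of these two vertices from its start. This
    -- gives t = ℓ - r₁ and u = d - r₂, and the condition d ≤ m turns into u ≤ t.
    enclosing-↭-fan : ∀ {e} a ℓ → ℓ < m → Joins e (pt (a + ℓ)) (pt (a + m)) →
        enclosing n k e ↭ fan a (suc ℓ)
    enclosing-↭-fan {e} a ℓ ℓ<m je = unique-↭ (Uniqueₚ.filter⁺ P? (allEdges-unique n))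
        (fan-unique a (suc ℓ) ℓ<m) to from
      where
      P? : ∀ (f : Edge n) → Dec (dist f ≤ k + 1 × InShortSide f (lo e) × InShortSide f (hi e))
      P? f = (dist f ≤? k + 1) ×-dec (inShortSide? f (lo e) ×-dec inShortSide? f (hi e))

      both : ∀ {f} → (∀ x → x ≡ pt (a + ℓ) ⊎ x ≡ pt (a + m) → InShortSide f x) ⇔
          (InShortSide f (lo e) × InShortSide f (hi e))
      both {f} = mk⇔ (fwd′ je) (λ s → bwd′ je s)
        where
        fwd′ : Joins e (pt (a + ℓ)) (pt (a + m)) → _ → InShortSide f (lo e) × InShortSide f (hi e)
        fwd′ (fwd l h) s = s (lo e) (inj₁ l) , s (hi e) (inj₂ h)
        fwd′ (bwd l h) s = s (lo e) (inj₂ l) , s (hi e) (inj₁ h)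
        bwd′ : Joins e (pt (a + ℓ)) (pt (a + m)) → InShortSide f (lo e) × InShortSide f (hi e) →
               ∀ x → x ≡ pt (a + ℓ) ⊎ x ≡ pt (a + m) → InShortSide f x
        bwd′ (fwd l h) (p , q) x (inj₁ refl) = subst (InShortSide f) l p
        bwd′ (fwd l h) (p , q) x (inj₂ refl) = subst (InShortSide f) h q
        bwd′ (bwd l h) (p , q) x (inj₁ refl) = subst (InShortSide f) h q
        bwd′ (bwd l h) (p , q) x (inj₂ refl) = subst (InShortSide f) l p

      to : ∀ {f} → f ∈ enclosing n k e → f ∈ fan a (suc ℓ)
      to {f} f∈ with _ , d≤k+1 , sides ← ∈-filter⁻ P? {xs = allEdges n} f∈ =
        subst (_∈ fan a (suc ℓ)) (sym
            (joins-unique (subst₂ (Joins f) (sym i≡) (sym j≡) joins) (E-fan-joins a t<m u<m)))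
          (∈-fan⁺ a (s≤s (m∸n≤m ℓ r₁)) u≤t)
        where
        open Named (name f)
        d = dist f
        d≤m : d ≤ m
        d≤m = subst (d ≤_) (+-comm k 1) d≤k+1
        δ = m ∸ ℓ
        ℓ+δ : ℓ + δ ≡ m
        ℓ+δ = m+[n∸m]≡n (<⇒≤ ℓ<m)
        2d<n : d + d < n
        2d<n = ≤-<-trans (+-mono-≤ d≤m d≤m) m+m<n
        r₁ = pt (a + ℓ) ⊖ pt base
        r₂ = pt (a + m) ⊖ pt base
        within : ∀ x → x ≡ pt (a + ℓ) ⊎ x ≡ pt (a + m) → x ⊖ pt base ≤ d
        within x x≡ = Equivalence.to (inShortSide⇔ {i = base} 0<d 2d<n joins x)
            (Equivalence.from (both {f}) sides x x≡)
        r₁≤d : r₁ ≤ d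
        r₁≤d = within _ (inj₁ refl)
        r₂≤d : r₂ ≤ d
        r₂≤d = within _ (inj₂ refl)
        at₁ : pt (base + r₁) ≡ pt (a + ℓ)
        at₁ = pt-⊖′ (a + ℓ) base
        at₂ : pt (base + r₂) ≡ pt (a + m)
        at₂ = pt-⊖′ (a + m) base
        -- Both numbers lead from `base` to the vertex a+m. Both are below `n`, the second because
        -- r₁ and δ are at most `m`, so there is no wrap between the two vertices.
        r₂≡ : r₂ ≡ r₁ + δ
        r₂≡ = +-cancelˡ-≡ base _ _ (window-injective base (m≤m+n base _)
          (+-monoʳ-< base (≤-<-trans (≤-trans r₂≤d d≤m) m<n)) (m≤m+n base _)
          (+-monoʳ-< base (≤-<-trans (+-mono-≤ (≤-trans r₁≤d d≤m) (m∸n≤m m ℓ)) m+m<n))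
          (trans at₂ (trans (cong pt (trans (cong (a +_) (sym ℓ+δ)) (sym (+-assoc a ℓ δ))))
            (trans (pt-shift δ (sym at₁)) (cong pt (+-assoc base r₁ δ))))))
        r₁≤ℓ : r₁ ≤ ℓ
        r₁≤ℓ = +-cancelʳ-≤ δ _ _ (begin
          r₁ + δ  ≡⟨ r₂≡ ⟨
          r₂      ≤⟨ r₂≤d ⟩
          d       ≤⟨ d≤m ⟩
          m       ≡⟨ ℓ+δ ⟨
          ℓ + δ   ∎)
          where open ≤-Reasoning
        t = ℓ ∸ r₁
        u = d ∸ r₂
        t<m : t < m
        t<m = ≤-<-trans (m∸n≤m ℓ r₁) ℓ<m
        u≤t : u ≤ t
        u≤t = begin
          d ∸ r₂            ≤⟨ ∸-monoˡ-≤ r₂ d≤m ⟩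
          m ∸ r₂            ≡⟨ cong₂ _∸_ (sym ℓ+δ) r₂≡ ⟩
          ℓ + δ ∸ (r₁ + δ)  ≡⟨ [m+n]∸[o+n]≡m∸o ℓ r₁ ⟩
          ℓ ∸ r₁            ∎
          where
          open ≤-Reasoning
          [m+n]∸[o+n]≡m∸o : ∀ x y → x + δ ∸ (y + δ) ≡ x ∸ y
          [m+n]∸[o+n]≡m∸o x y = trans (cong₂ _∸_ (+-comm x δ) (+-comm y δ)) ([m+n]∸[m+o]≡n∸o δ x y)
        u<m : u < m
        u<m = ≤-<-trans u≤t t<m
        i≡ : pt (a + t) ≡ pt base
        i≡ = pt-cancel r₁ (trans (cong pt (trans (+-assoc a t r₁) (cong (a +_) (m∸n+n≡m r₁≤ℓ))))
            (sym at₁))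
        j≡ : pt (a + m + u) ≡ pt (base + d)
        j≡ = trans (pt-shift u (sym at₂))
            (cong pt (trans (+-assoc base r₂ u) (cong (base +_) (m+[n∸m]≡n r₂≤d))))

      from : ∀ {f} → f ∈ fan a (suc ℓ) → f ∈ enclosing n k e
      from {f} f∈ with t , u , t≤ℓ , u≤t , refl ← ∈-fan⁻ a (suc ℓ) f∈ =
        ∈-filter⁺ P? (∈-allEdges f)
            (subst (_≤ k + 1) (sym dist≡) (subst (d ≤_) (+-comm 1 k) d≤m) , Equivalence.to (both {f})
            (λ x → inside′ x))
        where
        t<m : t < m
        t<m = <-≤-trans t≤ℓ ℓ<m
        d = m + u ∸ t
        t+d : t + d ≡ m + u
        t+d = m+[n∸m]≡n (≤-trans (<⇒≤ t<m) (m≤m+n m u))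
        d≤m : d ≤ m
        d≤m = m≤n+o⇒m∸n≤o (m + u) t (subst (m + u ≤_) (+-comm m t) (+-monoʳ-≤ m u≤t))
        0<d : 0 < d
        0<d = m<n⇒0<n∸m (<-≤-trans t<m (m≤m+n m u))
        2d<n : d + d < n
        2d<n = ≤-<-trans (+-mono-≤ d≤m d≤m) m+m<n
        i+d : a + t + d ≡ a + m + u
        i+d = trans (+-assoc a t d) (trans (cong (a +_) t+d) (sym (+-assoc a m u)))
        joins : Joins f (pt (a + t)) (pt (a + t + d))
        joins = subst (λ x → Joins f (pt (a + t)) (pt x)) (sym i+d)
            (E-fan-joins a t<m (≤-<-trans u≤t t<m))
        dist≡ : dist f ≡ d
        dist≡ = dist-pt-short 0<d (<⇒≤ 2d<n) joins
        offset : ∀ {s} → t ≤ s → s ≤ m → pt (a + s) ⊖ pt (a + t) ≤ d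
        offset {s} t≤s s≤m = subst (_≤ d)
            (sym (trans (cong (λ x → pt x ⊖ pt (a + t))
            (trans (cong (a +_) (sym (m+[n∸m]≡n t≤s))) (sym (+-assoc a t (s ∸ t)))))
            (⊖-pt (a + t) (≤-<-trans (m∸n≤m s t) (≤-<-trans s≤m m<n)))))
          (∸-monoˡ-≤ t (≤-trans s≤m (m≤m+n m u)))
        inside′ : ∀ x → x ≡ pt (a + ℓ) ⊎ x ≡ pt (a + m) → InShortSide f x
        inside′ x (inj₁ refl) = Equivalence.from (inShortSide⇔ {i = a + t} 0<d 2d<n joins x)
            (offset (s≤s⁻¹ t≤ℓ) (<⇒≤ ℓ<m))
        inside′ x (inj₂ refl) = Equivalence.from (inShortSide⇔ {i = a + t} 0<d 2d<n joins x)
            (offset (<⇒≤ t<m) ≤-refl)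

open Combinatorics

-- Ordered fields: a ring solver, order and halves.

module FieldProperties {c ℓ₁ ℓ₂} (F : OrderedField c ℓ₁ ℓ₂) where

  open OrderedField F
  open CommutativeRing commutativeRing public
    using ( refl; sym; trans; reflexive; setoid; ring; semiring; +-abelianGroup
          ; +-cong; +-congˡ; +-congʳ; +-comm; +-assoc; +-identityˡ; +-identityʳ; -‿cong; -‿inverseʳ
          ; *-congˡ; *-congʳ; *-assoc; *-identityˡ; *-identityʳ; zeroˡ; zeroʳ; distribˡ)
  open IsTotalOrder isTotalOrder public
    using (total; antisym)
    renaming (refl to ≤-refl; trans to ≤-trans; reflexive to ≤-reflexive; ≤-respˡ-≈ to ≤-respˡ;
        ≤-respʳ-≈ to ≤-respʳ)
  open import Algebra.Properties.Ring ring public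
    using (-0#≈0#; -‿involutive; -‿distribˡ-*; -‿distribʳ-*)
  open import Algebra.Properties.AbelianGroup +-abelianGroup using (⁻¹-∙-comm)
  open import Algebra.Properties.Semiring.Mult.TCOptimised semiring using (1+×; ×-homo-+; ×1-homo-*)
      renaming (_×_ to _⋆_)
  open import Relation.Binary.Reasoning.Setoid setoid

  -- The ring solver compares coefficients. Equality in the field need not be decidable, so the
  -- coefficients are integers mapped into it.
  fromℤ : ℤ → Carrier
  fromℤ (ℤ.+ i)  = i ⋆ 1#
  fromℤ -[1+ i ] = - (suc i ⋆ 1#)

  fromℤ-⊖ : ∀ i j → fromℤ (i ℤ.⊖ j) ≈ i ⋆ 1# + - (j ⋆ 1#)
  fromℤ-⊖ i zero = sym (trans (+-congˡ -0#≈0#) (+-identityʳ _))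
  fromℤ-⊖ zero (suc j) = sym (+-identityˡ _)
  fromℤ-⊖ (suc i) (suc j) = begin
    fromℤ (suc i ℤ.⊖ suc j)                     ≈⟨ reflexive (≡.cong fromℤ (ℤₚ.[1+m]⊖[1+n]≡m⊖n i j)) ⟩
    fromℤ (i ℤ.⊖ j)                             ≈⟨ fromℤ-⊖ i j ⟩
    i ⋆ 1# + - (j ⋆ 1#)                         ≈⟨ +-identityˡ _ ⟨
    0# + (i ⋆ 1# + - (j ⋆ 1#))                  ≈⟨ +-congʳ (-‿inverseʳ 1#) ⟨
    1# + - 1# + (i ⋆ 1# + - (j ⋆ 1#))           ≈⟨ interchange 1# (- 1#) (i ⋆ 1#) (- (j ⋆ 1#)) ⟩
    1# + i ⋆ 1# + (- 1# + - (j ⋆ 1#))           ≈⟨ +-cong (sym (1+× i 1#))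
        (trans (⁻¹-∙-comm 1# (j ⋆ 1#)) (-‿cong (sym (1+× j 1#)))) ⟩
    suc i ⋆ 1# + - (suc j ⋆ 1#)                 ∎
    where
    open import Algebra.Properties.CommutativeSemigroup
        (CommutativeRing.+-commutativeSemigroup commutativeRing) using (interchange)

  fromℤ-+ : ∀ i j → fromℤ (i ℤ.+ j) ≈ fromℤ i + fromℤ j
  fromℤ-+ (ℤ.+ i)  (ℤ.+ j)  = ×-homo-+ 1# i j
  fromℤ-+ (ℤ.+ i)  -[1+ j ] = fromℤ-⊖ i (suc j)
  fromℤ-+ -[1+ i ] (ℤ.+ j)  = trans (fromℤ-⊖ j (suc i)) (+-comm _ _)
  fromℤ-+ -[1+ i ] -[1+ j ] = begin
    - (suc (suc (i ℕ.+ j)) ⋆ 1#)           ≈⟨ -‿cong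
        (reflexive (≡.cong (λ x → suc x ⋆ 1#) (≡.sym (ℕₚ.+-suc i j)))) ⟩
    - ((suc i ℕ.+ suc j) ⋆ 1#)             ≈⟨ -‿cong (×-homo-+ 1# (suc i) (suc j)) ⟩
    - (suc i ⋆ 1# + suc j ⋆ 1#)            ≈⟨ ⁻¹-∙-comm _ _ ⟨
    - (suc i ⋆ 1#) + - (suc j ⋆ 1#)        ∎
    where import Data.Nat.Properties as ℕₚ

  fromℤ-neg : ∀ i → fromℤ (ℤ.- i) ≈ - fromℤ i
  fromℤ-neg (ℤ.+ zero)  = sym -0#≈0#
  fromℤ-neg (ℤ.+ suc i) = refl
  fromℤ-neg -[1+ i ]    = sym (-‿involutive _)

  fromℤ-◃⁻ : ∀ i → fromℤ (Sign.- ℤ.◃ i) ≈ - (i ⋆ 1#)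
  fromℤ-◃⁻ zero    = sym -0#≈0#
  fromℤ-◃⁻ (suc i) = refl

  fromℤ-◃⁺ : ∀ i → fromℤ (Sign.+ ℤ.◃ i) ≈ i ⋆ 1#
  fromℤ-◃⁺ zero    = refl
  fromℤ-◃⁺ (suc i) = refl

  fromℤ-* : ∀ i j → fromℤ (i ℤ.* j) ≈ fromℤ i * fromℤ j
  fromℤ-* (ℤ.+ i)  (ℤ.+ j)  = trans (fromℤ-◃⁺ (i ℕ.* j)) (×1-homo-* i j)
  fromℤ-* (ℤ.+ i)  -[1+ j ] = trans (fromℤ-◃⁻ (i ℕ.* suc j))
      (trans (-‿cong (×1-homo-* i (suc j))) (-‿distribʳ-* _ _))
  fromℤ-* -[1+ i ] (ℤ.+ j)  = trans (fromℤ-◃⁻ (suc i ℕ.* j))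
      (trans (-‿cong (×1-homo-* (suc i) j)) (-‿distribˡ-* _ _))
  fromℤ-* -[1+ i ] -[1+ j ] = begin
    (suc i ℕ.* suc j) ⋆ 1#             ≈⟨ ×1-homo-* (suc i) (suc j) ⟩
    suc i ⋆ 1# * (suc j ⋆ 1#)          ≈⟨ -‿involutive _ ⟨
    - (- (suc i ⋆ 1# * (suc j ⋆ 1#)))  ≈⟨ -‿cong (-‿distribˡ-* _ _) ⟩
    - (- (suc i ⋆ 1#) * (suc j ⋆ 1#))  ≈⟨ -‿distribʳ-* _ _ ⟩
    - (suc i ⋆ 1#) * - (suc j ⋆ 1#)    ∎

  ℤ⟶F : ℤ.+-*-rawRing -Raw-AlmostCommutative⟶ fromCommutativeRing commutativeRing
  ℤ⟶F = record { ⟦_⟧ = fromℤ ; +-homo = fromℤ-+ ; *-homo = fromℤ-* ; -‿homo = fromℤ-neg ; 0-homo =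
      refl ; 1-homo = refl }

  fromℤ-≟ : WeaklyDecidable (λ i j → fromℤ i ≈ fromℤ j)
  fromℤ-≟ i j = Maybe.map (λ eq → reflexive (≡.cong fromℤ eq)) (dec⇒maybe (i ℤₚ.≟ j))

  open Algebra.Solver.Ring ℤ.+-*-rawRing (fromCommutativeRing commutativeRing) ℤ⟶F fromℤ-≟ public
    using (solve; _:=_; _:+_; _:*_; _:-_; :-_; con)

  0≤-cong : ∀ {x y} → x ≈ y → 0# ≤ x → 0# ≤ y
  0≤-cong = ≤-respʳ

  +-mono-≤ : ∀ {x y z w} → x ≤ y → z ≤ w → x + z ≤ y + w
  +-mono-≤ {x} {y} {z} {w} x≤y z≤w = ≤-trans (+-monoˡ-≤ z x≤y)
    (≤-respˡ (+-comm z y) (≤-respʳ (+-comm w y) (+-monoˡ-≤ y z≤w)))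

  x≤y⇒0≤y-x : ∀ {x y} → x ≤ y → 0# ≤ y + - x
  x≤y⇒0≤y-x {x} x≤y = ≤-respˡ (-‿inverseʳ x) (+-monoˡ-≤ (- x) x≤y)

  0≤y-x⇒x≤y : ∀ {x y} → 0# ≤ y + - x → x ≤ y
  0≤y-x⇒x≤y {x} {y} p = ≤-respˡ (+-identityˡ x)
    (≤-respʳ (solve 2 (λ x y → y :+ :- x :+ x := y) refl x y) (+-monoˡ-≤ x p))

  0≤-neg⇒≤0 : ∀ {x} → 0# ≤ - x → x ≤ 0#
  0≤-neg⇒≤0 {x} p = 0≤y-x⇒x≤y (≤-respʳ (sym (+-identityˡ (- x))) p)

  ≤0⇒0≤-neg : ∀ {x} → x ≤ 0# → 0# ≤ - x
  ≤0⇒0≤-neg {x} p = ≤-respʳ (+-identityˡ (- x)) (x≤y⇒0≤y-x p)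

  0≤±⇒≈0 : ∀ {x} → 0# ≤ x → 0# ≤ - x → x ≈ 0#
  0≤±⇒≈0 p q = antisym (0≤-neg⇒≤0 q) p

  -- If 1 were at most 0, then -1 would be nonnegative, and so would its square, which is 1.
  0≤1 : 0# ≤ 1#
  0≤1 with total 0# 1#
  ... | inj₁ p = p
  ... | inj₂ p = ≤-respʳ (solve 0 (:- con (ℤ.+ 1) :* :- con (ℤ.+ 1) := con (ℤ.+ 1)) refl)
                   (*-nonNeg (≤0⇒0≤-neg p) (≤0⇒0≤-neg p))

  1≰0 : ¬ (1# ≤ 0#)
  1≰0 p = 1≉0 (antisym p 0≤1)

  2≰0 : ¬ (1# + 1# ≤ 0#)
  2≰0 p = 1≰0 (≤-trans (≤-respˡ (+-identityʳ 1#) (+-mono-≤ ≤-refl 0≤1)) p)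

  0≰-1 : ¬ (0# ≤ - 1#)
  0≰-1 p = 1≰0 (0≤-neg⇒≤0 p)

  0≰-2 : ¬ (0# ≤ - (1# + 1#))
  0≰-2 p = 2≰0 (0≤-neg⇒≤0 p)

  half : ∃[ h ] (1# + 1#) * h ≈ 1#
  half = inverse (1# + 1#) (2≰0 ∘ ≤-reflexive)

  ½ : Carrier
  ½ = proj₁ half

  ½+½ : ½ + ½ ≈ 1#
  ½+½ = trans (solve 1 (λ h → h :+ h := (con (ℤ.+ 1) :+ con (ℤ.+ 1)) :* h) refl ½) (proj₂ half)

  0≤½ : 0# ≤ ½
  0≤½ with total 0# ½
  ... | inj₁ p = p
  ... | inj₂ p = ⊥-elim (1≰0 (≤-respˡ ½+½ (≤-respʳ (+-identityˡ 0#) (+-mono-≤ p p))))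

  ½*-double : ∀ x → ½ * x * (1# + 1#) ≈ x
  ½*-double x = trans (solve 2
      (λ h x → h :* x :* (con (ℤ.+ 1) :+ con (ℤ.+ 1)) := (h :+ h) :* x) refl ½ x)
                  (trans (*-congʳ ½+½) (*-identityˡ x))

  double≈0 : ∀ {x} → x * (1# + 1#) ≈ 0# → x ≈ 0#
  double≈0 {x} eq = trans (sym (½*-double x)) (trans (*-assoc ½ x _) (trans (*-congˡ eq) (zeroʳ ½)))

-- Finite sums and linear functionals on edge vectors.

module Sums {c ℓ₁ ℓ₂} (F : OrderedField c ℓ₁ ℓ₂) (n : ℕ) where
  open OrderedField F
  open FieldProperties F
  open EdgeSpace F n

  module _ {a} {A : Set a} where

    ∑-cong : ∀ (xs : List A) {f g : A → Carrier} → (∀ {x} → x ∈ xs → f x ≈ g x) → ∑ xs f ≈ ∑ xs g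
    ∑-cong []       _  = refl
    ∑-cong (x ∷ xs) eq = +-cong (eq (here ≡.refl)) (∑-cong xs (eq ∘ there))

    ∑-zero : ∀ (xs : List A) {f : A → Carrier} → (∀ {x} → x ∈ xs → f x ≈ 0#) → ∑ xs f ≈ 0#
    ∑-zero []       _  = refl
    ∑-zero (x ∷ xs) eq = trans (+-cong (eq (here ≡.refl)) (∑-zero xs (eq ∘ there))) (+-identityˡ 0#)

    ∑-distrib-+ : ∀ (xs : List A) (f g : A → Carrier) → ∑ xs (λ x → f x + g x) ≈ ∑ xs f + ∑ xs g
    ∑-distrib-+ []       f g = sym (+-identityˡ 0#)
    ∑-distrib-+ (x ∷ xs) f g = trans (+-congˡ (∑-distrib-+ xs f g))
      (solve 4 (λ a b c d → a :+ b :+ (c :+ d) := a :+ c :+ (b :+ d)) refl (f x) (g x)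
          (∑ xs f) (∑ xs g))

    ∑-distrib-* : ∀ (xs : List A) a (f : A → Carrier) → ∑ xs (λ x → a * f x) ≈ a * ∑ xs f
    ∑-distrib-* []       a f = sym (zeroʳ a)
    ∑-distrib-* (x ∷ xs) a f = trans (+-congˡ (∑-distrib-* xs a f)) (sym (distribˡ a (f x) (∑ xs f)))

    ∑-++ : ∀ (xs ys : List A) (f : A → Carrier) → ∑ (xs ++ ys) f ≈ ∑ xs f + ∑ ys f
    ∑-++ []       ys f = sym (+-identityˡ _)
    ∑-++ (x ∷ xs) ys f = trans (+-congˡ (∑-++ xs ys f)) (sym (+-assoc (f x) (∑ xs f) (∑ ys f)))

    ∑-↭ : ∀ {xs ys : List A} (f : A → Carrier) → xs ↭ ys → ∑ xs f ≈ ∑ ys f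
    ∑-↭ f Perm.refl         = refl
    ∑-↭ f (Perm.prep x p)   = +-congˡ (∑-↭ f p)
    ∑-↭ {xs = _ ∷ _ ∷ xs} f (Perm.swap x y p) = trans
      (solve 3 (λ a b c → a :+ (b :+ c) := b :+ (a :+ c)) refl (f x) (f y) (∑ xs f))
          (+-congˡ (+-congˡ (∑-↭ f p)))
    ∑-↭ f (Perm.trans p q)  = trans (∑-↭ f p) (∑-↭ f q)

    ∑-mono-≤ : ∀ (xs : List A) {f g : A → Carrier} → (∀ {x} → x ∈ xs → f x ≤ g x) → ∑ xs f ≤ ∑ xs g
    ∑-mono-≤ []       _  = ≤-refl
    ∑-mono-≤ (x ∷ xs) le = +-mono-≤ (le (here ≡.refl)) (∑-mono-≤ xs (le ∘ there))

    ∑-single : ∀ {xs : List A} {y} {f : A → Carrier} → Unique xs → y ∈ xs →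
               (∀ {x} → x ∈ xs → x ≢ y → f x ≈ 0#) → ∑ xs f ≈ f y
    ∑-single {x ∷ xs} (px ∷ u) (here ≡.refl) eq =
      trans (+-congˡ (∑-zero xs (λ x∈ → eq (there x∈) (All.lookup px x∈ ∘ ≡.sym)))) (+-identityʳ _)
    ∑-single {x ∷ xs} (px ∷ u) (there y∈) eq =
      trans (+-cong (eq (here ≡.refl) (All.lookup px y∈)) (∑-single u y∈ (eq ∘ there))) (+-identityˡ _)

  ∑-map : ∀ {a b} {A : Set a} {B : Set b} (h : A → B) xs (f : B → Carrier) →
      ∑ (map h xs) f ≈ ∑ xs (f ∘ h)
  ∑-map h []       f = refl
  ∑-map h (x ∷ xs) f = +-congˡ (∑-map h xs f)

  -- The recursion splits off the last term, as `fan` splits off its last row; `∑<-suc` gives the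
  -- split at the first term that the rotation of partners calls for.
  ∑< : ℕ → (ℕ → Carrier) → Carrier
  ∑< zero    f = 0#
  ∑< (suc l) f = ∑< l f + f l

  ∑<-cong : ∀ l {f g} → (∀ t → t ℕ.< l → f t ≈ g t) → ∑< l f ≈ ∑< l g
  ∑<-cong zero    eq = refl
  ∑<-cong (suc l) eq = +-cong (∑<-cong l (λ t t<l → eq t (ℕₚ.m<n⇒m<1+n t<l))) (eq l ℕₚ.≤-refl)

  ∑<-zero : ∀ l {f} → (∀ t → t ℕ.< l → f t ≈ 0#) → ∑< l f ≈ 0#
  ∑<-zero zero    eq = refl
  ∑<-zero (suc l) eq = trans (+-cong (∑<-zero l (λ t t<l → eq t (ℕₚ.m<n⇒m<1+n t<l))) (eq l ℕₚ.≤-refl))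
      (+-identityˡ 0#)

  ∑<-suc : ∀ l f → ∑< (suc l) f ≈ f 0 + ∑< l (f ∘ suc)
  ∑<-suc zero    f = +-comm 0# (f 0)
  ∑<-suc (suc l) f = trans (+-congʳ (∑<-suc l f)) (+-assoc _ _ _)

  record IsLinear (φ : V → Carrier) : Set (c ⊔ ℓ₁) where
    field
      ≋-cong : ∀ {v w} → v ≋ w → φ v ≈ φ w
      +-homo : ∀ v w → φ (v ⊕ w) ≈ φ v + φ w
      *-homo : ∀ a v → φ (λ e → a * v e) ≈ a * φ v

    zero-homo : φ 𝟎 ≈ 0#
    zero-homo = trans (≋-cong (λ e → sym (zeroˡ 0#))) (trans (*-homo 0# 𝟎) (zeroˡ _))

    neg-homo : ∀ v → φ (⊝ v) ≈ - φ v
    neg-homo v = trans (≋-cong (λ e → neg≈ (v e))) (trans (*-homo (- 1#) v) (sym (neg≈ (φ v))))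
      where
      neg≈ : ∀ x → - x ≈ - 1# * x
      neg≈ x = trans (-‿cong (sym (*-identityˡ x))) (-‿distribˡ-* 1# x)

    comb-homo : ∀ {I : Set} (xs : List I) a (g : I → V) → φ (comb xs a g) ≈ ∑ xs (λ x → a x * φ (g x))
    comb-homo []       a g = zero-homo
    comb-homo (x ∷ xs) a g = trans (+-homo (λ e → a x * g x e) (comb xs a g))
        (+-cong (*-homo (a x) (g x)) (comb-homo xs a g))

  open IsLinear

  linear-coord : ∀ e → IsLinear (λ v → v e)
  linear-coord e = record { ≋-cong = λ eq → eq e ; +-homo = λ _ _ → refl ; *-homo = λ _ _ → refl }

  linear-0 : IsLinear (λ _ → 0#)
  linear-0 = record { ≋-cong = λ _ → refl ; +-homo = λ _ _ → sym (+-identityˡ 0#) ; *-homo = λ a _ →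
      sym (zeroʳ a) }

  linear-+ : ∀ {φ ψ} → IsLinear φ → IsLinear ψ → IsLinear (λ v → φ v + ψ v)
  linear-+ {φ} {ψ} l m = record
    { ≋-cong = λ eq → +-cong (≋-cong l eq) (≋-cong m eq)
    ; +-homo = λ v w → trans (+-cong (+-homo l v w) (+-homo m v w))
        (solve 4 (λ a b c d → a :+ b :+ (c :+ d) := a :+ c :+ (b :+ d)) refl (φ v) (φ w) (ψ v) (ψ w))
    ; *-homo = λ a v → trans (+-cong (*-homo l a v) (*-homo m a v)) (sym (distribˡ a (φ v) (ψ v)))
    }

  linear-neg : ∀ {φ} → IsLinear φ → IsLinear (λ v → - φ v)
  linear-neg {φ} l = record
    { ≋-cong = λ eq → -‿cong (≋-cong l eq)
    ; +-homo = λ v w → trans (-‿cong (+-homo l v w))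
        (solve 2 (λ a b → :- (a :+ b) := :- a :+ :- b) refl (φ v) (φ w))
    ; *-homo = λ a v → trans (-‿cong (*-homo l a v)) (-‿distribʳ-* a (φ v))
    }

  linear-∑ : ∀ {a} {A : Set a} (xs : List A) {φ : A → V → Carrier} → (∀ x → IsLinear (φ x)) →
      IsLinear (λ v → ∑ xs (λ x → φ x v))
  linear-∑ []       l = linear-0
  linear-∑ (x ∷ xs) l = linear-+ (l x) (linear-∑ xs l)

  linear-∑< : ∀ k {φ : ℕ → V → Carrier} → (∀ t → IsLinear (φ t)) → IsLinear (λ v → ∑< k (λ t → φ t v))
  linear-∑< zero    l = linear-0
  linear-∑< (suc k) l = linear-+ (linear-∑< k l) (l k)

  linear-⟨⟩ : ∀ x y → IsLinear (_⟨ x , y ⟩)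
  linear-⟨⟩ x y = record { ≋-cong = ⟨⟩-≋ ; +-homo = ⟨⟩-+ ; *-homo = ⟨⟩-* }
    where
    ⟨⟩-≋ : ∀ {v w} → v ≋ w → v ⟨ x , y ⟩ ≈ w ⟨ x , y ⟩
    ⟨⟩-≋ eq with Finₚ.<-cmp x y
    ... | tri< x<y _ _ = eq (edge x y x<y)
    ... | tri≈ _ _ _   = refl
    ... | tri> _ _ y<x = eq (edge y x y<x)
    ⟨⟩-+ : ∀ v w → (v ⊕ w) ⟨ x , y ⟩ ≈ v ⟨ x , y ⟩ + w ⟨ x , y ⟩
    ⟨⟩-+ v w with Finₚ.<-cmp x y
    ... | tri< _ _ _ = refl
    ... | tri≈ _ _ _ = sym (+-identityˡ 0#)
    ... | tri> _ _ _ = refl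
    ⟨⟩-* : ∀ a v → (λ e → a * v e) ⟨ x , y ⟩ ≈ a * v ⟨ x , y ⟩
    ⟨⟩-* a v with Finₚ.<-cmp x y
    ... | tri< _ _ _ = refl
    ... | tri≈ _ _ _ = sym (zeroʳ a)
    ... | tri> _ _ _ = refl

  linear-s : ∀ e → IsLinear (s e)
  linear-s e = linear-+ (linear-+ (linear-+ (linear-⟨⟩ a b) (linear-⟨⟩ (next a) (next b)))
      (linear-neg (linear-⟨⟩ a (next b)))) (linear-neg (linear-⟨⟩ (next a) b))
    where
    a = lo e
    b = hi e

  linear-weight : ∀ E → IsLinear (λ v → weight v E)
  linear-weight E = linear-∑ E linear-coord

  ⟨⟩-joins : ∀ (v : V) {e x y} → Joins e x y → v ⟨ x , y ⟩ ≡ v e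
  ⟨⟩-joins v {e} {x} {y} j with Finₚ.<-cmp x y
  ... | tri< x<y _ _ = cong v (joins-unique {e = edge x y x<y} (fwd ≡.refl ≡.refl) j)
  ... | tri≈ _ x≡y _ = ⊥-elim (joins-≢ j x≡y)
  ... | tri> _ _ y<x = cong v (joins-unique {e = edge y x y<x} (bwd ≡.refl ≡.refl) j)

-- Coordinates on lifts and mixed second differences.

module Space {c ℓ₁ ℓ₂} (F : OrderedField c ℓ₁ ℓ₂) (n : ℕ) (3≤n : 3 ℕ.≤ n) where
  open OrderedField F
  open FieldProperties F
  open EdgeSpace F n
  open Sums F n
  open Cyclic n 3≤n
  open IsLinear

  ⟨⟩-sym : ∀ (v : V) x y → v ⟨ x , y ⟩ ≡ v ⟨ y , x ⟩
  ⟨⟩-sym v x y with x Finₚ.≟ y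
  ... | yes ≡.refl = ≡.refl
  ... | no x≢y     = ≡.trans (⟨⟩-joins v (mk-joins x≢y)) (≡.sym (⟨⟩-joins v (joins-sym (mk-joins x≢y))))

  opaque
    M : ℕ → ℕ → V → Carrier
    M a b v = v ⟨ pt a , pt b ⟩

    M-⟨⟩ : ∀ a b v → v ⟨ pt a , pt b ⟩ ≡ M a b v
    M-⟨⟩ a b v = ≡.refl

    linear-M : ∀ a b → IsLinear (M a b)
    linear-M a b = linear-⟨⟩ (pt a) (pt b)

  M-cong : ∀ {a b a′ b′} v → pt a ≡ pt a′ → pt b ≡ pt b′ → M a b v ≡ M a′ b′ v
  M-cong {a} {b} {a′} {b′} v p q = ≡.trans (≡.sym (M-⟨⟩ a b v))
      (≡.trans (cong₂ (λ x y → v ⟨ x , y ⟩) p q) (M-⟨⟩ a′ b′ v))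

  M-joins : ∀ {e a b} v → Joins e (pt a) (pt b) → M a b v ≡ v e
  M-joins {a = a} {b} v j = ≡.trans (≡.sym (M-⟨⟩ a b v)) (⟨⟩-joins v j)

  M-sym : ∀ a b v → M a b v ≡ M b a v
  M-sym a b v = ≡.trans (≡.sym (M-⟨⟩ a b v)) (≡.trans (⟨⟩-sym v (pt a) (pt b)) (M-⟨⟩ b a v))

  -- The mixed second difference over the unit step from a to a+1 and an arbitrary step from b to c.
  -- It is additive in the second step, so it is the sum of the s_{a,x} with b ≤ x < c.
  rect : ℕ → ℕ → ℕ → V → Carrier
  rect a b c v = M a b v + M (suc a) c v + - M a c v + - M (suc a) b v

  linear-rect : ∀ a b c → IsLinear (rect a b c)
  linear-rect a b c = linear-+
      (linear-+ (linear-+ (linear-M a b) (linear-M (suc a) c)) (linear-neg (linear-M a c)))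
      (linear-neg (linear-M (suc a) b))

  rect-+ : ∀ a b c d v → rect a b c v + rect a c d v ≈ rect a b d v
  rect-+ a b c d v = solve 6 (λ ab ac ad sb sc sd →
      ab :+ sc :+ :- ac :+ :- sb :+ (ac :+ sd :+ :- ad :+ :- sc) := ab :+ sd :+ :- ad :+ :- sb) refl
    (M a b v) (M a c v) (M a d v) (M (suc a) b v) (M (suc a) c v) (M (suc a) d v)

  rect-diagonal : ∀ a b v → rect a b b v ≈ 0#
  rect-diagonal a b v = solve 2 (λ ab sb → ab :+ sb :+ :- ab :+ :- sb := con (ℤ.+ 0)) refl (M a b v)
      (M (suc a) b v)

  rect-⟨⟩ : ∀ a b v → v ⟨ pt a , pt b ⟩ + v ⟨ next (pt a) , next (pt b) ⟩ + - v ⟨ pt a , next (pt b) ⟩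
      + - v ⟨ next (pt a) , pt b ⟩
                    ≡ rect a b (suc b) v
  rect-⟨⟩ a b v = cong₂ _+_ (cong₂ _+_ (cong₂ _+_ (M-⟨⟩ a b v)
      (≡.trans (cong₂ (λ x y → v ⟨ x , y ⟩) (next-pt a) (next-pt b)) (M-⟨⟩ (suc a) (suc b) v)))
      (cong -_ (≡.trans (cong (λ y → v ⟨ pt a , y ⟩) (next-pt b)) (M-⟨⟩ a (suc b) v))))
      (cong -_ (≡.trans (cong (λ x → v ⟨ x , pt b ⟩) (next-pt a)) (M-⟨⟩ (suc a) b v)))

  s-rect : ∀ {e} a b v → Joins e (pt a) (pt b) → s e v ≈ rect a b (suc b) v
  s-rect a b v (fwd ≡.refl ≡.refl) = reflexive (rect-⟨⟩ a b v)
  s-rect a b v (bwd ≡.refl ≡.refl) = trans (reflexive (rect-⟨⟩ b a v))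
    (trans (+-cong (+-cong (+-cong (M-swap b a) (M-swap (suc b) (suc a))) (-‿cong (M-swap b (suc a))))
        (-‿cong (M-swap (suc b) a)))
      (solve 4 (λ p q r t → p :+ q :+ :- r :+ :- t := p :+ q :+ :- t :+ :- r) refl (M a b v)
          (M (suc a) (suc b) v) (M (suc a) b v) (M a (suc b) v)))
    where
    M-swap : ∀ a b → M a b v ≈ M b a v
    M-swap a b = reflexive (M-sym a b v)

  -- By telescoping, this is the sum of s over the edges {a+t , b+u} with 0 ≤ u ≤ t < l; it is
  -- also the difference of the weights of the two matchings compared in Grob⇒0≤Ψ.
  Ψ : ℕ → ℕ → ℕ → V → Carrier
  Ψ a b l v = ∑< l (λ t → rect (a ℕ.+ t) b (b ℕ.+ suc t) v)

  linear-Ψ : ∀ a b l → IsLinear (Ψ a b l)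
  linear-Ψ a b l = linear-∑< l (λ t → linear-rect (a ℕ.+ t) b (b ℕ.+ suc t))

-- The inequalities hold on `Grob`.

module Inequalities {c ℓ₁ ℓ₂} (F : OrderedField c ℓ₁ ℓ₂) (n : ℕ) (3≤n : 3 ℕ.≤ n) (k : ℕ)
    (m+m<n : suc k ℕ.+ suc k ℕ.< n) where
  open OrderedField F
  open FieldProperties F
  open EdgeSpace F n
  open Sums F n
  open Cyclic n 3≤n
  open Matchings n 3≤n
  open Fans n 3≤n k m+m<n
  open Space F n 3≤n
  open IsLinear

  ∑-zip : List ℕ → List ℕ → V → Carrier
  ∑-zip []      _       v = 0#
  ∑-zip (p ∷ P) []      v = 0#
  ∑-zip (p ∷ P) (q ∷ Q) v = M p q v + ∑-zip P Q v

  weight-link : ∀ P Q v → (∀ {p q} → p ∈ P → q ∈ Q → pt p ≢ pt q) → weight v (link P Q) ≈ ∑-zip P Q v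
  weight-link []      Q       v _     = refl
  weight-link (p ∷ P) []      v _     = refl
  weight-link (p ∷ P) (q ∷ Q) v apart = +-cong
    (reflexive (≡.sym (M-joins v (mk-joins (apart (here ≡.refl) (here ≡.refl))))))
    (weight-link P Q v (λ p∈ q∈ → apart (there p∈) (there q∈)))

  -- Bringing `y` from position `l` to the front takes `l` exchanges of adjacent partners.
  -- Exchanging the partners of x and x+1 changes the weight by one `rect`, and `y` takes part in
  -- every exchange.
  ∑-zip-rotate : ∀ l r a c y v →
    ∑-zip (iota a (suc (l ℕ.+ r))) (y ∷ iota c (l ℕ.+ r)) v
      ≈ ∑-zip (iota a (suc (l ℕ.+ r))) (iota c l ++ y ∷ iota (c ℕ.+ l) r) v + ∑< l
          (λ t → rect (a ℕ.+ t) y (c ℕ.+ t) v)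
  ∑-zip-rotate zero r a c y v = trans
    (reflexive (cong (λ c → ∑-zip (iota a (suc r)) (y ∷ iota c r) v) (≡.sym (ℕₚ.+-identityʳ c))))
        (sym (+-identityʳ _))
  ∑-zip-rotate (suc l) r a c y v = begin
    M a y v + (M (suc a) c v + rest)
      ≈⟨ solve 5 (λ p q x t u → p :+ (q :+ x) := t :+ (p :+ q :+ :- t :+ :- u) :+ (u :+ x)) refl
           (M a y v) (M (suc a) c v) rest (M a c v) (M (suc a) y v) ⟩
    M a c v + rect a y c v + (M (suc a) y v + rest)
      ≈⟨ +-congˡ (∑-zip-rotate l r (suc a) (suc c) y v) ⟩
    M a c v + rect a y c v + (∑-zip P (iota (suc c) l ++ y ∷ iota (suc c ℕ.+ l) r) v + ∑< l
        (λ t → rect (suc a ℕ.+ t) y (suc c ℕ.+ t) v))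
      ≈⟨ +-cong refl (+-cong (reflexive
          (cong (λ d → ∑-zip P (iota (suc c) l ++ y ∷ iota d r) v) (≡.sym (ℕₚ.+-suc c l))))
           (∑<-cong l (λ t _ → reflexive
               (cong₂ (λ x z → rect x y z v) (≡.sym (ℕₚ.+-suc a t)) (≡.sym (ℕₚ.+-suc c t)))))) ⟩
    M a c v + rect a y c v + (∑-zip P (iota (suc c) l ++ y ∷ iota (c ℕ.+ suc l) r) v + tail′)
      ≈⟨ solve 4 (λ p q x t → p :+ q :+ (x :+ t) := p :+ x :+ (q :+ t)) refl (M a c v)
          (rect a y c v) _ tail′ ⟩
    M a c v + ∑-zip P (iota (suc c) l ++ y ∷ iota (c ℕ.+ suc l) r) v + (rect a y c v + tail′)
      ≈⟨ +-congˡ (+-congʳ (reflexive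
          (cong₂ (λ x z → rect x y z v) (≡.sym (ℕₚ.+-identityʳ a)) (≡.sym (ℕₚ.+-identityʳ c))))) ⟩
    M a c v + ∑-zip P (iota (suc c) l ++ y ∷ iota (c ℕ.+ suc l) r) v +
        (rect (a ℕ.+ 0) y (c ℕ.+ 0) v + tail′)
      ≈⟨ +-congˡ (∑<-suc l (λ t → rect (a ℕ.+ t) y (c ℕ.+ t) v)) ⟨
    M a c v + ∑-zip P (iota (suc c) l ++ y ∷ iota (c ℕ.+ suc l) r) v + ∑< (suc l)
        (λ t → rect (a ℕ.+ t) y (c ℕ.+ t) v) ∎
    where
    open import Relation.Binary.Reasoning.Setoid setoid
    P = iota (suc a) (suc (l ℕ.+ r))
    rest = ∑-zip (iota (suc (suc a)) (l ℕ.+ r)) (iota (suc c) (l ℕ.+ r)) v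
    tail′ = ∑< l (λ t → rect (a ℕ.+ suc t) y (c ℕ.+ suc t) v)

  -- The (k+1)-crossing {a+t , b+t} (0 ≤ t ≤ k) is compared with the matching that
  -- rotates b , b+1 , … , b+l among the partners of a , a+1 , … , a+l.
  Grob⇒0≤Ψ : ∀ {v} → Grob k v → ∀ a b l → l ℕ.≤ k → a ℕ.+ m ℕ.≤ b → b ℕ.+ m ℕ.≤ a ℕ.+ n → 0# ≤ Ψ a b l v
  Grob⇒0≤Ψ {v} G a b l l≤k a+m≤b b+m≤a+n with ℕₚ.m≤n⇒∃[o]m+o≡n l≤k
  ... | r , ≡.refl = 0≤-cong difference (x≤y⇒0≤y-x
      (G U (≡.trans ∣U∣ size) (link P Q) (perfect ↭-refl)
          (subst (λ j → IsCrossing j (link P Q)) (ℕₚ.+-comm 1 k) crossing)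
        (link P Q′) (perfect Q′↭Q)))
    where
    open Antipodal a b (suc k) a+m≤b b+m≤a+n
    Q′ : List ℕ
    Q′ = iota (suc b) l ++ b ∷ iota (suc b ℕ.+ l) r
    Q′↭Q : Q′ ↭ Q
    Q′↭Q = ↭-trans (shift b (iota (suc b) l) _)
        (Perm.prep b (↭-reflexive (≡.sym (iota-++ (suc b) l r))))
    size : suc k ℕ.+ suc k ≡ 2 ℕ.* k ℕ.+ 2
    size = ≡.trans (cong suc (ℕₚ.+-suc k k))
        (≡.trans (ℕₚ.+-comm 2 (k ℕ.+ k)) (cong (λ j → k ℕ.+ j ℕ.+ 2) (≡.sym (ℕₚ.+-identityʳ k))))
    apart : ∀ {p q} → p ∈ P → q ∈ Q → pt p ≢ pt q
    apart p∈ q∈ = pt-≢ (proj₁ (P<Q p∈ q∈)) (proj₂ (P<Q p∈ q∈))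
    difference : weight v (link P Q) + - weight v (link P Q′) ≈ Ψ a b l v
    difference = begin
      weight v (link P Q) + - weight v (link P Q′)
        ≈⟨ +-cong (weight-link P Q v apart)
            (-‿cong (weight-link P Q′ v (λ p∈ q∈ → apart p∈ (∈-resp-↭ Q′↭Q q∈)))) ⟩
      ∑-zip P Q v + - ∑-zip P Q′ v
        ≈⟨ +-congʳ (∑-zip-rotate l r a (suc b) b v) ⟩
      ∑-zip P Q′ v + ∑< l (λ t → rect (a ℕ.+ t) b (suc b ℕ.+ t) v) + - ∑-zip P Q′ v
        ≈⟨ solve 2 (λ x y → x :+ y :+ :- x := y) refl (∑-zip P Q′ v) _ ⟩
      ∑< l (λ t → rect (a ℕ.+ t) b (suc b ℕ.+ t) v)
        ≈⟨ ∑<-cong l (λ t _ → reflexive (cong (λ x → rect (a ℕ.+ t) b x v) (≡.sym (ℕₚ.+-suc b t)))) ⟩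
      Ψ a b l v ∎
      where open import Relation.Binary.Reasoning.Setoid setoid

  ∑-row : ∀ l p b (f : ℕ → Edge n) v →
      (∀ u → u ℕ.< l → s (f u) v ≈ rect p (b ℕ.+ u) (suc (b ℕ.+ u)) v) →
          ∑ (applyUpTo f l) (λ e → s e v) ≈ rect p b (b ℕ.+ l) v
  ∑-row zero    p b f v eq = sym
      (trans (reflexive (cong (λ c → rect p b c v) (ℕₚ.+-identityʳ b))) (rect-diagonal p b v))
  ∑-row (suc l) p b f v eq = trans (+-cong
      (trans (eq 0 (s≤s z≤n)) (reflexive (cong (λ c → rect p c (suc c) v) (ℕₚ.+-identityʳ b))))
      (∑-row l p (suc b) (f ∘ suc) v
          (λ u u<l → trans (eq (suc u) (s≤s u<l))
          (reflexive (cong (λ c → rect p c (suc c) v) (ℕₚ.+-suc b u))))))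
    (trans (rect-+ p b (suc b) (suc b ℕ.+ l) v)
        (reflexive (cong (λ c → rect p b c v) (≡.sym (ℕₚ.+-suc b l)))))

  ∑-fan : ∀ a l v → l ℕ.≤ m → ∑ (fan a l) (λ e → s e v) ≈ Ψ a (a ℕ.+ m) l v
  ∑-fan a zero    v _   = refl
  ∑-fan a (suc l) v l<m = trans (∑-++ (fanRow a l) (fan a l) (λ e → s e v)) (trans (+-cong
      (∑-row (suc l) (a ℕ.+ l) (a ℕ.+ m) (λ u → E (a ℕ.+ l) (a ℕ.+ m ℕ.+ u)) v
        (λ u u≤l → s-rect (a ℕ.+ l) (a ℕ.+ m ℕ.+ u) v (E-fan-joins a l<m (ℕₚ.<-≤-trans u≤l l<m))))
      (∑-fan a l v (ℕₚ.<⇒≤ l<m)))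
    (+-comm _ _))

  ∑-enclosing : ∀ {e} a l v → l ℕ.< m → Joins e (pt (a ℕ.+ l)) (pt (a ℕ.+ m)) →
                ∑ (enclosing n k e) (λ f → s f v) ≈ Ψ a (a ℕ.+ m) (suc l) v
  ∑-enclosing a l v l<m j = trans (∑-↭ (λ f → s f v) (enclosing-↭-fan a l l<m j))
      (∑-fan a (suc l) v l<m)

  -- The short side is placed so that it ends at `apex + m`. Then `offset` is what the length lacks
  -- to `m`, and the enclosing edges of `e` fill `offset + 1` rows of the fan.
  record FanNamed (e : Edge n) : Set where
    field
      apex offset : ℕ
      dist+offset : dist e ℕ.+ offset ≡ m
      joins       : Joins e (pt (apex ℕ.+ offset)) (pt (apex ℕ.+ m))
      offset<m    : offset ℕ.< m

  fanName : ∀ {e} → dist e ℕ.≤ m → FanNamed e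
  fanName {e} d≤m = record
    { apex = apex ; offset = m ℕ.∸ dist e ; dist+offset = d+o
    ; joins = subst₂ (λ x y → Joins e (pt x) (pt y)) (≡.sym low) (≡.sym high) joins
    ; offset<m = subst (m ℕ.∸ dist e ℕ.<_) d+o (ℕₚ.m<n+m (m ℕ.∸ dist e) 0<d) }
    where
    open Named (name e)
    apex = base ℕ.+ dist e ℕ.∸ m
    d+o : dist e ℕ.+ (m ℕ.∸ dist e) ≡ m
    d+o = ℕₚ.m+[n∸m]≡n d≤m
    high : apex ℕ.+ m ≡ base ℕ.+ dist e
    high = ℕₚ.m∸n+n≡m (ℕₚ.≤-trans (ℕₚ.<⇒≤ m<n) (ℕₚ.≤-trans n≤ (ℕₚ.m≤m+n base (dist e))))
    low : apex ℕ.+ (m ℕ.∸ dist e) ≡ base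
    low = ℕₚ.+-cancelʳ-≡ (dist e) _ _ (≡.trans (ℕₚ.+-assoc apex (m ℕ.∸ dist e) (dist e))
            (≡.trans (cong (apex ℕ.+_) (ℕₚ.m∸n+n≡m d≤m)) high))

  s-Ψ : ∀ {e} a b v → Joins e (pt a) (pt b) → s e v ≈ Ψ a b 1 v
  s-Ψ a b v j = trans (s-rect a b v j) (trans
    (reflexive (cong₂ (λ x y → rect x b y v) (≡.sym (ℕₚ.+-identityʳ a)) (ℕₚ.+-comm 1 b)))
        (sym (+-identityˡ _)))

  -- At length `m` the offset is 0, so the fan is a single row consisting of `e` alone. An
  -- inequality of length k+1 can thus be read both as a long one and as a short one.
  ∑-enclosing-long : ∀ {e} v → dist e ≡ m → ∑ (enclosing n k e) (λ f → s f v) ≈ s e v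
  ∑-enclosing-long {e} v d≡m = trans (∑-enclosing apex offset v offset<m joins) (trans
      (reflexive (cong (λ l → Ψ apex (apex ℕ.+ m) (suc l) v) offset≡0))
      (sym (s-Ψ apex (apex ℕ.+ m) v
          (subst (λ x → Joins e (pt x) (pt (apex ℕ.+ m)))
          (≡.trans (cong (apex ℕ.+_) offset≡0) (ℕₚ.+-identityʳ apex)) joins))))
    where
    open FanNamed (fanName {e} (ℕₚ.≤-reflexive d≡m))
    offset≡0 : offset ≡ 0
    offset≡0 = ℕₚ.+-cancelˡ-≡ m _ _
        (≡.trans (cong (ℕ._+ offset) (≡.sym d≡m)) (≡.trans dist+offset (≡.sym (ℕₚ.+-identityʳ m))))

  module _ (1≤k : 1 ℕ.≤ k) where

    -- Exchanging a single pair of partners suffices. It takes two edges in the crossing, hence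
    -- `1 ≤ k`, and room for `m` vertices on each of the two arcs, which is the bound on `dist e`.
    Grob⇒0≤s : ∀ {v} → Grob k v → ∀ {e} → m ℕ.≤ dist e → 0# ≤ s e v
    Grob⇒0≤s {v} G {e} m≤d = 0≤-cong (sym (s-Ψ base (base ℕ.+ dist e) v joins))
        (Grob⇒0≤Ψ G base (base ℕ.+ dist e) 1 1≤k (ℕₚ.+-monoʳ-≤ base m≤d)
          (subst (ℕ._≤ base ℕ.+ n) (≡.sym (ℕₚ.+-assoc base (dist e) m))
              (ℕₚ.+-monoʳ-≤ base (ℕₚ.≤-trans (ℕₚ.+-monoʳ-≤ (dist e) m≤d) 2d≤n))))
      where open Named (name e)

    Grob⇒0≤Ψ-fan : ∀ {v} → Grob k v → ∀ a l → l ℕ.≤ k → 0# ≤ Ψ a (a ℕ.+ m) l v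
    Grob⇒0≤Ψ-fan G a l l≤k = Grob⇒0≤Ψ G a (a ℕ.+ m) l l≤k ℕₚ.≤-refl
      (subst (ℕ._≤ a ℕ.+ n) (≡.sym (ℕₚ.+-assoc a m m)) (ℕₚ.+-monoʳ-≤ a (ℕₚ.<⇒≤ m+m<n)))

    Grob⇒inequality : ∀ {v} → Grob k v → ∀ {x} → x ∈ inequalityIndices n k → 0# ≤ inequality k x v
    Grob⇒inequality {v} G x∈ with ∈-++⁻ (map inj₁ (longInequalityEdges n k)) x∈
    ... | inj₁ p with e , e∈ , ≡.refl ← ∈-map⁻ inj₁ p =
            Grob⇒0≤s G {e} (subst (ℕ._≤ dist e) (ℕₚ.+-comm k 1)
                (proj₂ (∈-filter⁻ (λ e → k ℕ.+ 1 ℕₚ.≤? dist e) {xs = allEdges n} e∈)))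
    ... | inj₂ p with e , e∈ , ≡.refl ← ∈-map⁻ inj₂ p
                 with _ , 2≤d , d≤k ← ∈-filter⁻ (λ e → (2 ℕₚ.≤? dist e) ×-dec (dist e ℕₚ.≤? k))
                     {xs = allEdges n} e∈ =
            0≤-cong (sym (∑-enclosing apex offset v offset<m joins))
              (Grob⇒0≤Ψ-fan G apex (suc offset)
                  (ℕ.s≤s⁻¹ (subst (suc (suc offset) ℕ.≤_) dist+offset (ℕₚ.+-monoˡ-≤ offset 2≤d))))
      where open FanNamed (fanName {e} (ℕₚ.m≤n⇒m≤1+n d≤k))

-- The generators lie in `Grob`.

module Generators {c ℓ₁ ℓ₂} (F : OrderedField c ℓ₁ ℓ₂) (n : ℕ) (3≤n : 3 ℕ.≤ n) (k : ℕ) where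
  open OrderedField F
  open FieldProperties F
  open EdgeSpace F n
  open Sums F n
  open Distances n 3≤n
  open IsLinear
  open import Relation.Binary.Reasoning.Setoid setoid

  Grob-resp-≋ : ∀ {v w} → v ≋ w → Grob k v → Grob k w
  Grob-resp-≋ eq G U size X pX cX E pE =
    ≤-respˡ (≋-cong (linear-weight E) eq)
        (≤-respʳ (≋-cong (linear-weight X) eq) (G U size X pX cX E pE))

  Grob-⊕ : ∀ {v w} → Grob k v → Grob k w → Grob k (v ⊕ w)
  Grob-⊕ {v} {w} G H U size X pX cX E pE =
    ≤-respˡ (sym (+-homo (linear-weight E) v w)) (≤-respʳ (sym (+-homo (linear-weight X) v w))
      (+-mono-≤ (G U size X pX cX E pE) (H U size X pX cX E pE)))

  Grob-scale : ∀ {a v} → 0# ≤ a → Grob k v → Grob k (λ e → a * v e)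
  Grob-scale {a} {v} 0≤a G U size X pX cX E pE =
    ≤-respˡ (sym (*-homo (linear-weight E) a v)) (≤-respʳ (sym (*-homo (linear-weight X) a v))
      (0≤y-x⇒x≤y (0≤-cong (solve 3 (λ a x y → a :* (y :+ :- x) := a :* y :+ :- (a :* x)) refl a
          (weight v E) (weight v X))
        (*-nonNeg 0≤a (x≤y⇒0≤y-x (G U size X pX cX E pE))))))

  Grob-𝟎 : Grob k 𝟎
  Grob-𝟎 U size X pX cX E pE = ≤-reflexive
      (trans (zero-homo (linear-weight E)) (sym (zero-homo (linear-weight X))))

  Grob-comb : ∀ {I : Set} (xs : List I) {a} {g : I → V} → (∀ x → 0# ≤ a x) →
      (∀ {x} → x ∈ xs → Grob k (g x)) → Grob k (comb xs a g)
  Grob-comb []       0≤a Gg = Grob-𝟎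
  Grob-comb (x ∷ xs) 0≤a Gg = Grob-⊕ (Grob-scale (0≤a x) (Gg (here ≡.refl)))
      (Grob-comb xs 0≤a (Gg ∘ there))

  -- The combinations of stars in closed form. Such a vector gives all perfect matchings of `U` the
  -- same weight, the total of α over `U`, so it satisfies each inequality of `Grob` with equality.
  potential : (Fin n → Carrier) → V
  potential α e = α (lo e) + α (hi e)

  weight-potential : ∀ α E → weight (potential α) E ≈ ∑ (endpoints E) α
  weight-potential α []      = refl
  weight-potential α (e ∷ E) = trans (+-congˡ (weight-potential α E)) (+-assoc _ _ _)

  matching-endpoints : ∀ {U : Subset n} E X → IsPerfectMatching U E → IsPerfectMatching U X →
      endpoints E ↭ endpoints X
  matching-endpoints E X (uE , iE) (uX , iX) = unique-↭ uE uX
    (λ {x} x∈ → Equivalence.from (iX x) (Equivalence.to (iE x) x∈))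
        (λ {x} x∈ → Equivalence.from (iE x) (Equivalence.to (iX x) x∈))

  weight-potential-≈ : ∀ α {U} E X → IsPerfectMatching U E → IsPerfectMatching U X →
      weight (potential α) E ≈ weight (potential α) X
  weight-potential-≈ α E X pE pX =
    trans (weight-potential α E)
        (trans (∑-↭ α (matching-endpoints E X pE pX)) (sym (weight-potential α X)))

  Grob-potential : ∀ α → Grob k (potential α)
  Grob-potential α U _ X pX _ E pE = ≤-reflexive (weight-potential-≈ α E X pE pX)

  indicator : Fin n → Fin n → Carrier
  indicator x i = [ does (x Finₚ.≟ i) ]₀₁

  star-indicator : ∀ i e → star i e ≈ indicator (lo e) i + indicator (hi e) i
  star-indicator i e with lo e Finₚ.≟ i | hi e Finₚ.≟ i
  ... | yes p | yes q = ⊥-elim (lo≢hi e (≡.trans p (≡.sym q)))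
  ... | yes _ | no _  = sym (+-identityʳ 1#)
  ... | no _  | yes _ = sym (+-identityˡ 1#)
  ... | no _  | no _  = sym (+-identityˡ 0#)

  ∑-indicator : ∀ (α : Fin n → Carrier) x → ∑ (allFin n) (λ i → α i * indicator x i) ≈ α x
  ∑-indicator α x = trans (∑-single (Uniqueₚ.allFin⁺ n) (∈-allFin x) off) on
    where
    off : ∀ {i} → i ∈ allFin n → i ≢ x → α i * indicator x i ≈ 0#
    off {i} _ i≢x with x Finₚ.≟ i
    ... | yes p = ⊥-elim (i≢x (≡.sym p))
    ... | no _  = zeroʳ _
    on : α x * indicator x x ≈ α x
    on with x Finₚ.≟ x
    ... | yes _ = *-identityʳ _
    ... | no q  = ⊥-elim (q ≡.refl)

  comb-star : ∀ (α : Fin n → Carrier) → comb (allFin n) α star ≋ potential α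
  comb-star α e = begin
    ∑ (allFin n) (λ i → α i * star i e)
      ≈⟨ ∑-cong (allFin n) (λ {i} _ → trans (*-congˡ (star-indicator i e))
          (distribˡ (α i) (indicator (lo e) i) (indicator (hi e) i))) ⟩
    ∑ (allFin n) (λ i → α i * indicator (lo e) i + α i * indicator (hi e) i)
      ≈⟨ ∑-distrib-+ (allFin n) _ _ ⟩
    ∑ (allFin n) (λ i → α i * indicator (lo e) i) + ∑ (allFin n) (λ i → α i * indicator (hi e) i)
      ≈⟨ +-cong (∑-indicator α (lo e)) (∑-indicator α (hi e)) ⟩
    potential α e ∎

  Span⇒Grob : ∀ {v} → Span (allFin n) star v → Grob k v
  Span⇒Grob (α , eq) = Grob-resp-≋ (λ e → sym (trans (eq e) (comb-star α e))) (Grob-potential α)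

  potential⇒Span : ∀ {v} α → v ≋ potential α → Span (allFin n) star v
  potential⇒Span α eq = α , λ e → trans (eq e) (sym (comb-star α e))

  Span-⊝ : ∀ {v} → Span (allFin n) star v → Span (allFin n) star (⊝ v)
  Span-⊝ (α , eq) = potential⇒Span (λ i → - α i) (λ e → trans (-‿cong (trans (eq e) (comb-star α e)))
    (solve 2 (λ x y → :- (x :+ y) := :- x :+ :- y) refl (α (lo e)) (α (hi e))))

  Span⊆Lineality : ∀ {v} → Span (allFin n) star v → Lineality (Grob k) v
  Span⊆Lineality sp = Span⇒Grob sp , Span⇒Grob (Span-⊝ sp)

  basis-self : ∀ e → basis e e ≡ 1#
  basis-self e = cong [_]₀₁ (dec-true (e ≡ᵉ? e) (≡.refl , ≡.refl))

  basis-other : ∀ e f → e ≢ f → basis e f ≡ 0#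
  basis-other e f e≢f = cong [_]₀₁ (dec-false (e ≡ᵉ? f) (λ (p , q) → e≢f (edge-≡ p q)))

  -- No matching has positive weight, while the crossing avoids the edge `g`, which is too short for
  -- it, and so has weight 0.
  Grob-⊝basis : ∀ {g} → dist g ℕ.≤ k → Grob k (⊝ basis g)
  Grob-⊝basis {g} d≤k U _ X (uX , _) (length-X , cross) E _ =
      ≤-respʳ (sym X≈0) (≤-respʳ E0 (∑-mono-≤ E (λ {f} _ → nonpos f)))
    where
    E0 : ∑ E (λ _ → 0#) ≈ 0#
    E0 = ∑-zero E (λ _ → refl)
    nonpos : ∀ f → - basis g f ≤ 0#
    nonpos f with does (g ≡ᵉ? f)
    ... | true  = 0≤y-x⇒x≤y (0≤-cong (solve 1 (λ x → x := con (ℤ.+ 0) :+ :- :- x) refl 1#) 0≤1)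
    ... | false = ≤-reflexive -0#≈0#
    X≈0 : weight (⊝ basis g) X ≈ 0#
    X≈0 = ∑-zero X (λ {f} f∈ → trans (-‿cong (reflexive (basis-other g f (λ { ≡.refl →
      ℕₚ.<⇒≱ (subst (ℕ._≤ dist f) (≡.trans length-X (ℕₚ.+-comm k 1))
          (crossing-length-≤-dist uX cross f∈)) d≤k })))) -0#≈0#)

  inside : Edge n → Fin n → Bool
  inside e x = does (inInterval? (next (lo e)) (hi e) x)

  inside-true : ∀ {e x} → lo e Fin.< x → x Fin.≤ hi e → inside e x ≡ true
  inside-true {e} {x} l h = dec-true (inInterval? (next (lo e)) (hi e) x)
      (Equivalence.from (inInterval⇔ e x) (l , h))

  inside-bounds : ∀ {e x} → inside e x ≡ true → lo e Fin.< x × x Fin.≤ hi e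
  inside-bounds {e} {x} eq = Equivalence.to (inInterval⇔ e x)
      (ℕₚ.≤ᵇ⇒≤ (x ⊖ next (lo e)) (hi e ⊖ next (lo e)) (subst T (≡.sym eq) tt))

  inside-between : ∀ {e x y z} → inside e x ≡ true → inside e z ≡ true → x Fin.< y → y Fin.< z →
      inside e y ≡ true
  inside-between {e} p q x<y y<z = inside-true {e} (ℕₚ.<-trans (proj₁ (inside-bounds {e} p)) x<y)
    (ℕₚ.≤-trans (ℕₚ.<⇒≤ y<z) (proj₂ (inside-bounds {e} q)))

  -- An edge that crosses `f` has an endpoint strictly between those of `f`; when both ends of `f`
  -- are in the interval, that endpoint is too.
  inside-cross : ∀ {e f g} → inside e (lo f) ≡ true → inside e (hi f) ≡ true → f ≡ g ⊎ Cross f g →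
                 inside e (lo g) ≡ true ⊎ inside e (hi g) ≡ true
  inside-cross     p q (inj₁ ≡.refl)                = inj₁ p
  inside-cross {e} p q (inj₂ (inj₁ (l , h , _)))    = inj₁ (inside-between {e} p q l h)
  inside-cross {e} p q (inj₂ (inj₂ (_ , l , h)))    = inj₂ (inside-between {e} p q l h)

  xor-≤ : ∀ a b → [ a xor b ]₀₁ ≤ [ a ]₀₁ + [ b ]₀₁
  xor-≤ true  true  = ≤-respˡ (+-identityˡ 0#) (+-mono-≤ 0≤1 0≤1)
  xor-≤ true  false = ≤-reflexive (sym (+-identityʳ 1#))
  xor-≤ false true  = ≤-reflexive (sym (+-identityˡ 1#))
  xor-≤ false false = ≤-reflexive (sym (+-identityˡ 0#))

  xor-≈ : ∀ a b → ¬ (a ≡ true × b ≡ true) → [ a xor b ]₀₁ ≈ [ a ]₀₁ + [ b ]₀₁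
  xor-≈ true  true  ¬both = ⊥-elim (¬both (≡.refl , ≡.refl))
  xor-≈ true  false _     = sym (+-identityʳ 1#)
  xor-≈ false true  _     = sym (+-identityˡ 1#)
  xor-≈ false false _     = sym (+-identityˡ 0#)

  xor-not : ∀ a b → not a xor not b ≡ a xor b
  xor-not true  true  = ≡.refl
  xor-not true  false = ≡.refl
  xor-not false true  = ≡.refl
  xor-not false false = ≡.refl

  cut : (Fin n → Bool) → V
  cut b f = [ b (lo f) xor b (hi f) ]₀₁

  -- A cut has at most as many edges of a matching as there are vertices on one of
  -- its sides, with equality if no edge of the matching lies within that side.
  weight-cut-≤ : ∀ b {U} E X → IsPerfectMatching U E → IsPerfectMatching U X →
                 (∀ {f} → f ∈ X → ¬ (b (lo f) ≡ true × b (hi f) ≡ true)) →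
                     weight (cut b) E ≤ weight (cut b) X
  weight-cut-≤ b E X pE pX ¬both = ≤-trans
      (∑-mono-≤ E {cut b} {potential (λ x → [ b x ]₀₁)} (λ {f} _ → xor-≤ (b (lo f)) (b (hi f))))
    (≤-reflexive (trans (weight-potential-≈ (λ x → [ b x ]₀₁) E X pE pX)
        (sym (∑-cong X (λ {f} f∈ → xor-≈ (b (lo f)) (b (hi f)) (¬both f∈))))))

  Grob-W : ∀ e → Grob k (W e)
  Grob-W e U _ X pX (_ , cross) E pE with Any.any?
      (λ f → (inside e (lo f) Data.Bool.Properties.≟ true) ×-dec
      (inside e (hi f) Data.Bool.Properties.≟ true)) X
  ... | no ¬any = weight-cut-≤ (inside e) E X pE pX (λ f∈ both → ¬any (lose f∈ both))
  -- An edge `f` of the crossing within the interval forces every edge to have an end there. So no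
  -- edge lies within the complement, which defines the same cut, and the cut edges are counted from
  -- that side.
  ... | yes any with f , f∈ , p , q ← find any =
      ≤-respˡ (complement E) (≤-respʳ (complement X) (weight-cut-≤ (not ∘ inside e) E X pE pX ¬both))
    where
    complement : ∀ E → weight (cut (not ∘ inside e)) E ≈ weight (W e) E
    complement E = ∑-cong E (λ {f} _ → reflexive
        (cong [_]₀₁ (xor-not (inside e (lo f)) (inside e (hi f)))))
    false≢ : ∀ {b} → b ≡ true → ¬ (not b ≡ true)
    false≢ ≡.refl ()
    ¬both : ∀ {g} → g ∈ X → ¬ (not (inside e (lo g)) ≡ true × not (inside e (hi g)) ≡ true)
    ¬both {g} g∈ (¬l , ¬h) with inside-cross {e} {f} {g} p q (cross-lookup cross f∈ g∈)
    ... | inj₁ l = false≢ l ¬l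
    ... | inj₂ h = false≢ h ¬h

-- Vectors on which all s vanish, and the values of s on cuts.

module Rigidity {c ℓ₁ ℓ₂} (F : OrderedField c ℓ₁ ℓ₂) (n : ℕ) (3≤n : 3 ℕ.≤ n) where
  open OrderedField F
  open FieldProperties F
  open EdgeSpace F n
  open Sums F n
  open Cyclic n 3≤n
  open Distances n 3≤n
  open Space F n 3≤n
  open Generators F n 3≤n 0 using (potential; potential⇒Span; cut; inside; inside-true; inside-bounds)
  open IsLinear

  -- The relations make v_{a+1,b} − v_{a,b} independent of b ∉ {a , a+1}, so v_{a,b} is
  -- determined by the entries v_{0,b} and v_{1,2}.
  s≈0⇒Span : ∀ {v} → (∀ e → 2 ℕ.≤ dist e → s e v ≈ 0#) → Span (allFin n) star v
  s≈0⇒Span {v} s≈0 = potential⇒Span (λ i → α (toℕ i)) v≋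
    where
    open import Relation.Binary.Reasoning.Setoid setoid
    -- The value at vertex 0 is forced by the triangle 0, 1, 2: solving α₀+α₁ = v₀₁, α₀+α₂ = v₀₂,
    -- α₁+α₂ = v₁₂ gives α₀ = ½(v₀₁ + v₀₂ - v₁₂).
    x₀ : Carrier
    x₀ = ½ * (M 0 1 v + M 0 2 v + - M 1 2 v)
    2x₀ : x₀ + x₀ ≈ M 0 1 v + M 0 2 v + - M 1 2 v
    2x₀ = trans (solve 2 (λ h x → h :* x :+ h :* x := (h :+ h) :* x) refl ½
        (M 0 1 v + M 0 2 v + - M 1 2 v))
            (trans (*-congʳ ½+½) (*-identityˡ _))
    α : ℕ → Carrier
    α zero    = x₀
    α (suc b) = M 0 (suc b) v + - x₀
    unit : ∀ a b → 2 ℕ.+ a ℕ.≤ b → 2 ℕ.+ b ℕ.≤ a ℕ.+ n → rect a b (suc b) v ≈ 0#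
    unit a b a+2≤b b+2≤a+n = trans (sym (s-rect a b v join)) (s≈0 (E a b) (dist-pt-≥ {d = b ℕ.∸ a} {2}
        (ℕₚ.m<n⇒0<n∸m a<b) (subst (ℕ._≤ b ℕ.∸ a) (ℕₚ.m+n∸n≡m 2 a) (ℕₚ.∸-monoˡ-≤ a a+2≤b))
        (ℕₚ.+-cancelˡ-≤ a _ _ (subst (ℕ._≤ a ℕ.+ n)
            (≡.sym (≡.trans (≡.sym (ℕₚ.+-assoc a (b ℕ.∸ a) 2))
            (≡.trans (cong (ℕ._+ 2) a+d) (ℕₚ.+-comm b 2)))) b+2≤a+n))
        (s≤s z≤n) (subst (λ x → Joins (E a b) (pt a) (pt x)) (≡.sym a+d) join)))
      where
      a<b : a ℕ.< b
      a<b = ℕₚ.<-trans (ℕₚ.n<1+n a) a+2≤b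
      a+d : a ℕ.+ (b ℕ.∸ a) ≡ b
      a+d = ℕₚ.m+[n∸m]≡n (ℕₚ.<⇒≤ a<b)
      join : Joins (E a b) (pt a) (pt b)
      join = E-joins a<b (ℕₚ.<-trans (ℕₚ.n<1+n b) b+2≤a+n)
    strip : ∀ a b l → 2 ℕ.+ a ℕ.≤ b → suc (b ℕ.+ l) ℕ.≤ a ℕ.+ n → rect a b (b ℕ.+ l) v ≈ 0#
    strip a b zero    _ _ = trans (reflexive (cong (λ c → rect a b c v) (ℕₚ.+-identityʳ b)))
        (rect-diagonal a b v)
    strip a b (suc l) p q = trans (sym (rect-+ a b (b ℕ.+ l) (b ℕ.+ suc l) v)) (trans (+-cong
        (strip a b l p (ℕₚ.≤-trans (ℕₚ.n≤1+n _) q′))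
        (trans (reflexive (cong (λ c → rect a (b ℕ.+ l) c v) (ℕₚ.+-suc b l)))
          (unit a (b ℕ.+ l) (ℕₚ.≤-trans p (ℕₚ.m≤m+n b l)) q′)))
      (+-identityˡ 0#))
      where
      q′ : suc (suc (b ℕ.+ l)) ℕ.≤ a ℕ.+ n
      q′ = subst (λ x → suc x ℕ.≤ a ℕ.+ n) (ℕₚ.+-suc b l) q
    strip′ : ∀ a b c → 2 ℕ.+ a ℕ.≤ b → b ℕ.≤ c → suc c ℕ.≤ a ℕ.+ n → rect a b c v ≈ 0#
    strip′ a b c p b≤c q = subst (λ c → rect a b c v ≈ 0#) (ℕₚ.m+[n∸m]≡n b≤c)
      (strip a b (c ℕ.∸ b) p (subst (λ c → suc c ℕ.≤ a ℕ.+ n) (≡.sym (ℕₚ.m+[n∸m]≡n b≤c)) q))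
    M-n : ∀ a → M a n v ≈ M 0 a v
    M-n a = reflexive (≡.trans (M-cong v ≡.refl (pt-+n 0)) (M-sym a 0 v))
    row₁ : ∀ b → 2 ℕ.≤ b → b ℕ.< n → M 1 b v ≈ M 0 b v + M 1 2 v + - M 0 2 v
    row₁ b 2≤b b<n = begin
      M 1 b v                                         ≈⟨ solve 4
          (λ p q r t → q := (p :+ q :+ :- r :+ :- t) :+ (r :+ t :+ :- p)) refl (M 0 2 v) (M 1 b v)
          (M 0 b v) (M 1 2 v) ⟩
      rect 0 2 b v + (M 0 b v + M 1 2 v + - M 0 2 v)  ≈⟨ +-congʳ (strip′ 0 2 b ℕₚ.≤-refl 2≤b b<n) ⟩
      0# + (M 0 b v + M 1 2 v + - M 0 2 v)            ≈⟨ +-identityˡ _ ⟩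
      M 0 b v + M 1 2 v + - M 0 2 v                   ∎
    rows : ∀ a b → suc a ℕ.< b → b ℕ.< n → M (suc a) b v ≈ M 0 (suc a) v + - M 0 1 v + M 1 b v
    rows zero    b _   _   = solve 2 (λ x y → y := x :+ :- x :+ y) refl (M 0 1 v) (M 1 b v)
    -- Column `n` is vertex 0 again. Comparing columns `b` and `n` therefore expresses the step from
    -- row a+1 to row a+2 through entries at vertex 0.
    rows (suc a) b a<b b<n = begin
      M (suc (suc a)) b v
        ≈⟨ solve 4 (λ p q r t → t := :- (p :+ q :+ :- r :+ :- t) :+ (p :+ q :+ :- r)) refl
            (M (suc a) b v) (M (suc (suc a)) n v) (M (suc a) n v) (M (suc (suc a)) b v) ⟩
      - rect (suc a) b n v + (M (suc a) b v + M (suc (suc a)) n v + - M (suc a) n v)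
        ≈⟨ +-cong (-‿cong (strip′ (suc a) b n a<b (ℕₚ.<⇒≤ b<n) (s≤s (ℕₚ.m≤n+m n a))))
            (+-cong (+-cong (rows a b (ℕₚ.<-trans (ℕₚ.n<1+n _) a<b) b<n) (M-n (suc (suc a))))
            (-‿cong (M-n (suc a)))) ⟩
      - 0# + (M 0 (suc a) v + - M 0 1 v + M 1 b v + M 0 (suc (suc a)) v + - M 0 (suc a) v)
        ≈⟨ solve 4 (λ p q r t → :- con (ℤ.+ 0) :+ (p :+ :- q :+ r :+ t :+ :- p) := t :+ :- q :+ r) refl
            (M 0 (suc a) v) (M 0 1 v) (M 1 b v) (M 0 (suc (suc a)) v) ⟩
      M 0 (suc (suc a)) v + - M 0 1 v + M 1 b v ∎
    M≈α : ∀ a b → a ℕ.< b → b ℕ.< n → M a b v ≈ α a + α b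
    M≈α zero    (suc b) _   _   = solve 2 (λ x y → y := x :+ (y :+ :- x)) refl x₀ (M 0 (suc b) v)
    M≈α (suc a) (suc b) a<b b<n = begin
      M (suc a) (suc b) v
        ≈⟨ trans (rows a (suc b) a<b b<n)
            (+-congˡ (row₁ (suc b) (ℕₚ.≤-trans (s≤s (s≤s z≤n)) a<b) b<n)) ⟩
      M 0 (suc a) v + - M 0 1 v + (M 0 (suc b) v + M 1 2 v + - M 0 2 v)
        ≈⟨ solve 5 (λ p q r t w → p :+ :- q :+ (r :+ t :+ :- w) := p :+ r :+ :- (q :+ w :+ :- t)) refl
            (M 0 (suc a) v) (M 0 1 v) (M 0 (suc b) v) (M 1 2 v) (M 0 2 v) ⟩
      M 0 (suc a) v + M 0 (suc b) v + - (M 0 1 v + M 0 2 v + - M 1 2 v)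
        ≈⟨ +-congˡ (-‿cong 2x₀) ⟨
      M 0 (suc a) v + M 0 (suc b) v + - (x₀ + x₀)
        ≈⟨ solve 3 (λ p q x → p :+ q :+ :- (x :+ x) := p :+ :- x :+ (q :+ :- x)) refl (M 0 (suc a) v)
            (M 0 (suc b) v) x₀ ⟩
      α (suc a) + α (suc b) ∎
    v≋ : v ≋ potential (λ i → α (toℕ i))
    v≋ e = trans (reflexive (≡.sym (M-joins v (fwd (≡.sym (pt-toℕ (lo e))) (≡.sym (pt-toℕ (hi e)))))))
      (M≈α (toℕ (lo e)) (toℕ (hi e)) (lo<hi′ e) (Finₚ.toℕ<n (hi e)))

  cut-⟨⟩ : ∀ b x y → cut b ⟨ x , y ⟩ ≡ [ b x xor b y ]₀₁
  cut-⟨⟩ b x y with Finₚ.<-cmp x y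
  ... | tri< _ _ _      = ≡.refl
  ... | tri≈ _ ≡.refl _ = cong [_]₀₁ (≡.sym (Data.Bool.Properties.xor-same (b x)))
  ... | tri> _ _ _      = cong [_]₀₁ (Data.Bool.Properties.xor-comm (b y) (b x))

  xor-rect : Bool → Bool → Bool → Bool → Carrier
  xor-rect x x′ y y′ = [ x xor y ]₀₁ + [ x′ xor y′ ]₀₁ + - [ x xor y′ ]₀₁ + - [ x′ xor y ]₀₁

  s-cut : ∀ f b → s f (cut b) ≡ xor-rect (b (lo f)) (b (next (lo f))) (b (hi f)) (b (next (hi f)))
  s-cut f b = cong₂ _+_ (cong₂ _+_ (cong₂ _+_ (cut-⟨⟩ b _ _) (cut-⟨⟩ b _ _)) (cong -_ (cut-⟨⟩ b _ _)))
      (cong -_ (cut-⟨⟩ b _ _))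

  xor-rect-constˡ : ∀ x y y′ → xor-rect x x y y′ ≈ 0#
  xor-rect-constˡ x y y′ = solve 2 (λ p q → p :+ q :+ :- q :+ :- p := con (ℤ.+ 0)) refl [ x xor y ]₀₁ [
      x xor y′ ]₀₁

  xor-rect-constʳ : ∀ x x′ y → xor-rect x x′ y y ≈ 0#
  xor-rect-constʳ x x′ y = solve 2 (λ p q → p :+ q :+ :- p :+ :- q := con (ℤ.+ 0)) refl [ x xor y ]₀₁ [
      x′ xor y ]₀₁

  inside-false : ∀ {e x} → ¬ (lo e Fin.< x × x Fin.≤ hi e) → inside e x ≡ false
  inside-false {e} {x} ¬in = dec-false (inInterval? (next (lo e)) (hi e) x)
      (¬in ∘ Equivalence.to (inInterval⇔ e x))

  toℕ-next : ∀ {x : Fin n} → suc (toℕ x) ℕ.< n → toℕ (next x) ≡ suc (toℕ x)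
  toℕ-next {x} lt = ≡.trans (cong toℕ (next≡pt x)) (toℕ-pt< lt)

  toℕ-next-last : ∀ {x : Fin n} → suc (toℕ x) ≡ n → toℕ (next x) ≡ 0
  toℕ-next-last {x} eq = ≡.trans (cong toℕ (≡.trans (next≡pt x) (≡.trans (cong pt eq) (pt-+n 0))))
      (toℕ-pt< (ℕₚ.≤-trans (s≤s z≤n) 3≤n))

  -- The step from x to x+1 crosses the boundary of the interval only at x = `lo e` and x = `hi e`.
  -- For the step from the last vertex to 0: vertex 0 is always outside, and the last vertex is
  -- inside only as `hi e`.
  inside-next : ∀ e x → x ≢ lo e → x ≢ hi e → inside e (next x) ≡ inside e x
  inside-next e x x≢lo x≢hi with ℕₚ.m≤n⇒m<n∨m≡n (Finₚ.toℕ<n x)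
  ... | inj₂ last = ≡.trans
          (inside-false {e} (λ (l , _) → ℕₚ.<⇒≱ l
              (subst (ℕ._≤ toℕ (lo e)) (≡.sym (toℕ-next-last last)) z≤n)))
          (≡.sym (inside-false {e} (λ (_ , h) → x≢hi (Finₚ.toℕ-injective
            (ℕₚ.≤-antisym h (ℕ.s≤s⁻¹ (subst (suc (toℕ (hi e)) ℕ.≤_) (≡.sym last)
                (Finₚ.toℕ<n (hi e)))))))))
  ... | inj₁ lt with (lo e Finₚ.<? x) ×-dec (x Finₚ.≤? hi e)
  ...   | yes (l , h) = ≡.trans
            (inside-true {e} (subst (toℕ (lo e) ℕ.<_) (≡.sym (toℕ-next lt)) (ℕₚ.m<n⇒m<1+n l))
              (subst (ℕ._≤ toℕ (hi e)) (≡.sym (toℕ-next lt)) (ℕₚ.≤∧≢⇒< h (x≢hi ∘ Finₚ.toℕ-injective))))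
            (≡.sym (inside-true {e} l h))
  ...   | no ¬in = ≡.trans
            (inside-false {e} (λ (l , h) → ¬in
              ( ℕₚ.≤∧≢⇒< (ℕ.s≤s⁻¹ (subst (toℕ (lo e) ℕ.<_) (toℕ-next lt) l))
                  (x≢lo ∘ ≡.sym ∘ Finₚ.toℕ-injective)
              , ℕₚ.≤-trans (ℕₚ.n≤1+n _) (subst (ℕ._≤ toℕ (hi e)) (toℕ-next lt) h))))
            (≡.sym (inside-false {e} ¬in))

  -- A mixed difference vanishes once one of its two steps leaves membership in the interval
  -- unchanged, that is, once an end of `f` is not an end of `e`. If f ≠ e, one of its ends is such.
  s-W-other : ∀ {e f} → f ≢ e → s f (W e) ≈ 0#
  s-W-other {e} {f} f≢e = trans (reflexive (s-cut f (inside e))) cases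
    where
    vanishˡ : lo f ≢ lo e → lo f ≢ hi e → xor-rect (inside e (lo f)) (inside e (next (lo f)))
        (inside e (hi f)) (inside e (next (hi f))) ≈ 0#
    vanishˡ p q = subst (λ x → xor-rect (inside e (lo f)) x (inside e (hi f)) (inside e (next (hi f))) ≈
        0#) (≡.sym (inside-next e (lo f) p q))
      (xor-rect-constˡ (inside e (lo f)) _ _)
    vanishʳ : hi f ≢ lo e → hi f ≢ hi e → xor-rect (inside e (lo f)) (inside e (next (lo f)))
        (inside e (hi f)) (inside e (next (hi f))) ≈ 0#
    vanishʳ p q = subst (λ x → xor-rect (inside e (lo f)) (inside e (next (lo f))) (inside e (hi f)) x ≈
        0#) (≡.sym (inside-next e (hi f) p q))
      (xor-rect-constʳ (inside e (lo f)) (inside e (next (lo f))) (inside e (hi f)))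
    cases : xor-rect (inside e (lo f)) (inside e (next (lo f))) (inside e (hi f))
        (inside e (next (hi f))) ≈ 0#
    cases with lo f Finₚ.≟ lo e | lo f Finₚ.≟ hi e
    ... | no p      | no q  = vanishˡ p q
    ... | yes l≡l   | _     = vanishʳ (λ h≡l → lo≢hi f (≡.trans l≡l (≡.sym h≡l)))
        (λ h≡h → f≢e (edge-≡ l≡l h≡h))
    ... | no _      | yes l≡h = vanishʳ
            (λ h≡l → ℕₚ.<-asym (lo<hi′ e) (subst₂ (λ x y → toℕ x ℕ.< toℕ y) l≡h h≡l (lo<hi′ f)))
            (λ h≡h → lo≢hi f (≡.trans l≡h (≡.sym h≡h)))

  s-W-self : ∀ e → s e (W e) ≈ 1# + 1#
  s-W-self e = trans (reflexive
      (≡.trans (s-cut e (inside e)) (values at-lo at-next-lo at-hi at-next-hi)))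
      (solve 1 (λ x → x :+ x :+ :- con (ℤ.+ 0) :+ :- con (ℤ.+ 0) := x :+ x) refl 1#)
    where
    values : ∀ {x x′ y y′} → x ≡ false → x′ ≡ true → y ≡ true → y′ ≡ false →
        xor-rect x x′ y y′ ≡ 1# + 1# + - 0# + - 0#
    values ≡.refl ≡.refl ≡.refl ≡.refl = ≡.refl
    at-lo : inside e (lo e) ≡ false
    at-lo = inside-false {e} (λ (l , _) → ℕₚ.<-irrefl ≡.refl l)
    at-hi : inside e (hi e) ≡ true
    at-hi = inside-true {e} (lo<hi′ e) ℕₚ.≤-refl
    next-lo : toℕ (next (lo e)) ≡ suc (toℕ (lo e))
    next-lo = toℕ-next (ℕₚ.≤-<-trans (lo<hi′ e) (Finₚ.toℕ<n (hi e)))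
    at-next-lo : inside e (next (lo e)) ≡ true
    at-next-lo = inside-true {e} (subst (toℕ (lo e) ℕ.<_) (≡.sym next-lo) ℕₚ.≤-refl)
        (subst (ℕ._≤ toℕ (hi e)) (≡.sym next-lo) (lo<hi′ e))
    at-next-hi : inside e (next (hi e)) ≡ false
    at-next-hi with ℕₚ.m≤n⇒m<n∨m≡n (Finₚ.toℕ<n (hi e))
    ... | inj₁ lt   = inside-false {e}
        (λ (_ , h) → ℕₚ.<⇒≱ ℕₚ.≤-refl (subst (ℕ._≤ toℕ (hi e)) (toℕ-next lt) h))
    ... | inj₂ last = inside-false {e}
        (λ (l , _) → ℕₚ.<⇒≱ l (subst (ℕ._≤ toℕ (lo e)) (≡.sym (toℕ-next-last last)) z≤n))

-- Vectors supported on short edges and the short coefficients.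

module Decomposition {c ℓ₁ ℓ₂} (F : OrderedField c ℓ₁ ℓ₂) (n : ℕ) (3≤n : 3 ℕ.≤ n) (k : ℕ)
    (m+m<n : suc k ℕ.+ suc k ℕ.< n) where
  open OrderedField F
  open FieldProperties F
  open EdgeSpace F n
  open Sums F n
  open Cyclic n 3≤n
  open Fans n 3≤n k m+m<n
  open Space F n 3≤n
  open Inequalities F n 3≤n k m+m<n
  open IsLinear
  open import Relation.Binary.Reasoning.Setoid setoid

  short? : (e : Edge n) → Dec (1 ℕ.≤ dist e × dist e ℕ.≤ k)
  short? e = (1 ℕₚ.≤? dist e) ×-dec (dist e ℕₚ.≤? k)

  long? : (e : Edge n) → Dec (k ℕ.+ 2 ℕ.≤ dist e)
  long? e = k ℕ.+ 2 ℕₚ.≤? dist e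

  k+2≡1+m : k ℕ.+ 2 ≡ suc m
  k+2≡1+m = ℕₚ.+-comm k 2

  shorts longs : List (Edge n)
  shorts = shortGeneratorEdges n k
  longs  = longGeneratorEdges n k

  ∈-shorts⁻ : ∀ {e} → e ∈ shorts → dist e ℕ.≤ k
  ∈-shorts⁻ e∈ = proj₂ (proj₂ (∈-filter⁻ short? {xs = allEdges n} e∈))

  ∈-longs⁻ : ∀ {e} → e ∈ longs → m ℕ.< dist e
  ∈-longs⁻ {e} e∈ = subst (ℕ._≤ dist e) k+2≡1+m (proj₂ (∈-filter⁻ long? {xs = allEdges n} e∈))

  ∈-shorts⁺ : ∀ {e} → dist e ℕ.≤ k → e ∈ shorts
  ∈-shorts⁺ {e} d≤k = ∈-filter⁺ short? (∈-allEdges e) (Named.0<d (name e) , d≤k)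

  ∈-longs⁺ : ∀ {e} → m ℕ.< dist e → e ∈ longs
  ∈-longs⁺ {e} m<d = ∈-filter⁺ long? (∈-allEdges e) (subst (ℕ._≤ dist e) (≡.sym k+2≡1+m) m<d)

  shorts-unique : Unique shorts
  shorts-unique = Uniqueₚ.filter⁺ short? (allEdges-unique n)

  longs-unique : Unique longs
  longs-unique = Uniqueₚ.filter⁺ long? (allEdges-unique n)

  ShortSupport : V → Set ℓ₁
  ShortSupport w = ∀ f → m ℕ.≤ dist f → w f ≈ 0#

  M-far : ∀ {w} → ShortSupport w → ∀ a {d} → m ℕ.≤ d → d ℕ.+ m ℕ.≤ n → M a (a ℕ.+ d) w ≈ 0#
  M-far {w} sup a {d} m≤d d+m≤n = trans (reflexive (M-joins w join))
      (sup (E a (a ℕ.+ d)) (dist-pt-≥ 0<d m≤d d+m≤n (s≤s z≤n) join))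
    where
    0<d : 0 ℕ.< d
    0<d = ℕₚ.≤-trans (s≤s z≤n) m≤d
    join : Joins (E a (a ℕ.+ d)) (pt a) (pt (a ℕ.+ d))
    join = E-joins (ℕₚ.m<m+n a 0<d) (ℕₚ.+-monoʳ-< a (ℕₚ.<-≤-trans (ℕₚ.m<m+n d (s≤s z≤n)) d+m≤n))

  -- The four entries have displacements d, d, d+1 and d-1, where d = `dist e` > m and 2d ≤ n; each
  -- of these and its complement to `n` is at least `m`.
  s-far : ∀ {w} → ShortSupport w → ∀ e → m ℕ.< dist e → s e w ≈ 0#
  s-far {w} sup e m<d = trans (s-rect base (base ℕ.+ dist e) w joins) (trans
      (+-cong (+-cong (+-cong
        (M-far sup base (ℕₚ.<⇒≤ m<d) (ℕₚ.≤-trans (ℕₚ.+-monoʳ-≤ (dist e) (ℕₚ.<⇒≤ m<d)) 2d≤n))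
        (M-far sup (suc base) (ℕₚ.<⇒≤ m<d) (ℕₚ.≤-trans (ℕₚ.+-monoʳ-≤ (dist e) (ℕₚ.<⇒≤ m<d)) 2d≤n)))
        (-‿cong (trans (reflexive (cong (λ x → M base x w) (≡.sym (ℕₚ.+-suc base (dist e)))))
          (M-far sup base (ℕₚ.m≤n⇒m≤1+n (ℕₚ.<⇒≤ m<d))
              (ℕₚ.≤-trans (subst (ℕ._≤ dist e ℕ.+ dist e) (ℕₚ.+-suc (dist e) m)
              (ℕₚ.+-monoʳ-≤ (dist e) m<d)) 2d≤n)))))
        (-‿cong (trans (reflexive (cong (λ x → M (suc base) x w) shorter))
          (M-far sup (suc base) (ℕₚ.∸-monoˡ-≤ 1 m<d)
              (ℕₚ.≤-trans (ℕₚ.+-mono-≤ (ℕₚ.m∸n≤m (dist e) 1) (ℕₚ.<⇒≤ m<d)) 2d≤n)))))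
      (solve 0 (con (ℤ.+ 0) :+ con (ℤ.+ 0) :+ :- con (ℤ.+ 0) :+ :- con (ℤ.+ 0) := con (ℤ.+ 0)) refl))
    where
    open Named (name e)
    shorter : base ℕ.+ dist e ≡ suc base ℕ.+ (dist e ℕ.∸ 1)
    shorter = ≡.trans (cong (base ℕ.+_) (≡.sym (ℕₚ.m+[n∸m]≡n 0<d))) (ℕₚ.+-suc base (dist e ℕ.∸ 1))

  -- In row t the column a+m contributes M(a+t, a+m) - M(a+t+1, a+m), which telescopes and starts
  -- with an entry of length `m`. The entries in the other column have displacements m and m+1,
  -- beyond the support.
  Ψ-far : ∀ {w} → ShortSupport w → ∀ a l → l ℕ.< m → Ψ a (a ℕ.+ m) l w ≈ - M (a ℕ.+ l) (a ℕ.+ m) w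
  Ψ-far {w} sup a zero _ = sym
      (trans (-‿cong (trans (reflexive (cong (λ x → M x (a ℕ.+ m) w) (ℕₚ.+-identityʳ a)))
      (M-far sup a ℕₚ.≤-refl (ℕₚ.<⇒≤ m+m<n)))) -0#≈0#)
  Ψ-far {w} sup a (suc l) l<m = begin
    Ψ a (a ℕ.+ m) l w + rect (a ℕ.+ l) (a ℕ.+ m) (a ℕ.+ m ℕ.+ suc l) w
      ≈⟨ +-cong (Ψ-far sup a l (ℕₚ.<-trans (ℕₚ.n<1+n l) l<m))
          (+-congʳ (+-cong (+-congˡ far₁) (-‿cong far₂))) ⟩
    - M (a ℕ.+ l) (a ℕ.+ m) w + (M (a ℕ.+ l) (a ℕ.+ m) w + 0# + - 0# + - M (suc (a ℕ.+ l)) (a ℕ.+ m) w)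
      ≈⟨ solve 2 (λ x y → :- x :+ (x :+ con (ℤ.+ 0) :+ :- con (ℤ.+ 0) :+ :- y) := :- y) refl
          (M (a ℕ.+ l) (a ℕ.+ m) w) (M (suc (a ℕ.+ l)) (a ℕ.+ m) w) ⟩
    - M (suc (a ℕ.+ l)) (a ℕ.+ m) w
      ≈⟨ -‿cong (reflexive (cong (λ x → M x (a ℕ.+ m) w) (≡.sym (ℕₚ.+-suc a l)))) ⟩
    - M (a ℕ.+ suc l) (a ℕ.+ m) w ∎
    where
    reorder : ∀ x → a ℕ.+ m ℕ.+ x ≡ a ℕ.+ x ℕ.+ m
    reorder x = ≡.trans (ℕₚ.+-assoc a m x)
        (≡.trans (cong (a ℕ.+_) (ℕₚ.+-comm m x)) (≡.sym (ℕₚ.+-assoc a x m)))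
    far₁ : M (suc (a ℕ.+ l)) (a ℕ.+ m ℕ.+ suc l) w ≈ 0#
    far₁ = trans (reflexive (cong (λ x → M (suc (a ℕ.+ l)) x w)
        (≡.trans (reorder (suc l)) (cong (ℕ._+ m) (ℕₚ.+-suc a l)))))
             (M-far sup (suc (a ℕ.+ l)) ℕₚ.≤-refl (ℕₚ.<⇒≤ m+m<n))
    far₂ : M (a ℕ.+ l) (a ℕ.+ m ℕ.+ suc l) w ≈ 0#
    far₂ = trans (reflexive (cong (λ x → M (a ℕ.+ l) x w)
        (≡.trans (reorder (suc l))
        (≡.trans (cong (ℕ._+ m) (ℕₚ.+-suc a l)) (≡.sym (ℕₚ.+-suc (a ℕ.+ l) m))))))
             (M-far sup (a ℕ.+ l) (ℕₚ.n≤1+n m) m+m<n)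

  fan-joins-dist : ∀ {e} a {o} → o ℕ.< m → Joins e (pt (a ℕ.+ o)) (pt (a ℕ.+ m)) → dist e ℕ.+ o ≡ m
  fan-joins-dist {e} a {o} o<m j = ≡.trans
      (cong (ℕ._+ o) (dist-pt-short {x = a ℕ.+ o} (ℕₚ.m<n⇒0<n∸m o<m)
      (ℕₚ.≤-trans (ℕₚ.+-mono-≤ (ℕₚ.m∸n≤m m o) (ℕₚ.m∸n≤m m o)) (ℕₚ.<⇒≤ m+m<n)) (spread j)))
          (ℕₚ.m∸n+n≡m (ℕₚ.<⇒≤ o<m))
    where
    spread : Joins e (pt (a ℕ.+ o)) (pt (a ℕ.+ m)) → Joins e (pt (a ℕ.+ o)) (pt (a ℕ.+ o ℕ.+ (m ℕ.∸ o)))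
    spread = subst (λ x → Joins e (pt (a ℕ.+ o)) (pt x))
        (≡.sym (≡.trans (ℕₚ.+-assoc a o (m ℕ.∸ o)) (cong (a ℕ.+_) (ℕₚ.m+[n∸m]≡n (ℕₚ.<⇒≤ o<m)))))

  fan-joins-unique : ∀ {e} a a′ {o o′} → o ℕ.< m → o′ ℕ.< m → Joins e (pt (a ℕ.+ o)) (pt (a ℕ.+ m)) →
      Joins e (pt (a′ ℕ.+ o′)) (pt (a′ ℕ.+ m)) →
                     o ≡ o′ × pt a ≡ pt a′
  fan-joins-unique {e} a a′ {o} {o′} o<m o′<m j j′
    with ≡.refl ← ℕₚ.+-cancelˡ-≡ (dist e) o o′
        (≡.trans (fan-joins-dist a o<m j) (≡.sym (fan-joins-dist a′ o′<m j′))) =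
    ≡.refl , pt-cancel o (name-unique {x = a ℕ.+ o} {a′ ℕ.+ o} {m ℕ.∸ o} (ℕₚ.m<n⇒0<n∸m o<m)
      (ℕₚ.≤-<-trans (ℕₚ.+-mono-≤ (ℕₚ.m∸n≤m m o) (ℕₚ.m∸n≤m m o)) m+m<n) (spread a j) (spread a′ j′))
    where
    spread : ∀ a → Joins e (pt (a ℕ.+ o)) (pt (a ℕ.+ m)) →
        Joins e (pt (a ℕ.+ o)) (pt (a ℕ.+ o ℕ.+ (m ℕ.∸ o)))
    spread a = subst (λ x → Joins e (pt (a ℕ.+ o)) (pt x))
        (≡.sym (≡.trans (ℕₚ.+-assoc a o (m ℕ.∸ o)) (cong (a ℕ.+_) (ℕₚ.m+[n∸m]≡n (ℕₚ.<⇒≤ o<m)))))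

  Ψ-cong : ∀ {a a′} l v → pt a ≡ pt a′ → Ψ a (a ℕ.+ m) l v ≈ Ψ a′ (a′ ℕ.+ m) l v
  Ψ-cong {a} {a′} l v eq = ∑<-cong l (λ t _ → reflexive (cong₂ _+_ (cong₂ _+_ (cong₂ _+_
      (M-cong v (pt-shift t eq) (pt-shift m eq))
      (M-cong v (suc-shift t) (far t)))
      (cong -_ (M-cong v (pt-shift t eq) (far t))))
      (cong -_ (M-cong v (suc-shift t) (pt-shift m eq)))))
    where
    suc-shift : ∀ t → pt (suc (a ℕ.+ t)) ≡ pt (suc (a′ ℕ.+ t))
    suc-shift t = ≡.trans (cong pt (≡.sym (ℕₚ.+-suc a t)))
        (≡.trans (pt-shift (suc t) eq) (cong pt (ℕₚ.+-suc a′ t)))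
    far : ∀ t → pt (a ℕ.+ m ℕ.+ suc t) ≡ pt (a′ ℕ.+ m ℕ.+ suc t)
    far t = pt-shift (suc t) (pt-shift m eq)

  -- The coefficient of −V_f for f = {p+1 , q} is the value of the inequality of {p , q}; it
  -- vanishes for |f| ≥ k+1 because the subtraction is truncated.
  shortCoeff : V → Edge n → Carrier
  shortCoeff v f = Ψ apex (apex ℕ.+ m) (m ℕ.∸ dist f) v
    where
    apex = Named.base (name f) ℕ.+ dist f ℕ.∸ m

  shortCoeff-far : ∀ v → ShortSupport (shortCoeff v)
  shortCoeff-far v f m≤d = reflexive
      (cong (λ l → ∑< l (λ t → rect (apex ℕ.+ t) (apex ℕ.+ m) (apex ℕ.+ m ℕ.+ suc t) v))
      (ℕₚ.m≤n⇒m∸n≡0 m≤d))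
    where
    apex = Named.base (name f) ℕ.+ dist f ℕ.∸ m

  -- The definition of `shortCoeff` reads the apex off one chosen name of `f`. Independence of that
  -- choice allows neighbouring edges to be evaluated in matching coordinates.
  shortCoeff-Ψ : ∀ v {f} a {o} → o ℕ.< m → Joins f (pt (a ℕ.+ o)) (pt (a ℕ.+ m)) →
      shortCoeff v f ≈ Ψ a (a ℕ.+ m) o v
  shortCoeff-Ψ v {f} a {o} o<m j = named
      (fanName (subst (dist f ℕ.≤_) d+o (ℕₚ.m≤m+n (dist f) o))) ≡.refl
    where
    d+o : dist f ℕ.+ o ≡ m
    d+o = fan-joins-dist a o<m j
    named : (fn : FanNamed f) → FanNamed.apex fn ≡ Named.base (name f) ℕ.+ dist f ℕ.∸ m →
        shortCoeff v f ≈ Ψ a (a ℕ.+ m) o v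
    named fn ≡.refl with fan-joins-unique a (FanNamed.apex fn) o<m (FanNamed.offset<m fn) j
        (FanNamed.joins fn)
    ... | _ , eq = trans (reflexive (cong (λ l → Ψ (FanNamed.apex fn) (FanNamed.apex fn ℕ.+ m) l v)
                     (ℕₚ.+-cancelˡ-≡ (dist f) _ _
                         (≡.trans (ℕₚ.m+[n∸m]≡n (subst (dist f ℕ.≤_) d+o (ℕₚ.m≤m+n (dist f) o)))
                         (≡.sym d+o)))))
                     (sym (Ψ-cong o v eq))

-- The decomposition of a vector and the independence of the generators.

module Cones {c ℓ₁ ℓ₂} (F : OrderedField c ℓ₁ ℓ₂) (n : ℕ) (3≤n : 3 ℕ.≤ n) (k : ℕ)
    (m+m<n : suc k ℕ.+ suc k ℕ.< n) where
  open OrderedField F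
  open FieldProperties F
  open EdgeSpace F n
  open Sums F n
  open Cyclic n 3≤n
  open Fans n 3≤n k m+m<n
  open Space F n 3≤n
  open Inequalities F n 3≤n k m+m<n
  open Generators F n 3≤n k
  open Rigidity F n 3≤n
  open Decomposition F n 3≤n k m+m<n
  open IsLinear
  open import Relation.Binary.Reasoning.Setoid setoid

  fan-join : ∀ a {o} → o ℕ.< m → Joins (E (a ℕ.+ o) (a ℕ.+ m)) (pt (a ℕ.+ o)) (pt (a ℕ.+ m))
  fan-join a {o} o<m = subst (λ x → Joins (E (a ℕ.+ o) x) (pt (a ℕ.+ o)) (pt x))
      (ℕₚ.+-identityʳ (a ℕ.+ m)) (E-fan-joins a o<m (s≤s z≤n))

  M-shortCoeff : ∀ v a {o} → o ℕ.< m → M (a ℕ.+ o) (a ℕ.+ m) (shortCoeff v) ≈ Ψ a (a ℕ.+ m) o v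
  M-shortCoeff v a {o} o<m = trans (reflexive (M-joins (shortCoeff v) (fan-join a o<m)))
      (shortCoeff-Ψ v a o<m (fan-join a o<m))

  -- The four values are sums of s over triangles. Going from a+l to a+l+1 adds row `l` to the
  -- triangle with apex `a`, and the last row to the triangle with apex a+1. These rows share the
  -- part `R` and differ by the unit square at (a+l, a+m). So adding `shortCoeff v` to `v`
  -- annihilates the short s.
  rect-shortCoeff : ∀ v a l → suc l ℕ.< m → rect (a ℕ.+ l) (a ℕ.+ m) (suc (a ℕ.+ m)) (shortCoeff v) ≈ -
      rect (a ℕ.+ l) (a ℕ.+ m) (suc (a ℕ.+ m)) v
  rect-shortCoeff v a l 1+l<m = begin
    rect (a ℕ.+ l) (a ℕ.+ m) (suc (a ℕ.+ m)) (shortCoeff v)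
      ≈⟨ +-cong (+-cong (+-cong (M-shortCoeff v a l<m) (M-shortCoeff v (suc a) l<m))
          (-‿cong (above l l<m)))
           (-‿cong (trans (reflexive (cong (λ x → M x (a ℕ.+ m) (shortCoeff v)) (≡.sym (ℕₚ.+-suc a l))))
               (M-shortCoeff v a 1+l<m))) ⟩
    A + Ψ (suc a) (suc a ℕ.+ m) l v + - before l + -
        (A + rect (a ℕ.+ l) (a ℕ.+ m) (a ℕ.+ m ℕ.+ suc l) v)
      ≈⟨ +-cong (+-congʳ (+-congˡ (step l)))
          (-‿cong (+-congˡ (sym (rect-+ (a ℕ.+ l) (a ℕ.+ m) (suc (a ℕ.+ m)) (a ℕ.+ m ℕ.+ suc l) v)))) ⟩
    A + (before l + R) + - before l + - (A + (rect (a ℕ.+ l) (a ℕ.+ m) (suc (a ℕ.+ m)) v + R))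
      ≈⟨ solve 4 (λ x y r z → x :+ (y :+ r) :+ :- y :+ :- (x :+ (z :+ r)) := :- z) refl A (before l) R
          (rect (a ℕ.+ l) (a ℕ.+ m) (suc (a ℕ.+ m)) v) ⟩
    - rect (a ℕ.+ l) (a ℕ.+ m) (suc (a ℕ.+ m)) v ∎
    where
    l<m : l ℕ.< m
    l<m = ℕₚ.<-trans (ℕₚ.n<1+n l) 1+l<m
    A = Ψ a (a ℕ.+ m) l v
    R = rect (a ℕ.+ l) (suc (a ℕ.+ m)) (a ℕ.+ m ℕ.+ suc l) v
    -- The value at the corner (a+l, a+m+1), whose fan has apex a+1 and one row fewer. For l = 0
    -- this corner has displacement m+1, where `shortCoeff` vanishes.
    before : ℕ → Carrier
    before zero    = 0#
    before (suc l) = Ψ (suc a) (suc a ℕ.+ m) l v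
    above : ∀ l → l ℕ.< m → M (a ℕ.+ l) (suc (a ℕ.+ m)) (shortCoeff v) ≈ before l
    above zero    _   = trans
        (reflexive (cong₂ (λ x y → M x y (shortCoeff v)) (ℕₚ.+-identityʳ a) (≡.sym (ℕₚ.+-suc a m))))
                          (M-far (shortCoeff-far v) a (ℕₚ.n≤1+n m) m+m<n)
    above (suc l) l<m = trans
        (reflexive (cong (λ x → M x (suc (a ℕ.+ m)) (shortCoeff v)) (ℕₚ.+-suc a l)))
                          (M-shortCoeff v (suc a) (ℕₚ.<-trans (ℕₚ.n<1+n l) l<m))
    step : ∀ l → Ψ (suc a) (suc a ℕ.+ m) l v ≈ before l + rect (a ℕ.+ l) (suc (a ℕ.+ m))
        (a ℕ.+ m ℕ.+ suc l) v
    step zero    = sym (trans (+-identityˡ _) (trans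
      (reflexive (cong (λ x → rect (a ℕ.+ 0) (suc (a ℕ.+ m)) x v) (ℕₚ.+-comm (a ℕ.+ m) 1)))
          (rect-diagonal (a ℕ.+ 0) (suc (a ℕ.+ m)) v)))
    step (suc l) = +-congˡ (reflexive
        (cong₂ (λ x y → rect x (suc (a ℕ.+ m)) y v) (≡.sym (ℕₚ.+-suc a l))
        (≡.sym (ℕₚ.+-suc (a ℕ.+ m) (suc l)))))

  s-shortCoeff : ∀ v f → 2 ℕ.≤ dist f → dist f ℕ.≤ m → s f (shortCoeff v) ≈ - s f v
  s-shortCoeff v f 2≤d d≤m = trans (s-rect (apex ℕ.+ offset) (apex ℕ.+ m) (shortCoeff v) joins) (trans
      (rect-shortCoeff v apex offset
          (subst (suc (suc offset) ℕ.≤_) dist+offset (ℕₚ.+-monoˡ-≤ offset 2≤d)))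
      (-‿cong (sym (s-rect (apex ℕ.+ offset) (apex ℕ.+ m) v joins))))
    where open FanNamed (fanName {f} d≤m)

  -- The factor ½ compensates s_e(W_e) = 2. The value 0 off the long edges is there because `Cone`
  -- asks for nonnegative coefficients on the whole index type.
  longCoeff : V → Edge n → Carrier
  longCoeff v e with suc m ℕₚ.≤? dist e
  ... | yes _ = ½ * s e v
  ... | no _  = 0#

  longCoeff-long : ∀ v e → m ℕ.< dist e → longCoeff v e * (1# + 1#) ≈ s e v
  longCoeff-long v e m<d with suc m ℕₚ.≤? dist e
  ... | yes _ = ½*-double (s e v)
  ... | no m≮d = ⊥-elim (m≮d m<d)

  s-comb-long : ∀ h f → m ℕ.< dist f → s f (comb longs h W) ≈ h f * (1# + 1#)
  s-comb-long h f m<d = trans (comb-homo (linear-s f) longs h W) (trans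
    (∑-single longs-unique (∈-longs⁺ m<d)
        (λ {x} _ x≢f → trans (*-congˡ (s-W-other {x} {f} (x≢f ∘ ≡.sym))) (zeroʳ (h x))))
    (*-congˡ (s-W-self f)))

  s-comb-short : ∀ h f → dist f ℕ.≤ m → s f (comb longs h W) ≈ 0#
  s-comb-short h f d≤m = trans (comb-homo (linear-s f) longs h W)
    (∑-zero longs (λ {x} x∈ → trans
        (*-congˡ (s-W-other {x} {f} (λ { ≡.refl → ℕₚ.<⇒≱ (∈-longs⁻ {f} x∈) d≤m }))) (zeroʳ (h x))))

  -- What is left after both generator parts are removed. `shortCoeff v` comes with a plus sign
  -- since the combination of the -V_f with these coefficients is its negative.
  remainder : V → V
  remainder v = (v ⊕ shortCoeff v) ⊕ ⊝ comb longs (longCoeff v) W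

  -- For a long `f` the W part cancels s_f(v) and the short part is invisible. For 2 ≤ |f| ≤ m it is
  -- the short part that cancels s_f(v), and the W of longer edges are invisible.
  s-remainder : ∀ v f → 2 ℕ.≤ dist f → s f (remainder v) ≈ 0#
  s-remainder v f 2≤d = trans
      (trans (+-homo (linear-s f) (v ⊕ shortCoeff v) (⊝ comb longs (longCoeff v) W))
      (+-cong (+-homo (linear-s f) v (shortCoeff v))
          (neg-homo (linear-s f) (comb longs (longCoeff v) W)))) (cases (suc m ℕₚ.≤? dist f))
    where
    cases : Dec (m ℕ.< dist f) → s f v + s f (shortCoeff v) + - s f (comb longs (longCoeff v) W) ≈ 0#
    cases (yes m<d) = trans (+-cong (+-congˡ (s-far (shortCoeff-far v) f m<d))
        (-‿cong (trans (s-comb-long (longCoeff v) f m<d) (longCoeff-long v f m<d))))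
      (solve 1 (λ x → x :+ con (ℤ.+ 0) :+ :- x := con (ℤ.+ 0)) refl (s f v))
    cases (no m≮d) = trans (+-cong (+-congˡ (s-shortCoeff v f 2≤d (ℕₚ.≮⇒≥ m≮d)))
        (-‿cong (s-comb-short (longCoeff v) f (ℕₚ.≮⇒≥ m≮d))))
      (solve 1 (λ x → x :+ :- x :+ :- con (ℤ.+ 0) := con (ℤ.+ 0)) refl (s f v))

  remainder-Span : ∀ v → Span (allFin n) star (remainder v)
  remainder-Span v = s≈0⇒Span (s-remainder v)

  comb-⊝basis : ∀ a f → dist f ℕ.≤ k → comb shorts a (λ e → ⊝ basis e) f ≈ - a f
  comb-⊝basis a f d≤k = trans (∑-single shorts-unique (∈-shorts⁺ d≤k)
      (λ {x} _ x≢f → trans (*-congˡ (trans (-‿cong (reflexive (basis-other x f x≢f))) -0#≈0#))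
          (zeroʳ (a x))))
    (trans (*-congˡ (-‿cong (reflexive (basis-self f))))
        (trans (sym (-‿distribʳ-* (a f) 1#)) (-‿cong (*-identityʳ (a f)))))

  comb-⊝basis-far : ∀ a → ShortSupport (comb shorts a (λ e → ⊝ basis e))
  comb-⊝basis-far a f m≤d = ∑-zero shorts
      (λ {x} x∈ → trans (*-congˡ (trans (-‿cong (reflexive (basis-other x f
    (λ { ≡.refl → ℕₚ.<⇒≱ m≤d (∈-shorts⁻ x∈) })))) -0#≈0#)) (zeroʳ (a x)))

  comb-shortCoeff : ∀ v → comb shorts (shortCoeff v) (λ e → ⊝ basis e) ≋ ⊝ shortCoeff v
  comb-shortCoeff v f with dist f ℕₚ.≤? k
  ... | yes d≤k = comb-⊝basis (shortCoeff v) f d≤k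
  ... | no d≰k  = trans (comb-⊝basis-far (shortCoeff v) f (ℕₚ.≰⇒> d≰k))
      (sym (trans (-‿cong (shortCoeff-far v f (ℕₚ.≰⇒> d≰k))) -0#≈0#))

  decompose : ∀ v → v ≋ (remainder v ⊕ comb shorts (shortCoeff v) (λ e → ⊝ basis e)) ⊕ comb longs
      (longCoeff v) W
  decompose v f = sym (trans (+-congʳ (+-congˡ (comb-shortCoeff v f)))
    (solve 3 (λ x y z → x :+ y :+ :- z :+ :- y :+ z := x) refl (v f) (shortCoeff v f)
        (comb longs (longCoeff v) W f)))

  shortCoeff-nonNeg : ∀ {v} → (∀ a l → l ℕ.≤ k → 0# ≤ Ψ a (a ℕ.+ m) l v) → ∀ f → 0# ≤ shortCoeff v f
  shortCoeff-nonNeg {v} 0≤Ψ f = 0≤Ψ _ (m ℕ.∸ dist f) (ℕₚ.∸-monoʳ-≤ m (Named.0<d (name f)))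

  longCoeff-nonNeg : ∀ {v} → (∀ e → m ℕ.< dist e → 0# ≤ s e v) → ∀ e → 0# ≤ longCoeff v e
  longCoeff-nonNeg {v} 0≤s e with suc m ℕₚ.≤? dist e
  ... | yes m<d = *-nonNeg 0≤½ (0≤s e m<d)
  ... | no _    = ≤-refl

  enclosing-dist : ∀ {e f} → f ∈ enclosing n k e → dist f ℕ.≤ m
  enclosing-dist {e} {f} f∈ = subst (dist f ℕ.≤_) (ℕₚ.+-comm k 1) (proj₁ (proj₂ (∈-filter⁻
    (λ f → (dist f ℕₚ.≤? k ℕ.+ 1) ×-dec (inShortSide? f (lo e) ×-dec inShortSide? f (hi e)))
        {xs = allEdges n} f∈)))

  -- Read as a sum over enclosing edges, Ψ involves only s_f with |f| ≤ m, and each of these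
  -- vanishes on the W of all edges longer than `m`.
  Ψ-comb-long : ∀ h a l → l ℕ.≤ k → Ψ a (a ℕ.+ m) l (comb longs h W) ≈ 0#
  Ψ-comb-long h a zero    _   = refl
  Ψ-comb-long h a (suc l) l<k = trans
      (sym (∑-enclosing {E (a ℕ.+ l) (a ℕ.+ m)} a l (comb longs h W) (ℕₚ.m<n⇒m<1+n l<k)
      (fan-join a (ℕₚ.m<n⇒m<1+n l<k))))
    (∑-zero (enclosing n k (E (a ℕ.+ l) (a ℕ.+ m)))
        (λ {f} f∈ → s-comb-short h f (enclosing-dist {E (a ℕ.+ l) (a ℕ.+ m)} {f} f∈)))

  simplicialIndices : List (Edge n ⊎ Edge n)
  simplicialIndices = map inj₁ shorts ++ map inj₂ longs

  generator : Edge n ⊎ Edge n → V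
  generator = [ (λ e → ⊝ basis e) , W ]′

  simplicialIndices-unique : Unique simplicialIndices
  simplicialIndices-unique = Uniqueₚ.++⁺ (Uniqueₚ.map⁺ (λ { ≡.refl → ≡.refl }) shorts-unique)
      (Uniqueₚ.map⁺ (λ { ≡.refl → ≡.refl }) longs-unique) disjoint
    where
    disjoint : ∀ {x} → ¬ (x ∈ map inj₁ shorts × x ∈ map inj₂ longs)
    disjoint (p , q) with ∈-map⁻ inj₁ p | ∈-map⁻ inj₂ q
    ... | _ , _ , ≡.refl | _ , _ , ()

  comb-generator : ∀ a → comb simplicialIndices a generator ≋ comb shorts (a ∘ inj₁) (λ e → ⊝ basis e) ⊕
      comb longs (a ∘ inj₂) W
  comb-generator a f = trans (∑-++ (map inj₁ shorts) (map inj₂ longs) (λ x → a x * generator x f))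
    (+-cong (∑-map inj₁ shorts (λ x → a x * generator x f))
        (∑-map inj₂ longs (λ x → a x * generator x f)))

  module _ (1≤k : 1 ℕ.≤ k) where

    Lineality⇒Ψ≈0 : ∀ {v} → Lineality (Grob k) v → ∀ a l → l ℕ.≤ k → Ψ a (a ℕ.+ m) l v ≈ 0#
    Lineality⇒Ψ≈0 {v} (G , H) a l l≤k = 0≤±⇒≈0 (Grob⇒0≤Ψ-fan 1≤k G a l l≤k)
      (0≤-cong (neg-homo (linear-Ψ a (a ℕ.+ m) l) v) (Grob⇒0≤Ψ-fan 1≤k H a l l≤k))

    Lineality⇒s≈0 : ∀ {v} → Lineality (Grob k) v → ∀ e → m ℕ.< dist e → s e v ≈ 0#
    Lineality⇒s≈0 {v} (G , H) e m<d = 0≤±⇒≈0 (Grob⇒0≤s 1≤k G {e} (ℕₚ.<⇒≤ m<d))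
      (0≤-cong (neg-homo (linear-s e) v) (Grob⇒0≤s 1≤k H {e} (ℕₚ.<⇒≤ m<d)))

    -- Each coefficient is isolated by a functional that vanishes on the lineality space: s_e for
    -- W_e, and for -V_e the Ψ with `offset` rows, which belongs to the edge one step longer than
    -- `e`.
    generators-independent : ∀ a → Lineality (Grob k) (comb simplicialIndices a generator) → ∀ x →
        x ∈ simplicialIndices → a x ≈ 0#
    generators-independent a L x x∈ with ∈-++⁻ (map inj₁ shorts) x∈
    ... | inj₂ q with e , e∈ , ≡.refl ← ∈-map⁻ inj₂ q = double≈0 (begin
        a (inj₂ e) * (1# + 1#)                 ≈⟨ trans (sym (s-comb-long (a ∘ inj₂) e m<d))
            (sym (+-identityˡ _)) ⟩
        0# + s e C                             ≈⟨ +-congʳ (s-far (comb-⊝basis-far (a ∘ inj₁)) e m<d) ⟨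
        s e B + s e C                          ≈⟨ +-homo (linear-s e) B C ⟨
        s e (B ⊕ C)                            ≈⟨ ≋-cong (linear-s e) (comb-generator a) ⟨
        s e (comb simplicialIndices a generator) ≈⟨ Lineality⇒s≈0 L e m<d ⟩
        0#                                     ∎)
      where
      m<d = ∈-longs⁻ e∈
      B = comb shorts (a ∘ inj₁) (λ e → ⊝ basis e)
      C = comb longs (a ∘ inj₂) W
    ... | inj₁ p with e , e∈ , ≡.refl ← ∈-map⁻ inj₁ p = begin
        a (inj₁ e)                             ≈⟨ -‿involutive _ ⟨
        - - a (inj₁ e)                         ≈⟨ -‿cong
            (trans (reflexive (M-joins B joins)) (comb-⊝basis (a ∘ inj₁) e (∈-shorts⁻ e∈))) ⟨
        - M (apex ℕ.+ offset) (apex ℕ.+ m) B   ≈⟨ trans (+-identityʳ _)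
            (Ψ-far (comb-⊝basis-far (a ∘ inj₁)) apex offset offset<m) ⟨
        φ B + 0#                               ≈⟨ +-congˡ
            (Ψ-comb-long (a ∘ inj₂) apex offset (ℕ.s≤s⁻¹ offset<m)) ⟨
        φ B + φ C                              ≈⟨ +-homo (linear-Ψ apex (apex ℕ.+ m) offset) B C ⟨
        φ (B ⊕ C)                              ≈⟨ ≋-cong (linear-Ψ apex (apex ℕ.+ m) offset)
            (comb-generator a) ⟨
        φ (comb simplicialIndices a generator) ≈⟨ Lineality⇒Ψ≈0 L apex offset (ℕ.s≤s⁻¹ offset<m) ⟩
        0#                                     ∎
      where
      open FanNamed (fanName {e} (ℕₚ.m≤n⇒m≤1+n (∈-shorts⁻ e∈)))
      B = comb shorts (a ∘ inj₁) (λ e → ⊝ basis e)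
      C = comb longs (a ∘ inj₂) W
      φ = Ψ apex (apex ℕ.+ m) offset

-- The four-point cone `FP` and its rays.

module FourPoint {c ℓ₁ ℓ₂} (F : OrderedField c ℓ₁ ℓ₂) (n : ℕ) (3≤n : 3 ℕ.≤ n) where
  open OrderedField F
  open FieldProperties F
  open EdgeSpace F n
  open Sums F n
  open Distances n 3≤n
  open Space F n 3≤n
  open Generators F n 3≤n 0 using (cut; inside; inside-between; xor-≤; xor-≈)
  open Rigidity F n 3≤n

  both? : ∀ x y → Dec (x ≡ true × y ≡ true)
  both? x y = (x Data.Bool.Properties.≟ true) ×-dec (y Data.Bool.Properties.≟ true)

  xor-sum-≤ : ∀ x y z w → [ x xor z ]₀₁ + [ y xor w ]₀₁ ≤ [ x ]₀₁ + [ y ]₀₁ + ([ z ]₀₁ + [ w ]₀₁)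
  xor-sum-≤ x y z w = ≤-respʳ
      (solve 4 (λ x y z w → x :+ z :+ (y :+ w) := x :+ y :+ (z :+ w)) refl [ x ]₀₁ [ y ]₀₁ [ z
      ]₀₁ [ w ]₀₁)
    (+-mono-≤ (xor-≤ x z) (xor-≤ y w))

  -- The Booleans are the memberships of four successive vertices, and the two implications express
  -- convexity of the interval. If a diagonal has both ends inside, a third vertex is inside as well
  -- and the sums are equal. Otherwise each diagonal is cut once per inside end, the most that any
  -- pairing can achieve.
  crossing-cut-max : ∀ x x′ y y′ → (x ≡ true → y ≡ true → x′ ≡ true) →
      (x′ ≡ true → y′ ≡ true → y ≡ true) →
    ([ x xor x′ ]₀₁ + [ y xor y′ ]₀₁ ≤ [ x xor y ]₀₁ + [ x′ xor y′ ]₀₁)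
    × ([ x xor y′ ]₀₁ + [ x′ xor y ]₀₁ ≤ [ x xor y ]₀₁ + [ x′ xor y′ ]₀₁)
  crossing-cut-max x x′ y y′ p q with both? x y | both? x′ y′
  ... | yes (≡.refl , ≡.refl) | _ with ≡.refl ← p ≡.refl ≡.refl = ≤-refl , ≤-reflexive (+-comm _ _)
  ... | no _ | yes (≡.refl , ≡.refl) with ≡.refl ← q ≡.refl ≡.refl = ≤-refl , ≤-refl
  ... | no ¬xy | no ¬x′y′ =
        ≤-respʳ (+-cong (sym (xor-≈ x y ¬xy)) (sym (xor-≈ x′ y′ ¬x′y′))) (xor-sum-≤ x y x′ y′)
      , ≤-respʳ (+-cong (sym (xor-≈ x y ¬xy)) (sym (xor-≈ x′ y′ ¬x′y′))) (≤-respʳ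
          (solve 4 (λ x x′ y′ y → x :+ x′ :+ (y′ :+ y) := x :+ y :+ (x′ :+ y′)) refl [ x ]₀₁ [ x′ ]₀₁ [
              y′ ]₀₁ [ y ]₀₁) (xor-sum-≤ x x′ y′ y))

  FP-W : ∀ e → FP (W e)
  FP-W e a a′ b b′ a<a′ a′<b b<b′
    with p , q ← crossing-cut-max (inside e a) (inside e a′) (inside e b) (inside e b′)
                   (λ p q → inside-between {e} p q a<a′ a′<b)
                       (λ p q → inside-between {e} p q a′<b b<b′) =
      subst₂ _≤_ (at a a′ b b′) (at a b a′ b′) p , subst₂ _≤_ (at a b′ a′ b) (at a b a′ b′) q
    where
    at : ∀ x y z w → [ inside e x xor inside e y ]₀₁ + [ inside e z xor inside e w ]₀₁ ≡ W e ⟨ x , y ⟩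
        + W e ⟨ z , w ⟩
    at x y z w = cong₂ _+_ (≡.sym (cut-⟨⟩ (inside e) x y)) (≡.sym (cut-⟨⟩ (inside e) z w))

  W-ray : ∀ e → IsRayOfFP e (W e)
  W-ray e = FP-W e , (λ le → 2≰0 (≤-respˡ (s-W-self e) le)) , λ f _ f≢e → s-W-other f≢e

  FP⇒0≤s : ∀ {v} → FP v → ∀ e → 2 ℕ.≤ dist e → 0# ≤ s e v
  FP⇒0≤s {v} fp e 2≤d = cases (ℕₚ.m≤n⇒m<n∨m≡n (Finₚ.toℕ<n b))
    where
    a b a′ b′ : Fin n
    a = lo e
    b = hi e
    a′ = next a
    b′ = next b
    gap≥2 : 2 ℕ.≤ gap e
    gap≥2 = ℕₚ.≤-trans (subst (2 ℕ.≤_) (dist-gap e) 2≤d) (ℕₚ.m⊓n≤n (n ℕ.∸ gap e) (gap e))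
    cogap≥2 : 2 ℕ.≤ n ℕ.∸ gap e
    cogap≥2 = ℕₚ.≤-trans (subst (2 ℕ.≤_) (dist-gap e) 2≤d) (ℕₚ.m⊓n≤m (n ℕ.∸ gap e) (gap e))
    1+a<b : suc (toℕ a) ℕ.< toℕ b
    1+a<b = subst₂ ℕ._≤_ (ℕₚ.+-comm (toℕ a) 2) (lo+gap e) (ℕₚ.+-monoʳ-≤ (toℕ a) gap≥2)
    toℕ-a′ : toℕ a′ ≡ suc (toℕ a)
    toℕ-a′ = toℕ-next (ℕₚ.<-trans 1+a<b (Finₚ.toℕ<n b))
    a<a′ : a Fin.< a′
    a<a′ = subst (toℕ a ℕ.<_) (≡.sym toℕ-a′) ℕₚ.≤-refl
    a′<b : a′ Fin.< b
    a′<b = subst (ℕ._< toℕ b) (≡.sym toℕ-a′) 1+a<b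
    cases : suc (toℕ b) ℕ.< n ⊎ suc (toℕ b) ≡ n → 0# ≤ s e v
    cases (inj₁ lt) = 0≤-cong
        (solve 4 (λ p q r t → p :+ q :+ :- (r :+ t) := p :+ q :+ :- r :+ :- t) refl
          (v ⟨ a , b ⟩) (v ⟨ a′ , b′ ⟩) (v ⟨ a , b′ ⟩) (v ⟨ a′ , b ⟩))
        (x≤y⇒0≤y-x (proj₂ (fp a a′ b b′ a<a′ a′<b
            (subst (toℕ b ℕ.<_) (≡.sym (toℕ-next lt)) ℕₚ.≤-refl))))
    -- Here `b` is the last vertex and `b′` is vertex 0, so the four vertices increase in the order
    -- b′, a, a′, b. The pairing to be compared with the crossing is then the one of neighbours, the
    -- first conjunct of `FP`.
    cases (inj₂ last) = 0≤-cong (trans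
          (+-cong (+-congʳ (reflexive (⟨⟩-sym v b′ a′))) (-‿cong (+-congʳ (reflexive (⟨⟩-sym v b′ a)))))
          (solve 4 (λ p q r t → p :+ q :+ :- (r :+ t) := q :+ p :+ :- r :+ :- t) refl
            (v ⟨ a′ , b′ ⟩) (v ⟨ a , b ⟩) (v ⟨ a , b′ ⟩) (v ⟨ a′ , b ⟩)))
        (x≤y⇒0≤y-x (proj₁ (fp b′ a a′ b (subst (ℕ._< toℕ a) (≡.sym (toℕ-next-last last)) 0<a)
            a<a′ a′<b)))
      where
      0<a : 0 ℕ.< toℕ a
      0<a = ℕₚ.n≢0⇒n>0 (λ a≡0 → ℕₚ.<⇒≱ cogap≥2
          (ℕₚ.≤-reflexive (≡.trans (cong (λ x → n ℕ.∸ (toℕ b ℕ.∸ x)) a≡0)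
        (≡.trans (cong (ℕ._∸ toℕ b) (≡.sym last)) (ℕₚ.m+n∸n≡m 1 (toℕ b))))))

-- Equality of the three descriptions, and irredundancy.

module Facets {c ℓ₁ ℓ₂} (F : OrderedField c ℓ₁ ℓ₂) (n : ℕ) (3≤n : 3 ℕ.≤ n) (k : ℕ)
    (m+m<n : suc k ℕ.+ suc k ℕ.< n) (1≤k : 1 ℕ.≤ k) where
  open OrderedField F
  open FieldProperties F
  open EdgeSpace F n
  open Sums F n
  open Cyclic n 3≤n
  open Fans n 3≤n k m+m<n
  open Space F n 3≤n
  open Inequalities F n 3≤n k m+m<n
  open Generators F n 3≤n k
  open Rigidity F n 3≤n
  open Decomposition F n 3≤n k m+m<n
  open Cones F n 3≤n k m+m<n
  open FourPoint F n 3≤n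
  open IsLinear

  -- Selects the index under which the inequality of `e` is listed, so that length k+1, listed as
  -- long, can be treated together with the short lengths.
  tag : Edge n → Edge n ⊎ Edge n
  tag e with m ℕₚ.≤? dist e
  ... | yes _ = inj₁ e
  ... | no _  = inj₂ e

  long∈ : ∀ {e} → m ℕ.≤ dist e → inj₁ e ∈ inequalityIndices n k
  long∈ {e} m≤d = ∈-++⁺ˡ (∈-map⁺ inj₁
      (∈-filter⁺ (λ e → k ℕ.+ 1 ℕₚ.≤? dist e) (∈-allEdges e) (subst (ℕ._≤ dist e) (ℕₚ.+-comm 1 k) m≤d)))

  tag∈ : ∀ {e} → 2 ℕ.≤ dist e → tag e ∈ inequalityIndices n k
  tag∈ {e} 2≤d with m ℕₚ.≤? dist e
  ... | yes m≤d = long∈ m≤d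
  ... | no m≰d  = ∈-++⁺ʳ (map inj₁ (longInequalityEdges n k)) (∈-map⁺ inj₂
          (∈-filter⁺ (λ e → (2 ℕₚ.≤? dist e) ×-dec (dist e ℕₚ.≤? k)) (∈-allEdges e)
              (2≤d , ℕ.s≤s⁻¹ (ℕₚ.≰⇒> m≰d))))

  -- Regroups the indices by the generator dual to them: inequalities of length 2, ..., k+1 go with
  -- the -V of length 1, ..., k, and only those of length at least k+2 go with a W.
  classify : ∀ {x} → x ∈ inequalityIndices n k →
             (∃[ e ] (x ≡ inj₁ e × m ℕ.< dist e)) ⊎ (∃[ e ] (x ≡ tag e × 2 ℕ.≤ dist e × dist e ℕ.≤ m))
  classify x∈ with ∈-++⁻ (map inj₁ (longInequalityEdges n k)) x∈
  ... | inj₁ p with e , e∈ , ≡.refl ← ∈-map⁻ inj₁ p = by-length (ℕₚ.m≤n⇒m<n∨m≡n m≤d)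
    where
    m≤d : m ℕ.≤ dist e
    m≤d = subst (ℕ._≤ dist e) (ℕₚ.+-comm k 1)
        (proj₂ (∈-filter⁻ (λ e → k ℕ.+ 1 ℕₚ.≤? dist e) {xs = allEdges n} e∈))
    tag≡ : inj₁ e ≡ tag e
    tag≡ with m ℕₚ.≤? dist e
    ... | yes _  = ≡.refl
    ... | no m≰d = ⊥-elim (m≰d m≤d)
    by-length : m ℕ.< dist e ⊎ m ≡ dist e → _
    by-length (inj₁ m<d) = inj₁ (e , ≡.refl , m<d)
    by-length (inj₂ m≡d) = inj₂ (e , tag≡ , subst (2 ℕ.≤_) m≡d (s≤s 1≤k) , ℕₚ.≤-reflexive (≡.sym m≡d))
  ... | inj₂ p with e , e∈ , ≡.refl ← ∈-map⁻ inj₂ p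
               with _ , 2≤d , d≤k ← ∈-filter⁻ (λ e → (2 ℕₚ.≤? dist e) ×-dec (dist e ℕₚ.≤? k))
                   {xs = allEdges n} e∈ =
        inj₂ (e , tag≡ , 2≤d , ℕₚ.m≤n⇒m≤1+n d≤k)
    where
    tag≡ : inj₂ e ≡ tag e
    tag≡ with m ℕₚ.≤? dist e
    ... | yes m≤d = ⊥-elim (ℕₚ.<⇒≱ m≤d d≤k)
    ... | no _    = ≡.refl

  inequality-tag : ∀ e v → dist e ℕ.≤ m → inequality k (tag e) v ≈ ∑ (enclosing n k e) (λ f → s f v)
  inequality-tag e v d≤m with m ℕₚ.≤? dist e
  ... | yes m≤d = sym (∑-enclosing-long {e} v (ℕₚ.≤-antisym d≤m m≤d))
  ... | no _    = refl

  Holds : V → Set ℓ₂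
  Holds v = ∀ {x} → x ∈ inequalityIndices n k → 0# ≤ inequality k x v

  Holds⇒0≤Ψ : ∀ {v} → Holds v → ∀ a l → l ℕ.≤ k → 0# ≤ Ψ a (a ℕ.+ m) l v
  Holds⇒0≤Ψ     H a zero    _   = ≤-refl
  Holds⇒0≤Ψ {v} H a (suc o) o<k = 0≤-cong
      (trans (inequality-tag e v d≤m) (∑-enclosing {e} a o v o<m (fan-join a o<m))) (H (tag∈ 2≤d))
    where
    e = E (a ℕ.+ o) (a ℕ.+ m)
    o<m : o ℕ.< m
    o<m = ℕₚ.m<n⇒m<1+n o<k
    d+o : dist e ℕ.+ o ≡ m
    d+o = fan-joins-dist a o<m (fan-join a o<m)
    d≤m : dist e ℕ.≤ m
    d≤m = subst (dist e ℕ.≤_) d+o (ℕₚ.m≤m+n (dist e) o)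
    2≤d : 2 ℕ.≤ dist e
    2≤d = ℕₚ.+-cancelʳ-≤ o 2 (dist e) (subst (suc (suc o) ℕ.≤_) (≡.sym d+o) (s≤s o<k))

  Holds⇒0≤s : ∀ {v} → Holds v → ∀ e → m ℕ.< dist e → 0# ≤ s e v
  Holds⇒0≤s H e m<d = H (long∈ {e} (ℕₚ.<⇒≤ m<d))

  Generated : V → Set (c ⊔ ℓ₁ ⊔ ℓ₂)
  Generated = Span (allFin n) star ⊞ Cone shorts (λ e → ⊝ basis e) ⊞ Cone longs W

  Holds⇒Generated : ∀ {v} → Holds v → Generated v
  Holds⇒Generated {v} H = _ , comb longs (longCoeff v) W
    , (remainder v , comb shorts (shortCoeff v) (λ e → ⊝ basis e)
      , remainder-Span v , (shortCoeff v , shortCoeff-nonNeg {v} (Holds⇒0≤Ψ H) , λ _ → refl) ,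
          λ _ → refl)
    , (longCoeff v , longCoeff-nonNeg (Holds⇒0≤s H) , λ _ → refl)
    , decompose v

  Generated⇒Grob : ∀ {v} → Generated v → Grob k v
  Generated⇒Grob (p , q , (p₁ , p₂ , sp , (a , 0≤a , eq₂) , eq₁) , (b , 0≤b , eq₃) , eq) =
    Grob-resp-≋ (λ e → sym (eq e)) (Grob-⊕
      (Grob-resp-≋ (λ e → sym (eq₁ e)) (Grob-⊕ (Span⇒Grob sp)
        (Grob-resp-≋ (λ e → sym (eq₂ e))
            (Grob-comb shorts 0≤a (λ {x} x∈ → Grob-⊝basis {x} (∈-shorts⁻ x∈))))))
      (Grob-resp-≋ (λ e → sym (eq₃ e)) (Grob-comb longs 0≤b (λ {x} _ → Grob-W x))))

  Grob⇒Holds : ∀ {v} → Grob k v → Holds v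
  Grob⇒Holds G x∈ = Grob⇒inequality 1≤k G x∈

  -- Here both families of coefficients vanish, so `v` coincides with its remainder, which is a
  -- combination of stars.
  Lineality⊆Span : ∀ {v} → Lineality (Grob k) v → Span (allFin n) star v
  Lineality⊆Span {v} L = proj₁ (remainder-Span v) , λ e →
      trans (sym (unchanged e)) (proj₂ (remainder-Span v) e)
    where
    long≈0 : ∀ x → longCoeff v x ≈ 0#
    long≈0 x with suc m ℕₚ.≤? dist x
    ... | yes m<d = trans (*-congˡ (Lineality⇒s≈0 1≤k L x m<d)) (zeroʳ ½)
    ... | no _    = refl
    unchanged : remainder v ≋ v
    unchanged e = trans (+-cong
        (+-congˡ (Lineality⇒Ψ≈0 1≤k L _ (m ℕ.∸ dist e) (ℕₚ.∸-monoʳ-≤ m (Named.0<d (name e)))))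
        (trans (-‿cong (∑-zero longs (λ {x} _ → trans (*-congʳ (long≈0 x)) (zeroˡ (W x e))))) -0#≈0#))
      (solve 1 (λ x → x :+ con (ℤ.+ 0) :+ con (ℤ.+ 0) := x) refl (v e))

  -- Three successive vertices form a triangle on whose edges the potential vanishes, and 2aₓ is the
  -- sum over the two edges at x minus the value on the third.
  star-independent : ∀ a → comb (allFin n) a star ≋ 𝟎 → ∀ x → a x ≈ 0#
  star-independent a eq x = double≈0 (begin
      a x * (1# + 1#)                                    ≈⟨ solve 3
          (λ x y z → x :* (con (ℤ.+ 1) :+ con (ℤ.+ 1)) := x :+ y :+ (x :+ z) :+ :- (y :+ z)) refl (a x)
          (a y) (a z) ⟩
      a x + a y + (a x + a z) + - (a y + a z)            ≈⟨ +-cong (+-cong (pair x≢y) (pair x≢z))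
          (-‿cong (pair y≢z)) ⟩
      0# + 0# + - 0#                                     ≈⟨ solve 0
          (con (ℤ.+ 0) :+ con (ℤ.+ 0) :+ :- con (ℤ.+ 0) := con (ℤ.+ 0)) refl ⟩
      0#                                                 ∎)
    where
    open import Relation.Binary.Reasoning.Setoid setoid
    p = toℕ x
    y = pt (suc p)
    z = pt (suc (suc p))
    x≢y : x ≢ y
    x≢y eq = pt-≢ {p} {suc p} ℕₚ.≤-refl
        (subst (ℕ._< p ℕ.+ n) (ℕₚ.+-comm p 1) (ℕₚ.+-monoʳ-< p (ℕₚ.<-trans (ℕₚ.n<1+n 1) 3≤n)))
        (≡.trans (pt-toℕ x) eq)
    x≢z : x ≢ z
    x≢z eq = pt-≢ {p} {suc (suc p)} (ℕₚ.n≤1+n _)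
        (subst (ℕ._< p ℕ.+ n) (ℕₚ.+-comm p 2) (ℕₚ.+-monoʳ-< p 3≤n)) (≡.trans (pt-toℕ x) eq)
    y≢z : y ≢ z
    y≢z = pt-≢ {suc p} {suc (suc p)} ℕₚ.≤-refl
        (subst (ℕ._< suc p ℕ.+ n) (ℕₚ.+-comm (suc p) 1)
        (ℕₚ.+-monoʳ-< (suc p) (ℕₚ.<-trans (ℕₚ.n<1+n 1) 3≤n)))
    pair : ∀ {x y} → x ≢ y → a x + a y ≈ 0#
    pair {x} {y} x≢y = go (mk-joins x≢y) (trans (sym (comb-star a (mk x y))) (eq (mk x y)))
      where
      go : Joins (mk x y) x y → potential a (mk x y) ≈ 0# → a x + a y ≈ 0#
      go (fwd l h) e0 = trans (reflexive (cong₂ (λ x y → a x + a y) (≡.sym l) (≡.sym h))) e0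
      go (bwd l h) e0 = trans (+-comm (a x) (a y))
          (trans (reflexive (cong₂ (λ x y → a x + a y) (≡.sym l) (≡.sym h))) e0)

  Simplicial : V → Set _
  Simplicial = Lineality (Grob k) ⊞ Cone simplicialIndices generator

  Grob⇒Simplicial : ∀ {v} → Grob k v → Simplicial v
  Grob⇒Simplicial {v} G = remainder v , comb simplicialIndices coeff generator
    , Span⊆Lineality (remainder-Span v)
    , (coeff , nonNeg , λ _ → refl)
    , λ e → trans (decompose v e) (trans (+-assoc _ _ _) (+-congˡ (sym (comb-generator coeff e))))
    where
    coeff : Edge n ⊎ Edge n → Carrier
    coeff = [ shortCoeff v , longCoeff v ]′
    nonNeg : ∀ x → 0# ≤ coeff x
    nonNeg (inj₁ e) = shortCoeff-nonNeg {v} (Holds⇒0≤Ψ (Grob⇒Holds G)) e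
    nonNeg (inj₂ e) = longCoeff-nonNeg (Holds⇒0≤s (Grob⇒Holds G)) e

  Simplicial⇒Grob : ∀ {v} → Simplicial v → Grob k v
  Simplicial⇒Grob (p , q , (Gp , _) , (a , 0≤a , eq₁) , eq) = Grob-resp-≋ (λ e → sym (eq e))
    (Grob-⊕ Gp (Grob-resp-≋ (λ e → sym (eq₁ e)) (Grob-comb simplicialIndices 0≤a generator∈)))
    where
    generator∈ : ∀ {x} → x ∈ simplicialIndices → Grob k (generator x)
    generator∈ x∈ with ∈-++⁻ (map inj₁ shorts) x∈
    ... | inj₁ p with e , e∈ , ≡.refl ← ∈-map⁻ inj₁ p = Grob-⊝basis {e} (∈-shorts⁻ e∈)
    ... | inj₂ q with e , e∈ , ≡.refl ← ∈-map⁻ inj₂ q = Grob-W e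

  basis-far : ∀ {g} → dist g ℕ.≤ k → ShortSupport (basis g)
  basis-far {g} d≤k f m≤d = reflexive (basis-other g f (λ { ≡.refl → ℕₚ.<⇒≱ m≤d d≤k }))

  inequality-⊝W-tag : ∀ e f → m ℕ.< dist e → dist f ℕ.≤ m → inequality k (tag f) (⊝ W e) ≈ 0#
  inequality-⊝W-tag e f m<d d≤m = trans (inequality-tag f (⊝ W e) d≤m)
      (∑-zero (enclosing n k f) (λ {g} g∈ →
    trans (neg-homo (linear-s g) (W e))
        (trans (-‿cong (s-W-other {e} {g}
        (λ { ≡.refl → ℕₚ.<⇒≱ m<d (enclosing-dist {f} g∈) }))) -0#≈0#)))

  -- By duality -W_e violates only s_e: the other long s vanish on it, and so do the enclosing sums,
  -- whose edges have length at most `m`.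
  irredundant-long : ∀ e → m ℕ.< dist e →
    ∃[ v ] ((∀ y → y ∈ inequalityIndices n k → y ≢ inj₁ e → 0# ≤ inequality k y v) × ¬
        (0# ≤ inequality k (inj₁ e) v))
  irredundant-long e m<d = ⊝ W e , others , λ le →
      0≰-2 (0≤-cong (trans (neg-homo (linear-s e) (W e)) (-‿cong (s-W-self e))) le)
    where
    others : ∀ y → y ∈ inequalityIndices n k → y ≢ inj₁ e → 0# ≤ inequality k y (⊝ W e)
    others y y∈ y≢ with classify y∈
    ... | inj₁ (f , ≡.refl , _) = ≤-reflexive (sym (trans (neg-homo (linear-s f) (W e))
            (trans (-‿cong (s-W-other {e} {f} (λ { ≡.refl → y≢ ≡.refl }))) -0#≈0#)))
    ... | inj₂ (f , ≡.refl , _ , d≤m) = ≤-reflexive (sym (inequality-⊝W-tag e f m<d d≤m))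

  -- Shortening [p , q] to [p+1 , q] matches the inequalities of length 2 , … , k+1 with
  -- the short generators.
  irredundant-short : ∀ e → 2 ℕ.≤ dist e → dist e ℕ.≤ m →
    ∃[ v ] ((∀ y → y ∈ inequalityIndices n k → y ≢ tag e → 0# ≤ inequality k y v) × ¬
        (0# ≤ inequality k (tag e) v))
  irredundant-short e 2≤d d≤m = basis g , others , λ le →
      0≰-1 (0≤-cong (trans (value e fn 2≤d d≤m) (-‿cong (reflexive (basis-self g)))) le)
    where
    fn : FanNamed e
    fn = fanName d≤m
    shrunk : ∀ {f} → FanNamed f → Edge n
    shrunk fn = E (FanNamed.apex fn ℕ.+ suc (FanNamed.offset fn)) (FanNamed.apex fn ℕ.+ m)
    suc-offset<m : ∀ {f} (fn : FanNamed f) → 2 ℕ.≤ dist f → suc (FanNamed.offset fn) ℕ.< m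
    suc-offset<m fn 2≤d = subst (suc (suc (FanNamed.offset fn)) ℕ.≤_) (FanNamed.dist+offset fn)
        (ℕₚ.+-monoˡ-≤ (FanNamed.offset fn) 2≤d)
    shrunk-joins : ∀ {f} (fn : FanNamed f) → 2 ℕ.≤ dist f →
        Joins (shrunk fn) (pt (FanNamed.apex fn ℕ.+ suc (FanNamed.offset fn)))
        (pt (FanNamed.apex fn ℕ.+ m))
    shrunk-joins fn 2≤d = fan-join (FanNamed.apex fn) (suc-offset<m fn 2≤d)
    g : Edge n
    g = shrunk fn
    g≤k : dist g ℕ.≤ k
    g≤k = ℕ.s≤s⁻¹ (subst (suc (dist g) ℕ.≤_)
        (≡.trans (≡.sym (ℕₚ.+-suc (dist g) _))
        (fan-joins-dist (FanNamed.apex fn) (suc-offset<m fn 2≤d) (shrunk-joins fn 2≤d)))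
            (s≤s (ℕₚ.m≤m+n (dist g) _)))
    value : ∀ f (fn′ : FanNamed f) → 2 ℕ.≤ dist f → dist f ℕ.≤ m →
        inequality k (tag f) (basis g) ≈ - basis g (shrunk fn′)
    value f fn′ 2≤f f≤m = trans (inequality-tag f (basis g) f≤m)
        (trans (∑-enclosing apex offset (basis g) offset<m joins)
        (trans (Ψ-far (basis-far {g} g≤k) apex (suc offset) (suc-offset<m fn′ 2≤f))
            (-‿cong (reflexive (M-joins (basis g) (shrunk-joins fn′ 2≤f))))))
      where open FanNamed fn′
    shrunk-injective : ∀ {f} (fn′ : FanNamed f) → 2 ℕ.≤ dist f → g ≡ shrunk fn′ → f ≡ e
    shrunk-injective {f} fn′ 2≤f eq
      with o≡ , a≡ ← fan-joins-unique (FanNamed.apex fn) (FanNamed.apex fn′) (suc-offset<m fn 2≤d)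
          (suc-offset<m fn′ 2≤f)
                       (shrunk-joins fn 2≤d) (subst
                           (λ h → Joins h (pt (FanNamed.apex fn′ ℕ.+ suc (FanNamed.offset fn′)))
                           (pt (FanNamed.apex fn′ ℕ.+ m))) (≡.sym eq) (shrunk-joins fn′ 2≤f)) =
      joins-unique (FanNamed.joins fn′) (subst₂ (Joins e)
        (≡.trans (cong (λ o → pt (FanNamed.apex fn ℕ.+ o)) (ℕₚ.suc-injective o≡))
            (pt-shift (FanNamed.offset fn′) a≡)) (pt-shift m a≡) (FanNamed.joins fn))
    others : ∀ y → y ∈ inequalityIndices n k → y ≢ tag e → 0# ≤ inequality k y (basis g)
    others y y∈ y≢ with classify y∈
    ... | inj₁ (f , ≡.refl , m<f) = ≤-reflexive (sym (s-far (basis-far {g} g≤k) f m<f))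
    ... | inj₂ (f , ≡.refl , 2≤f , f≤m) = ≤-reflexive
        (sym (trans (value f (fanName f≤m) 2≤f f≤m) (trans (-‿cong (reflexive
            (basis-other g (shrunk (fanName f≤m))
                (λ eq → y≢ (cong tag (shrunk-injective (fanName f≤m) 2≤f eq)))))) -0#≈0#)))

  irredundant : Irredundant (inequalityIndices n k) (inequality k)
  irredundant x x∈ with classify x∈
  ... | inj₁ (e , ≡.refl , m<d)       = irredundant-long e m<d
  ... | inj₂ (e , ≡.refl , 2≤d , d≤m) = irredundant-short e 2≤d d≤m

  -- With no short edges left, the decomposition for k = 0 expresses v by cuts alone.
  FP⊆Grob : FP ⊆ Grob k
  FP⊆Grob {v} fp = Grob-resp-≋ (λ e → sym (C₀.decompose v e))
      (Grob-⊕ (Grob-⊕ (Span⇒Grob (C₀.remainder-Span v))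
      (Grob-comb D₀.shorts (C₀.shortCoeff-nonNeg {v} (λ { a zero _ → ≤-refl }))
        (λ {x} x∈ → ⊥-elim (ℕₚ.<⇒≱ (Named.0<d (name x)) (D₀.∈-shorts⁻ x∈)))))
      (Grob-comb D₀.longs (C₀.longCoeff-nonNeg (FP⇒0≤s fp)) (λ {x} _ → Grob-W x)))
    where
    module D₀ = Decomposition F n 3≤n 0 3≤n
    module C₀ = Cones F n 3≤n 0 3≤n

open import Data.Nat.Base using (_≤_; _+_; _*_; _∸_)

theorem1p7 : ∀ {c ℓ₁ ℓ₂} (F : OrderedField c ℓ₁ ℓ₂) (k n : ℕ) → 1 ≤ k → 2 * k + 3 ≤ n →
    let open EdgeSpace F n in
    (HasDimension (Lineality (Grob k)) n × IsSimplicialModuloLineality (Grob k))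
    × (Lineality (Grob k) ≐ Span (allFin n) star)
    × (∀ e → e ∈ longGeneratorEdges n k → IsRayOfFP e (W e))
    × (Grob k ≐ (Span (allFin n) star ⊞ Cone (shortGeneratorEdges n k) (λ e → ⊝ basis e) ⊞ Cone (longGeneratorEdges n k) W))
    × Describes (inequalityIndices n k) (inequality k) (Grob k)
    × Irredundant (inequalityIndices n k) (inequality k)
    × (length (inequalityIndices n k) ≡ (n C 2) ∸ n)
    × (FP ⊆ Grob k)
theorem1p7 F k n 1≤k 2k+3≤n =
    ( (star , (Uniqueₚ.allFin⁺ n , λ a eq x _ → star-independent a eq x) , Lineality⊆Span , Span⊆Lineality)
    , ((Edge n ⊎ Edge n) , simplicialIndices , generator , (simplicialIndices-unique , generators-independent 1≤k) , Grob⇒Simplicial , Simplicial⇒Grob))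
  , (Lineality⊆Span , Span⊆Lineality)
  , (λ e _ → W-ray e)
  , ((λ G → Holds⇒Generated (Grob⇒Holds G)) , Generated⇒Grob)
  , ((λ G → All.tabulate (Grob⇒Holds G)) , λ H → Generated⇒Grob (Holds⇒Generated (All.lookup H)))
  , irredundant
  , length-inequalityIndices k 1≤k
  , FP⊆Grob
  where
  3≤n : 3 ℕ.≤ n
  3≤n = ℕₚ.≤-trans (ℕₚ.m≤n+m 3 (2 ℕ.* k)) 2k+3≤n
  m+m<n : suc k ℕ.+ suc k ℕ.< n
  m+m<n = subst (ℕ._≤ n) size 2k+3≤n
    where
    size : 2 ℕ.* k ℕ.+ 3 ≡ suc (suc k ℕ.+ suc k)
    size = ≡.trans (ℕₚ.+-comm (2 ℕ.* k) 3) (cong (λ x → suc (suc x)) (≡.trans (cong (λ j → suc (k ℕ.+ j)) (ℕₚ.+-identityʳ k)) (≡.sym (ℕₚ.+-suc k k))))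
  open EdgeSpace F n
  open Distances n 3≤n
  open Generators F n 3≤n k
  open Cones F n 3≤n k m+m<n
  open FourPoint F n 3≤n
  open Facets F n 3≤n k m+m<n 1≤k
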